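{- For any $n$-node, $m$-edge directed weighted graph $G$ with a unique shortest path between each (ordered) pair of nodes, the system $\Pi$ of all these shortest paths satisfies $$\mathrm{herdisc}_v(\Pi)\le O(n^{1/4})\qquad\text{and}\qquad \mathrm{herdisc}_e(\Pi)\le O(m^{1/4}).$$
   Context: Weighted graphs have real edge weights for which shortest paths exist (no negative cycles). For a matrix $A\in\mathbb R^{k\times N}$, $\mathrm{disc}(A)=\min_{x\in\{1,-1\}^N}\|Ax\|_\infty$, and $\mathrm{herdisc}(A)=\max_{Y\subseteq[N]}\mathrm{disc}(A_Y)$, where $A_Y$ is the submatrix of $A$ keeping all rows and only the columns indexed by $Y$. For a set $\Pi$ of paths in a graph $G=(V,E)$, the vertex (respectively edge) incidence matrix is the $\{0,1\}$-matrix with rows indexed by $\Pi$ and columns indexed by $V$ (respectively $E$) whose entry is $1$ iff the vertex (respectively edge) lies on the path. $\mathrm{herdisc}_v(\Pi)$ and $\mathrm{herdisc}_e(\Pi)$ denote the hereditary discrepancy of the vertex and edge incidence matrix, respectively. The constants hidden in $O(\cdot)$ are absolute. -}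

module Defs where

open import Data.Bool.Base using (if_then_else_)
open import Data.Fin.Base using (Fin)
import Data.Fin.Properties as Fin
open import Data.Fin.Subset using (Subset; inside; outside; ∣_∣)
open import Data.Integer.Base as ℤ using (ℤ; 0ℤ; 1ℤ)
open import Data.List.Base as List using (List)
open import Data.List.Membership.DecPropositional using (_∈?_)
open import Data.List.Relation.Unary.Unique.Propositional using (Unique)
open import Data.Nat.Base as ℕ using (ℕ; zero; suc; _⊔_; _⊓_)
import Data.Nat.Properties as ℕₚ
open import Data.Product using (∃; ∃!; _×_; _,_; proj₁; proj₂; uncurry)
open import Data.Rational.Base as ℚ using (ℚ; 0ℚ; ½)
import Data.Rational.Properties as ℚₚ
open import Data.Rational.Solver using (module +-*-Solver)
open import Data.Sign.Base using (Sign)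
open import Data.Vec.Base as Vec using (Vec; []; _∷_)
open import Function.Definitions using (Injective)
open import Relation.Binary.Construct.Closure.ReflexiveTransitive using (Star; ε; _◅_)
open import Relation.Binary.PropositionalEquality using (_≡_; refl; sym; trans; cong; subst)
open import Relation.Nullary.Decidable using (Dec; does)

------------------------------------------------------------------------
-- Real numbers: Cauchy sequences of rationals with a modulus of convergence.
-- Two reals x and y are equal when x ≤ᴿ y and y ≤ᴿ x.

record ℝ : Set where
  field
    approx : ℕ → ℚ
    cauchy : ∀ δ → 0ℚ ℚ.< δ →
             ∃ λ N → ∀ i j → N ℕ.≤ i → N ℕ.≤ j →
             ℚ.∣ approx i ℚ.- approx j ∣ ℚ.≤ δ

open ℝ public

infixl 6 _+ᴿ_
infix  4 _≤ᴿ_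

_≤ᴿ_ : ℝ → ℝ → Set
x ≤ᴿ y = ∀ δ → 0ℚ ℚ.< δ →
         ∃ λ N → ∀ i → N ℕ.≤ i → approx x i ℚ.≤ approx y i ℚ.+ δ

0ᴿ : ℝ
0ᴿ .approx _ = 0ℚ
0ᴿ .cauchy δ 0<δ = 0 , λ _ _ _ _ → ℚₚ.<⇒≤ 0<δ

_+ᴿ_ : ℝ → ℝ → ℝ
(x +ᴿ y) .approx i = approx x i ℚ.+ approx y i
(x +ᴿ y) .cauchy δ 0<δ = Nx ⊔ Ny , close
  where
  δ/2 : ℚ
  δ/2 = ½ ℚ.* δ

  0<δ/2 : 0ℚ ℚ.< δ/2
  0<δ/2 = subst (ℚ._< δ/2) (ℚₚ.*-zeroʳ ½) (ℚₚ.*-monoʳ-<-pos ½ 0<δ)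

  halves : δ/2 ℚ.+ δ/2 ≡ δ
  halves = trans (sym (ℚₚ.*-distribʳ-+ δ ½ ½)) (ℚₚ.*-identityˡ δ)

  Nx Ny : ℕ
  Nx = proj₁ (cauchy x δ/2 0<δ/2)
  Ny = proj₁ (cauchy y δ/2 0<δ/2)

  regroup : ∀ a b c d → (a ℚ.+ b) ℚ.- (c ℚ.+ d) ≡ (a ℚ.- c) ℚ.+ (b ℚ.- d)
  regroup = solve 4 (λ a b c d → (a :+ b) :- (c :+ d) := (a :- c) :+ (b :- d)) refl
    where open +-*-Solver

  close : ∀ i j → Nx ⊔ Ny ℕ.≤ i → Nx ⊔ Ny ℕ.≤ j →
          ℚ.∣ (approx x i ℚ.+ approx y i) ℚ.- (approx x j ℚ.+ approx y j) ∣ ℚ.≤ δ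
  close i j N≤i N≤j = begin
    ℚ.∣ (xi ℚ.+ yi) ℚ.- (xj ℚ.+ yj) ∣      ≡⟨ cong ℚ.∣_∣ (regroup xi yi xj yj) ⟩
    ℚ.∣ (xi ℚ.- xj) ℚ.+ (yi ℚ.- yj) ∣      ≤⟨ ℚₚ.∣p+q∣≤∣p∣+∣q∣ (xi ℚ.- xj) (yi ℚ.- yj) ⟩
    ℚ.∣ xi ℚ.- xj ∣ ℚ.+ ℚ.∣ yi ℚ.- yj ∣    ≤⟨ ℚₚ.+-mono-≤ dx dy ⟩
    δ/2 ℚ.+ δ/2                            ≡⟨ halves ⟩
    δ                                      ∎
    where
    open ℚₚ.≤-Reasoning
    xi = approx x i
    xj = approx x j
    yi = approx y i
    yj = approx y j
    dx = proj₂ (cauchy x δ/2 0<δ/2) i j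
           (ℕₚ.m⊔n≤o⇒m≤o Nx Ny N≤i) (ℕₚ.m⊔n≤o⇒m≤o Nx Ny N≤j)
    dy = proj₂ (cauchy y δ/2 0<δ/2) i j
           (ℕₚ.m⊔n≤o⇒n≤o Nx Ny N≤i) (ℕₚ.m⊔n≤o⇒n≤o Nx Ny N≤j)

------------------------------------------------------------------------
-- Discrepancy. Matrices have integer entries, which covers incidence
-- matrices, so that discrepancies are natural numbers.

Matrix : ℕ → ℕ → Set
Matrix k N = Vec (Vec ℤ N) k

-- The i-th entry of A x, for x in {1,-1}^N.
dot : ∀ {N} → Vec ℤ N → Vec Sign N → ℤ
dot []       []       = 0ℤ
dot (a ∷ as) (s ∷ ss) = a ℤ.* (s ℤ.◃ 1) ℤ.+ dot as ss

‖_·_‖∞ : ∀ {k N} → Matrix k N → Vec Sign N → ℕ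
‖ A · x ‖∞ = Vec.foldr′ _⊔_ 0 (Vec.map (λ row → ℤ.∣ dot row x ∣) A)

minOverSigns : ∀ N → (Vec Sign N → ℕ) → ℕ
minOverSigns zero    f = f []
minOverSigns (suc N) f = minOverSigns N (λ x → f (Sign.+ ∷ x))
                       ⊓ minOverSigns N (λ x → f (Sign.- ∷ x))

maxOverSubsets : ∀ N → (Subset N → ℕ) → ℕ
maxOverSubsets zero    f = f []
maxOverSubsets (suc N) f = maxOverSubsets N (λ Y → f (inside ∷ Y))
                         ⊔ maxOverSubsets N (λ Y → f (outside ∷ Y))

disc : ∀ {k N} → Matrix k N → ℕ
disc {N = N} A = minOverSigns N (λ x → ‖ A · x ‖∞)

select : ∀ {A : Set} {N} (Y : Subset N) → Vec A N → Vec A ∣ Y ∣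
select []            []       = []
select (inside ∷ Y)  (a ∷ as) = a ∷ select Y as
select (outside ∷ Y) (a ∷ as) = select Y as

columns : ∀ {k N} → Matrix k N → (Y : Subset N) → Matrix k ∣ Y ∣
columns A Y = Vec.map (select Y) A

herdisc : ∀ {k N} → Matrix k N → ℕ
herdisc {N = N} A = maxOverSubsets N (λ Y → disc (columns A Y))

------------------------------------------------------------------------
-- Weighted directed graphs with vertex set Fin n. By injectivity of `ends`
-- the edges form an m-element set of ordered pairs (source , target).

record WeightedDigraph (n m : ℕ) : Set where
  field
    ends           : Fin m → Fin n × Fin n
    ends-injective : Injective _≡_ _≡_ ends
    weight         : Fin m → ℝ

module _ {n m : ℕ} (G : WeightedDigraph n m) where
  open WeightedDigraph G

  Edge : Fin n → Fin n → Set
  Edge u v = ∃ λ e → ends e ≡ (u , v)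

  Walk : Fin n → Fin n → Set
  Walk = Star Edge

  vertices : ∀ {u v} → Walk u v → List (Fin n)
  vertices {u} ε       = u List.∷ List.[]
  vertices {u} (_ ◅ w) = u List.∷ vertices w

  edges : ∀ {u v} → Walk u v → List (Fin m)
  edges ε             = List.[]
  edges ((e , _) ◅ w) = e List.∷ edges w

  length : ∀ {u v} → Walk u v → ℝ
  length ε             = 0ᴿ
  length ((e , _) ◅ w) = weight e +ᴿ length w

  IsPath : ∀ {u v} → Walk u v → Set
  IsPath w = Unique (vertices w)

  -- A cycle is an edge from u to x together with a path from x back to u
  -- (a self-loop when x is u).
  NoNegativeCycle : Set
  NoNegativeCycle = ∀ {u x} (e : Edge u x) (p : Walk x u) → IsPath p →
                    0ᴿ ≤ᴿ length (e ◅ p)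

  IsShortestPath : ∀ {u v} → Walk u v → Set
  IsShortestPath {u} {v} p =
    IsPath p × (∀ (q : Walk u v) → IsPath q → length p ≤ᴿ length q)

  UniqueShortestPaths : Set
  UniqueShortestPaths = ∀ u v → ∃! _≡_ (IsShortestPath {u} {v})

  record Path : Set where
    constructor path
    field
      {source target} : Fin n
      walk   : Walk source target
      isPath : IsPath walk

  open Path

  indicator : ∀ {P : Set} → Dec P → ℤ
  indicator P? = if does P? then 1ℤ else 0ℤ

  vertexIncidence : ∀ {k} → Vec Path k → Matrix k n
  vertexIncidence = Vec.map λ p → Vec.tabulate λ x →
    indicator (_∈?_ Fin._≟_ x (vertices (walk p)))

  edgeIncidence : ∀ {k} → Vec Path k → Matrix k m
  edgeIncidence = Vec.map λ p → Vec.tabulate λ e →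
    indicator (_∈?_ Fin._≟_ e (edges (walk p)))

  herdiscᵥ : ∀ {k} → Vec Path k → ℕ
  herdiscᵥ Π = herdisc (vertexIncidence Π)

  herdiscₑ : ∀ {k} → Vec Path k → ℕ
  herdiscₑ Π = herdisc (edgeIncidence Π)

  -- Paths for distinct pairs are distinct, so this lists a set without
  -- repetition. The pairs (u , u) contribute the one-vertex paths.
  shortestPaths : UniqueShortestPaths → Vec Path (n ℕ.* n)
  shortestPaths usp = Vec.map (uncurry shortest) (Vec.allPairs (Vec.allFin n) (Vec.allFin n))
    where
    shortest : Fin n → Fin n → Path
    shortest u v with (p , (p-path , _) , _) ← usp u v = path p p-path

{-# OPTIONS --safe #-}
module Submission where

-- Call two lists consistent if they agree between any two elements that both visit in the same
-- order. Vertex and edge lists of unique shortest paths are consistent, since subpaths of shortest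
-- paths are shortest. On a ground set of size N, consistency gives nets: choose greedily traces
-- such that the sets (first δ elements) × (last δ elements) are pairwise disjoint. There are at
-- most N²/δ² of them, and a trace that shares such a pair (x , y) with a chosen one agrees with it
-- from x to y, hence differs from it in at most 4δ elements.
--
-- With nets at all scales δ = 2^(8e), every trace is a telescoping sum of differences of net
-- elements. Round the values of these differences under a coloring to multiples of a width that is
-- about N^(1/4) at the scale √N and decays geometrically away from it. The second moment (δ ≥ √N)
-- and the sixth moment (δ ≤ √N) of a random signed sum show that the rounded values are described
-- by few bits on average, so by the pigeonhole principle exponentially many colorings share them.
-- Two of these differ in N/16 places, and half their difference is a partial coloring of
-- discrepancy O(N^(1/4)). Recursion on the uncolored part gives a geometric series.

open import Defs
open import Data.Bool.Base using (Bool; true; false; if_then_else_)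
open import Data.Fin.Base using (Fin)
import Data.Fin.Properties as Finₚ
open import Data.Fin.Subset using (Subset; inside; outside; ∣_∣)
open import Data.Fin.Subset.Properties using (∣p∣≤n)
import Data.Integer.Base as ℤ
open import Data.Integer.Base using (ℤ; +_; -[1+_])
import Data.Integer.Properties as ℤₚ
import Data.Integer.Tactic.RingSolver as ℤ-Solver
open import Data.List.Base as List using (List; []; _∷_; _++_)
import Data.List.Membership.DecPropositional as DecMembership
open import Data.List.Membership.Propositional using (_∈_; _∉_; find; lose)
open import Data.List.Membership.Propositional.Properties
import Data.List.Properties as Listₚ
open import Data.List.Relation.Binary.Disjoint.Propositional using (Disjoint)
open import Data.List.Relation.Binary.Sublist.Propositional using (_⊆_; []; _∷_; _∷ʳ_; ⊆-refl; ⊆-trans; lookup)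
import Data.List.Relation.Binary.Sublist.Propositional.Properties as Subₚ
open import Data.List.Relation.Unary.All as All using (All; []; _∷_)
import Data.List.Relation.Unary.All.Properties as Allₚ
open import Data.List.Relation.Unary.AllPairs using (AllPairs; []; _∷_)
open import Data.List.Relation.Unary.Any using (Any; here; there; any?)
open import Data.List.Relation.Unary.Unique.Propositional using (Unique)
import Data.List.Relation.Unary.Unique.Propositional.Properties as Uniqueₚ
open import Data.Nat.Base
import Data.Nat.DivMod as DivMod
open import Data.Nat.Induction using (<-wellFounded)
open import Data.Nat.Properties
open import Data.Nat.Tactic.RingSolver using (solve-∀)
open import Data.Product using (∃; _×_; _,_; proj₁; proj₂)
import Data.Product.Properties as Productₚ
import Data.Rational.Base as ℚ
open import Data.Rational.Base using (ℚ; 0ℚ)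
import Data.Rational.Properties as ℚₚ
open import Data.Rational.Solver using (module +-*-Solver)
import Data.Sign.Base as Sign
open import Data.Sign.Base using (Sign)
open import Data.Sum.Base using (_⊎_; inj₁; inj₂)
open import Data.Unit.Base using (tt)
open import Data.Vec.Base as Vec using (Vec; []; _∷_)
import Data.Vec.Properties as Vecₚ
open import Data.Vec.Relation.Unary.All as VecAll using ([]; _∷_)
import Data.Vec.Relation.Unary.All.Properties as VecAllₚ
open import Function.Base using (_∘_; id)
open import Induction.WellFounded using (Acc; acc)
open import Relation.Binary.Construct.Closure.ReflexiveTransitive using (ε; _◅_; _◅◅_)
open import Relation.Binary.Construct.Closure.ReflexiveTransitive.Properties using (◅◅-assoc)
open import Relation.Binary.Definitions using (DecidableEquality)
open import Relation.Binary.PropositionalEquality using (_≡_; _≢_; refl; sym; trans; cong; cong₂; subst; subst₂; module ≡-Reasoning)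
open import Relation.Nullary using (¬_; Dec; yes; no; does; contradiction)
open import Relation.Nullary.Decidable using (¬?; dec-true; dec-false)
open import Relation.Unary using (Decidable)

-- Finite sums

-- Why 1/4: at scale √N a net has about N members, which matches the N bits of a coloring, and a
-- difference of about √N elements has a random sum of about N^(1/4). From one level to the next the
-- size of a difference changes by 2^8, hence its typical sum by 2^4, and the bound on the number of
-- members by 2^16 in the opposite direction, while the width only halves away from the peak. Above
-- √N the members thin out faster than the sums outgrow the widths. Below √N the members multiply,
-- and nonzero codes must be rare enough to beat their number; at these rates the sixth moment is
-- the first even one that achieves this. Entropy would bring in logarithms. Instead, each unit of a
-- rounded value has an integral price in bits, which rises away from the peak, and a product of
-- Kraft type bounds the number of code vectors within a budget. Roots are avoided by stating the
-- final bounds for fourth powers.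

∑ : {A : Set} → List A → (A → ℕ) → ℕ
∑ []       f = 0
∑ (x ∷ xs) f = f x + ∑ xs f

∑-mono : ∀ {A : Set} {f g : A → ℕ} xs → (∀ x → f x ≤ g x) → ∑ xs f ≤ ∑ xs g
∑-mono []       f≤g = z≤n
∑-mono (x ∷ xs) f≤g = +-mono-≤ (f≤g x) (∑-mono xs f≤g)

∑-cong : ∀ {A : Set} {f g : A → ℕ} xs → (∀ x → f x ≡ g x) → ∑ xs f ≡ ∑ xs g
∑-cong []       f≡g = refl
∑-cong (x ∷ xs) f≡g = cong₂ _+_ (f≡g x) (∑-cong xs f≡g)

∑-+ : ∀ {A : Set} (f g : A → ℕ) xs → ∑ xs (λ x → f x + g x) ≡ ∑ xs f + ∑ xs g
∑-+ f g []       = refl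
∑-+ f g (x ∷ xs) rewrite ∑-+ f g xs = lem (f x) (g x) (∑ xs f) (∑ xs g)
  where
  lem : ∀ a b c d → a + b + (c + d) ≡ a + c + (b + d)
  lem = solve-∀

∑-*ˡ : ∀ {A : Set} k (f : A → ℕ) xs → ∑ xs (λ x → k * f x) ≡ k * ∑ xs f
∑-*ˡ k f []       = sym (*-zeroʳ k)
∑-*ˡ k f (x ∷ xs) rewrite ∑-*ˡ k f xs = sym (*-distribˡ-+ k (f x) (∑ xs f))

∑-*ʳ : ∀ {A : Set} k (f : A → ℕ) xs → ∑ xs (λ x → f x * k) ≡ ∑ xs f * k
∑-*ʳ k f []       = refl
∑-*ʳ k f (x ∷ xs) rewrite ∑-*ʳ k f xs = sym (*-distribʳ-+ k (f x) (∑ xs f))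

∑-const : ∀ {A : Set} k (xs : List A) → ∑ xs (λ _ → k) ≡ List.length xs * k
∑-const k []       = refl
∑-const k (x ∷ xs) = cong (λ s → k + s) (∑-const k xs)

∑-++ : ∀ {A : Set} (f : A → ℕ) xs ys → ∑ (xs ++ ys) f ≡ ∑ xs f + ∑ ys f
∑-++ f []       ys = refl
∑-++ f (x ∷ xs) ys rewrite ∑-++ f xs ys = sym (+-assoc (f x) (∑ xs f) (∑ ys f))

∑-map : ∀ {A B : Set} (f : B → ℕ) (h : A → B) xs → ∑ (List.map h xs) f ≡ ∑ xs (f ∘ h)
∑-map f h []       = refl
∑-map f h (x ∷ xs) = cong (λ k → f (h x) + k) (∑-map f h xs)

∑-zero : ∀ {A : Set} (xs : List A) → ∑ xs (λ _ → 0) ≡ 0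
∑-zero []       = refl
∑-zero (x ∷ xs) = ∑-zero xs

∑-swap : ∀ {A B : Set} (f : A → B → ℕ) xs ys → ∑ xs (λ x → ∑ ys (f x)) ≡ ∑ ys (λ y → ∑ xs (λ x → f x y))
∑-swap f []       ys = sym (∑-zero ys)
∑-swap f (x ∷ xs) ys = trans (cong (λ k → ∑ ys (f x) + k) (∑-swap f xs ys)) (sym (∑-+ (f x) (λ y → ∑ xs (λ x → f x y)) ys))

∑-⊆ : ∀ {A : Set} (f : A → ℕ) {xs ys} → xs ⊆ ys → ∑ xs f ≤ ∑ ys f
∑-⊆ f []         = z≤n
∑-⊆ f (y ∷ʳ τ)   = ≤-trans (∑-⊆ f τ) (m≤n+m _ (f y))
∑-⊆ f (refl ∷ τ) = +-monoʳ-≤ _ (∑-⊆ f τ)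

∑-≤-const : ∀ {A : Set} (f : A → ℕ) K {xs} → All (λ x → f x ≤ K) xs → ∑ xs f ≤ List.length xs * K
∑-≤-const f K []       = z≤n
∑-≤-const f K (p ∷ ps) = +-mono-≤ p (∑-≤-const f K ps)

const-≤-∑ : ∀ {A : Set} (f : A → ℕ) K {xs} → All (λ x → K ≤ f x) xs → List.length xs * K ≤ ∑ xs f
const-≤-∑ f K []       = z≤n
const-≤-∑ f K (p ∷ ps) = +-mono-≤ p (const-≤-∑ f K ps)

length-filter-+ : ∀ {A : Set} {P : A → Set} (P? : Decidable P) xs →
  List.length (List.filter P? xs) + List.length (List.filter (λ x → ¬? (P? x)) xs) ≡ List.length xs
length-filter-+ P? []       = refl
length-filter-+ P? (x ∷ xs) with P? x
... | yes _ = cong suc (length-filter-+ P? xs)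
... | no  _ = trans (+-suc _ _) (cong suc (length-filter-+ P? xs))

markov : ∀ {A : Set} (f : A → ℕ) xs K L → ∑ xs f ≤ List.length xs * K → 2 * K ≤ L →
  List.length xs ≤ 2 * List.length (List.filter (λ x → f x ≤? L) xs)
markov f xs K L ∑f≤ 2K≤L = ≮⇒≥ λ 2small<all → <-irrefl refl (absurd 2small<all)
  where
  small large : ℕ
  small = List.length (List.filter (λ x → f x ≤? L) xs)
  large = List.length (List.filter (λ x → ¬? (f x ≤? L)) xs)
  large-bound : large * suc L ≤ List.length xs * K
  large-bound = ≤-trans
    (const-≤-∑ f (suc L) (All.map ≰⇒> (Allₚ.all-filter (λ x → ¬? (f x ≤? L)) xs)))
    (≤-trans (∑-⊆ f (Subₚ.filter-⊆ (λ x → ¬? (f x ≤? L)) xs)) ∑f≤)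
  split : small + large ≡ List.length xs
  split = length-filter-+ (λ x → f x ≤? L) xs
  2large : 2 * small < List.length xs → suc (List.length xs) ≤ 2 * large
  2large 2s<n = +-cancelˡ-≤ (2 * small) _ _ (begin
    2 * small + suc (List.length xs)      ≡⟨ +-suc _ _ ⟩
    suc (2 * small) + List.length xs      ≤⟨ +-monoˡ-≤ _ 2s<n ⟩
    List.length xs + List.length xs       ≡⟨ cong (λ n → n + n) (sym split) ⟩
    small + large + (small + large)       ≡⟨ lem small large ⟩
    2 * small + 2 * large ∎)
    where
    open ≤-Reasoning
    lem : ∀ a b → a + b + (a + b) ≡ 2 * a + 2 * b
    lem = solve-∀
  absurd : 2 * small < List.length xs → List.length xs * L + List.length xs < List.length xs * L + List.length xs
  absurd 2s<n = begin-strict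
    List.length xs * L + List.length xs     ≡⟨ lem (List.length xs) L ⟩
    List.length xs * suc L                  <⟨ *-monoˡ-< (suc L) (2large 2s<n) ⟩
    2 * large * suc L                       ≡⟨ *-assoc 2 large (suc L) ⟩
    2 * (large * suc L)                     ≤⟨ *-monoʳ-≤ 2 large-bound ⟩
    2 * (List.length xs * K)                ≡⟨ lem₂ (List.length xs) K ⟩
    List.length xs * (2 * K)                ≤⟨ *-monoʳ-≤ (List.length xs) 2K≤L ⟩
    List.length xs * L                      ≤⟨ m≤m+n _ _ ⟩
    List.length xs * L + List.length xs     ∎
    where
    open ≤-Reasoning
    lem : ∀ n l → n * l + n ≡ n * suc l
    lem = solve-∀
    lem₂ : ∀ n k → 2 * (n * k) ≡ n * (2 * k)
    lem₂ = solve-∀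

-- Pigeonhole principle for priced codes

record Code (A : Set) : Set where
  constructor mkCode
  field
    code   : A → ℕ
    price  : ℕ
    excess : ℕ

open Code public

cost : {A : Set} → List (Code A) → A → ℕ
cost cs χ = ∑ cs (λ c → price c * code c χ)

∏ : {A : Set} → ℕ → List (Code A) → ℕ
∏ H []       = 1
∏ H (c ∷ cs) = (H + excess c) * ∏ H cs

-- With ε = `excess c` / H and p = `price c`, the second inequality says 1 / (1 - 2^(-p)) ≤ 1 + ε:
-- the geometric series that gives the code value k the weight 2^(-p k) is at most 1 + ε. Hence at
-- most 2^L times the product of all 1 + ε code vectors have cost at most L. `∏` is this product
-- with the common denominator H cleared.
Fair : {A : Set} → ℕ → Code A → Set
Fair H c = 1 ≤ price c × H + excess c ≤ 2 ^ price c * excess c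

SameCode : {A : Set} → List (Code A) → List A → Set
SameCode cs 𝒳 = ∀ {χ χ'} → χ ∈ 𝒳 → χ' ∈ 𝒳 → All (λ c → code c χ ≡ code c χ') cs

-- Either many elements have first code 0, and the class is found among them, or many have a
-- positive first code, which is then decremented at the expense of its price.
pigeonhole : ∀ {A : Set} B H (cs : List (Code A)) → All (Fair H) cs →
  ∀ fuel L → L ≤ fuel → ∀ 𝒳 → All (λ χ → cost cs χ ≤ L) 𝒳 →
  B * (2 ^ L * ∏ H cs) < List.length 𝒳 * H ^ List.length cs →
  ∃ λ 𝒴 → 𝒴 ⊆ 𝒳 × B < List.length 𝒴 × SameCode cs 𝒴
pigeonhole B H [] [] fuel L L≤ 𝒳 cheap big = 𝒳 , ⊆-refl , B<𝒳 , λ _ _ → []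
  where
  B<𝒳 : B < List.length 𝒳
  B<𝒳 = begin-strict
    B                 ≡⟨ sym (*-identityʳ B) ⟩
    B * 1             ≤⟨ *-monoʳ-≤ B (m^n>0 2 L) ⟩
    B * 2 ^ L         ≡⟨ cong (B *_) (sym (*-identityʳ (2 ^ L))) ⟩
    B * (2 ^ L * 1)   <⟨ big ⟩
    List.length 𝒳 * 1 ≡⟨ *-identityʳ _ ⟩
    List.length 𝒳     ∎
    where open ≤-Reasoning
pigeonhole {A} B H (c ∷ cs) ((1≤p , fair) ∷ fairs) fuel L L≤ 𝒳 cheap big
  with B * (2 ^ L * ∏ H cs) <? List.length (List.filter (λ χ → code c χ ≟ 0) 𝒳) * H ^ List.length cs
... | yes bigZ =
  let Z? = λ χ → code c χ ≟ 0
      𝒴 , 𝒴⊆Z , B<𝒴 , same = pigeonhole B H cs fairs fuel L L≤ (List.filter Z? 𝒳)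
        (All.map (λ le → ≤-trans (m≤n+m _ _) le)
          (Subₚ.All-resp-⊆ (Subₚ.filter-⊆ Z? 𝒳) cheap)) bigZ
      zero-on : ∀ {χ} → χ ∈ 𝒴 → code c χ ≡ 0
      zero-on χ∈ = All.lookup (Allₚ.all-filter Z? 𝒳) (lookup 𝒴⊆Z χ∈)
  in 𝒴 , ⊆-trans 𝒴⊆Z (Subₚ.filter-⊆ Z? 𝒳) , B<𝒴 ,
     λ χ∈ χ'∈ → trans (zero-on χ∈) (sym (zero-on χ'∈)) ∷ same χ∈ χ'∈
... | no ¬bigZ = positive fuel L≤
  where
  Z? = λ χ → code c χ ≟ 0
  R? = λ χ → ¬? (Z? χ)
  Z R : List A
  Z = List.filter Z? 𝒳
  R = List.filter R? 𝒳
  M = List.length cs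
  p = price c

  -- The factor `H + excess c` is split: if the zeros do not exceed the share of H, then the
  -- positive codes exceed the share of `excess c`.
  bigR : B * (2 ^ L * (excess c * ∏ H cs)) < List.length R * H ^ suc M
  bigR = +-cancelˡ-< (B * (2 ^ L * ∏ H cs) * H) _ _ (begin-strict
    B * (2 ^ L * ∏ H cs) * H + B * (2 ^ L * (excess c * ∏ H cs))  ≡⟨ lem₁ B (2 ^ L) (∏ H cs) H (excess c) ⟩
    B * (2 ^ L * ((H + excess c) * ∏ H cs))                       <⟨ big ⟩
    List.length 𝒳 * H ^ suc M                                     ≡⟨ cong (_* H ^ suc M) (sym (length-filter-+ Z? 𝒳)) ⟩
    (List.length Z + List.length R) * H ^ suc M                   ≡⟨ lem₂ (List.length Z) (List.length R) (H ^ M) H ⟩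
    List.length Z * H ^ M * H + List.length R * H ^ suc M         ≤⟨ +-monoˡ-≤ _ (*-monoˡ-≤ H (≮⇒≥ ¬bigZ)) ⟩
    B * (2 ^ L * ∏ H cs) * H + List.length R * H ^ suc M          ∎)
    where
    open ≤-Reasoning
    lem₁ : ∀ b l π h x → b * (l * π) * h + b * (l * (x * π)) ≡ b * (l * ((h + x) * π))
    lem₁ = solve-∀
    lem₂ : ∀ z r e h → (z + r) * (h * e) ≡ z * e * h + r * (h * e)
    lem₂ = solve-∀

  cheapR : All (λ χ → cost (c ∷ cs) χ ≤ L) R
  cheapR = Subₚ.All-resp-⊆ (Subₚ.filter-⊆ R? 𝒳) cheap

  positiveR : All (λ χ → code c χ ≢ 0) R
  positiveR = Allₚ.all-filter R? 𝒳

  c⁻ : Code A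
  c⁻ = mkCode (λ χ → code c χ ∸ 1) p (excess c)

  pay : ∀ p k r → k ≢ 0 → p * k + r ≡ p + (p * (k ∸ 1) + r)
  pay p zero    r k≢0 = contradiction refl k≢0
  pay p (suc k) r _   = lem p k r
    where
    lem : ∀ p k r → p * suc k + r ≡ p + (p * k + r)
    lem = solve-∀

  positive : ∀ fuel → L ≤ fuel → ∃ λ 𝒴 → 𝒴 ⊆ 𝒳 × B < List.length 𝒴 × SameCode (c ∷ cs) 𝒴
  positive fuel L≤ with p ≤? L
  -- A positive code alone costs p > L, so `R` would be empty, against `bigR`.
  ... | no p≰L = contradiction refl (impossible R)
    where
    impossible : ∀ ys → R ≢ ys
    impossible []       eq = n≮0 (subst (λ ys → _ < List.length ys * H ^ suc M) eq bigR)
    impossible (y ∷ ys) eq with subst (All _) eq positiveR | subst (All _) eq cheapR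
    ... | y≢0 ∷ _ | y≤L ∷ _ =
      p≰L (≤-trans (m≤m+n p _) (≤-trans (≤-reflexive (sym (pay p (code c y) _ y≢0))) y≤L))
  positive zero    L≤ | yes p≤L = contradiction (≤-trans 1≤p (≤-trans p≤L L≤)) λ ()
  positive (suc fuel) L≤ | yes p≤L =
    let 𝒴 , 𝒴⊆R , B<𝒴 , same = pigeonhole B H (c⁻ ∷ cs) ((1≤p , fair) ∷ fairs) fuel (L ∸ p)
          (≤-trans (∸-monoʳ-≤ L 1≤p) (∸-monoˡ-≤ 1 L≤)) R
          (All.zipWith (λ {χ} (≢0 , le) → m+n≤o⇒m≤o∸n _
             (≤-trans (≤-reflexive (trans (+-comm _ p) (sym (pay p (code c χ) _ ≢0)))) le)) (positiveR , cheapR))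
          big⁻
        pos-on : ∀ {χ} → χ ∈ 𝒴 → code c χ ≢ 0
        pos-on χ∈ = All.lookup positiveR (lookup 𝒴⊆R χ∈)
        extend : ∀ {χ χ'} → χ ∈ 𝒴 → χ' ∈ 𝒴 → All (λ c → code c χ ≡ code c χ') (c⁻ ∷ cs) → All (λ c → code c χ ≡ code c χ') (c ∷ cs)
        extend = λ χ∈ χ'∈ → λ where (eq ∷ eqs) → pred-injective′ (pos-on χ∈) (pos-on χ'∈) eq ∷ eqs
    in 𝒴 , ⊆-trans 𝒴⊆R (Subₚ.filter-⊆ R? 𝒳) , B<𝒴 , λ χ∈ χ'∈ → extend χ∈ χ'∈ (same χ∈ χ'∈)
    where
    pred-injective′ : ∀ {m n} → m ≢ 0 → n ≢ 0 → m ∸ 1 ≡ n ∸ 1 → m ≡ n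
    pred-injective′ {zero}  m≢0 n≢0 eq = contradiction refl m≢0
    pred-injective′ {suc m} {zero}  m≢0 n≢0 eq = contradiction refl n≢0
    pred-injective′ {suc m} {suc n} m≢0 n≢0 eq = cong suc eq
    -- This is where the price is fair: the share `excess c` at budget L is worth at least the full
    -- factor `H + excess c` at budget L - p.
    big⁻ : B * (2 ^ (L ∸ p) * ((H + excess c) * ∏ H cs)) < List.length R * H ^ suc M
    big⁻ = ≤-<-trans (*-monoʳ-≤ B (begin
      2 ^ (L ∸ p) * ((H + excess c) * ∏ H cs)            ≤⟨ *-monoʳ-≤ (2 ^ (L ∸ p)) (*-monoˡ-≤ (∏ H cs) fair) ⟩
      2 ^ (L ∸ p) * (2 ^ p * excess c * ∏ H cs)          ≡⟨ lem (2 ^ (L ∸ p)) (2 ^ p) (excess c) (∏ H cs) ⟩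
      2 ^ (L ∸ p) * 2 ^ p * (excess c * ∏ H cs)          ≡⟨ cong (_* (excess c * ∏ H cs)) (sym (^-distribˡ-+-* 2 (L ∸ p) p)) ⟩
      2 ^ (L ∸ p + p) * (excess c * ∏ H cs)              ≡⟨ cong (λ k → 2 ^ k * (excess c * ∏ H cs)) (m∸n+n≡m p≤L) ⟩
      2 ^ L * (excess c * ∏ H cs)                        ∎)) bigR
      where
      open ≤-Reasoning
      lem : ∀ l q x π → l * (q * x * π) ≡ l * q * (x * π)
      lem = solve-∀

-- Bernoulli inequalities for the product of the excess factors

-- This is 1 + X/H ≤ (1 + 1/H)^X without denominators. It turns the product `∏` into a power of 1 +
-- 1/H whose exponent is the sum of all excesses.
bernoulli : ∀ H X → (H + X) * H ^ X ≤ H * (suc H) ^ X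
bernoulli H zero    = ≤-reflexive (cong (_* 1) (+-identityʳ H))
bernoulli H (suc X) = begin
  (H + suc X) * (H * H ^ X)             ≡⟨ lem₁ H X (H ^ X) ⟩
  H * ((H + X) * H ^ X) + H * H ^ X     ≤⟨ +-monoʳ-≤ _ (*-monoˡ-≤ (H ^ X) (m≤m+n H X)) ⟩
  H * ((H + X) * H ^ X) + (H + X) * H ^ X ≡⟨ lem₂ H ((H + X) * H ^ X) ⟩
  suc H * ((H + X) * H ^ X)             ≤⟨ *-monoʳ-≤ (suc H) (bernoulli H X) ⟩
  suc H * (H * suc H ^ X)               ≡⟨ lem₃ H (suc H ^ X) ⟩
  H * (suc H * suc H ^ X)               ∎
  where
  open ≤-Reasoning
  lem₁ : ∀ h x e → (h + suc x) * (h * e) ≡ h * ((h + x) * e) + h * e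
  lem₁ = solve-∀
  lem₂ : ∀ h e → h * e + e ≡ suc h * e
  lem₂ = solve-∀
  lem₃ : ∀ h e → suc h * (h * e) ≡ h * (suc h * e)
  lem₃ = solve-∀

∏-bernoulli : ∀ {A : Set} H (cs : List (Code A)) →
  ∏ H cs * H ^ ∑ cs excess ≤ H ^ List.length cs * suc H ^ ∑ cs excess
∏-bernoulli H []       = ≤-refl
∏-bernoulli H (c ∷ cs) = begin
  (H + X) * π * H ^ (X + S)                  ≡⟨ cong ((H + X) * π *_) (^-distribˡ-+-* H X S) ⟩
  (H + X) * π * (H ^ X * H ^ S)              ≡⟨ lem (H + X) π (H ^ X) (H ^ S) ⟩
  (H + X) * H ^ X * (π * H ^ S)              ≤⟨ *-mono-≤ (bernoulli H X) (∏-bernoulli H cs) ⟩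
  H * suc H ^ X * (H ^ M * suc H ^ S)        ≡⟨ lem H (suc H ^ X) (H ^ M) (suc H ^ S) ⟩
  H * H ^ M * (suc H ^ X * suc H ^ S)        ≡⟨ cong (H * H ^ M *_) (sym (^-distribˡ-+-* (suc H) X S)) ⟩
  H * H ^ M * suc H ^ (X + S)                ∎
  where
  open ≤-Reasoning
  X = excess c
  S = ∑ cs excess
  π = ∏ H cs
  M = List.length cs
  lem : ∀ a b c d → a * b * (c * d) ≡ a * c * (b * d)
  lem = solve-∀

-- (1 - 1/(m+1))^h ≥ 1 - h/(m+1), with denominators cleared.
bernoulli⁻ : ∀ m h k → h + k ≡ suc m → suc m ^ h * k ≤ m ^ h * suc m
bernoulli⁻ m zero    k eq = ≤-reflexive (cong (1 *_) eq)
bernoulli⁻ m (suc h) k eq = begin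
  suc m * suc m ^ h * k      ≡⟨ lem₁ m (suc m ^ h) k ⟩
  suc m * k * suc m ^ h      ≤⟨ *-monoˡ-≤ (suc m ^ h) le ⟩
  m * suc k * suc m ^ h      ≡⟨ lem₂ m (suc m ^ h) k ⟩
  m * (suc m ^ h * suc k)    ≤⟨ *-monoʳ-≤ m (bernoulli⁻ m h (suc k) (trans (+-suc h k) eq)) ⟩
  m * (m ^ h * suc m)        ≡⟨ sym (*-assoc m (m ^ h) (suc m)) ⟩
  m * m ^ h * suc m          ∎
  where
  open ≤-Reasoning
  lem₁ : ∀ m e k → suc m * e * k ≡ suc m * k * e
  lem₁ = solve-∀
  lem₂ : ∀ m e k → m * suc k * e ≡ m * (e * suc k)
  lem₂ = solve-∀
  le : suc m * k ≤ m * suc k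
  le = begin
    suc m * k  ≡⟨ +-comm k (m * k) ⟩
    m * k + k  ≤⟨ +-monoʳ-≤ (m * k) (subst (k ≤_) (suc-injective eq) (m≤n+m k h)) ⟩
    m * k + m  ≡⟨ lem₃ m k ⟩
    m * suc k  ∎
    where
    lem₃ : ∀ m k → m * k + m ≡ m * suc k
    lem₃ = solve-∀

-- `bernoulli⁻` at half the exponent gives (m / (m+1))^h ≥ (h+1) / (2h+1) ≥ 1/2, and squaring gives
-- (1 + 1/m)^m ≤ 4. The even exponent is the reason for writing H as 2 * h.
suc-^-≤ : ∀ h → let m = 2 * h in suc m ^ m ≤ 4 * m ^ m
suc-^-≤ h = begin
  suc m ^ m                ≡⟨ cong (suc m ^_) (cong (λ k → h + k) (+-identityʳ h)) ⟩
  suc m ^ (h + h)          ≡⟨ ^-distribˡ-+-* (suc m) h h ⟩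
  suc m ^ h * suc m ^ h    ≤⟨ *-mono-≤ half half ⟩
  2 * m ^ h * (2 * m ^ h)  ≡⟨ lem (m ^ h) ⟩
  4 * (m ^ h * m ^ h)      ≡⟨ cong (4 *_) (sym (^-distribˡ-+-* m h h)) ⟩
  4 * m ^ (h + h)          ≡⟨ cong (λ k → 4 * m ^ k) (cong (λ k → h + k) (sym (+-identityʳ h))) ⟩
  4 * m ^ m                ∎
  where
  open ≤-Reasoning
  m = 2 * h
  lem : ∀ e → 2 * e * (2 * e) ≡ 4 * (e * e)
  lem = solve-∀
  lem₁ : ∀ h e → 2 * e * suc h ≡ e * (suc (2 * h) + 1)
  lem₁ = solve-∀
  lem₂ : ∀ h e → e * (suc (2 * h)) + e * suc (2 * h) ≡ 2 * e * suc (2 * h)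
  lem₂ = solve-∀
  half : suc m ^ h ≤ 2 * m ^ h
  half = *-cancelʳ-≤ (suc m ^ h) (2 * m ^ h) (suc m) (begin
    suc m ^ h * suc m                   ≤⟨ *-monoʳ-≤ (suc m ^ h) (s≤s (≤-trans (≤-reflexive (cong (λ k → h + k) (+-identityʳ h))) (+-monoʳ-≤ h (n≤1+n h)))) ⟩
    suc m ^ h * (suc h + suc h)         ≡⟨ *-distribˡ-+ (suc m ^ h) (suc h) (suc h) ⟩
    suc m ^ h * suc h + suc m ^ h * suc h ≤⟨ +-mono-≤ B B ⟩
    m ^ h * suc m + m ^ h * suc m       ≡⟨ lem₂ h (m ^ h) ⟩
    2 * m ^ h * suc m                   ∎)
    where
    B = bernoulli⁻ m h (suc h) (trans (+-suc h h) (cong (λ k → suc (h + k)) (sym (+-identityʳ h))))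

∏-bound : ∀ {A : Set} h z (cs : List (Code A)) .{{_ : NonZero h}} → let H = 2 * h in
  ∑ cs excess ≤ H * z → ∏ H cs ≤ 4 ^ z * H ^ List.length cs
∏-bound h z cs S≤Hz = *-cancelʳ-≤ _ _ (H ^ (H * z)) {{m^n≢0 H (H * z) {{m*n≢0 2 h}}}} (begin
  ∏ H cs * H ^ (H * z)                         ≡⟨ cong (λ k → ∏ H cs * H ^ k) (sym pad) ⟩
  ∏ H cs * H ^ (S + D)                         ≡⟨ cong (∏ H cs *_) (^-distribˡ-+-* H S D) ⟩
  ∏ H cs * (H ^ S * H ^ D)                     ≡⟨ sym (*-assoc (∏ H cs) (H ^ S) (H ^ D)) ⟩
  ∏ H cs * H ^ S * H ^ D                       ≤⟨ *-mono-≤ (∏-bernoulli H cs) (^-monoˡ-≤ D (n≤1+n H)) ⟩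
  H ^ M * suc H ^ S * suc H ^ D                ≡⟨ *-assoc (H ^ M) (suc H ^ S) (suc H ^ D) ⟩
  H ^ M * (suc H ^ S * suc H ^ D)              ≡⟨ cong (H ^ M *_) (sym (^-distribˡ-+-* (suc H) S D)) ⟩
  H ^ M * suc H ^ (S + D)                      ≡⟨ cong (λ k → H ^ M * suc H ^ k) pad ⟩
  H ^ M * suc H ^ (H * z)                      ≡⟨ cong (H ^ M *_) (sym (^-*-assoc (suc H) H z)) ⟩
  H ^ M * (suc H ^ H) ^ z                      ≤⟨ *-monoʳ-≤ (H ^ M) (^-monoˡ-≤ z (suc-^-≤ h)) ⟩
  H ^ M * (4 * H ^ H) ^ z                      ≡⟨ cong (H ^ M *_) (^-distribʳ-* z 4 (H ^ H)) ⟩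
  H ^ M * (4 ^ z * (H ^ H) ^ z)                ≡⟨ cong (λ e → H ^ M * (4 ^ z * e)) (^-*-assoc H H z) ⟩
  H ^ M * (4 ^ z * H ^ (H * z))                ≡⟨ lem (H ^ M) (4 ^ z) (H ^ (H * z)) ⟩
  4 ^ z * H ^ M * H ^ (H * z)                  ∎)
  where
  open ≤-Reasoning
  H = 2 * h
  S = ∑ cs excess
  -- The deficit fills the exponent up to a multiple of H, so that `suc-^-≤` applies z times.
  D = H * z ∸ S
  M = List.length cs
  pad : S + D ≡ H * z
  pad = m+[n∸m]≡n S≤Hz
  lem : ∀ a b c → a * (b * c) ≡ b * a * c
  lem = solve-∀
  ^-distribʳ-* : ∀ z a b → (a * b) ^ z ≡ a ^ z * b ^ z
  ^-distribʳ-* zero a b = refl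
  ^-distribʳ-* (suc z) a b rewrite ^-distribʳ-* z a b = lem′ a b (a ^ z) (b ^ z)
    where
    lem′ : ∀ a b c d → a * b * (c * d) ≡ a * c * (b * d)
    lem′ = solve-∀

-- Colorings and Hamming balls

allSigns : ∀ N → List (Vec Sign N)
allSigns zero    = [] ∷ []
allSigns (suc N) = List.map (Sign.+ ∷_) (allSigns N) ++ List.map (Sign.- ∷_) (allSigns N)

∑-signs : ∀ N (f : Vec Sign (suc N) → ℕ) →
  ∑ (allSigns (suc N)) f ≡ ∑ (allSigns N) (λ χ → f (Sign.+ ∷ χ) + f (Sign.- ∷ χ))
∑-signs N f = trans (∑-++ f (List.map _ (allSigns N)) _)
  (trans (cong₂ _+_ (∑-map f _ (allSigns N)) (∑-map f _ (allSigns N)))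
         (sym (∑-+ _ _ (allSigns N))))

length-allSigns : ∀ N → List.length (allSigns N) ≡ 2 ^ N
length-allSigns zero    = refl
length-allSigns (suc N) = trans (Listₚ.length-++ (List.map (Sign.+ ∷_) (allSigns N)))
  (cong₂ _+_ (trans (Listₚ.length-map (Sign.+ ∷_) (allSigns N)) (length-allSigns N))
    (trans (Listₚ.length-map (Sign.- ∷_) (allSigns N)) (trans (length-allSigns N) (sym (+-identityʳ _)))))

∑-signs-const : ∀ N k → ∑ (allSigns N) (λ _ → k) ≡ 2 ^ N * k
∑-signs-const N k = trans (∑-const k (allSigns N)) (cong (_* k) (length-allSigns N))

differ : Sign → Sign → ℕ
differ Sign.+ Sign.+ = 0
differ Sign.+ Sign.- = 1
differ Sign.- Sign.+ = 1
differ Sign.- Sign.- = 0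

dist : ∀ {N} → Vec Sign N → Vec Sign N → ℕ
dist []       []       = 0
dist (s ∷ χ) (t ∷ χ') = differ s t + dist χ χ'

-- An exponential weight, 8 for each agreement, as in a Chernoff bound: it is at least 8^(N-r) on
-- the ball of radius r, and over all colorings it sums to (8 + 1)^N.
closeness : ∀ {N} → Vec Sign N → Vec Sign N → ℕ
closeness []       []       = 1
closeness (s ∷ χ) (t ∷ χ') = 8 ^ (1 ∸ differ s t) * closeness χ χ'

closeness-dist : ∀ {N} (χ χ' : Vec Sign N) → closeness χ χ' * 8 ^ dist χ χ' ≡ 8 ^ N
closeness-dist []       []       = refl
closeness-dist {suc N} (s ∷ χ) (t ∷ χ') = begin
  8 ^ (1 ∸ differ s t) * c * 8 ^ (differ s t + d)           ≡⟨ cong (8 ^ (1 ∸ differ s t) * c *_) (^-distribˡ-+-* 8 (differ s t) d) ⟩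
  8 ^ (1 ∸ differ s t) * c * (8 ^ differ s t * 8 ^ d)       ≡⟨ lem (8 ^ (1 ∸ differ s t)) c (8 ^ differ s t) (8 ^ d) ⟩
  8 ^ (1 ∸ differ s t) * 8 ^ differ s t * (c * 8 ^ d)       ≡⟨ cong₂ _*_ (eight s t) (closeness-dist χ χ') ⟩
  8 * 8 ^ N                                                 ∎
  where
  open ≡-Reasoning
  c = closeness χ χ'
  d = dist χ χ'
  lem : ∀ a b c d → a * b * (c * d) ≡ a * c * (b * d)
  lem = solve-∀
  eight : ∀ s t → 8 ^ (1 ∸ differ s t) * 8 ^ differ s t ≡ 8
  eight Sign.+ Sign.+ = refl
  eight Sign.+ Sign.- = refl
  eight Sign.- Sign.+ = refl
  eight Sign.- Sign.- = refl

∑-closeness : ∀ {N} (χ : Vec Sign N) → ∑ (allSigns N) (closeness χ) ≡ 9 ^ N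
∑-closeness []       = refl
∑-closeness {suc N} (s ∷ χ) = begin
  ∑ (allSigns (suc N)) (closeness (s ∷ χ))             ≡⟨ ∑-signs N _ ⟩
  ∑ (allSigns N) (λ χ' → 8 ^ (1 ∸ differ s Sign.+) * closeness χ χ' + 8 ^ (1 ∸ differ s Sign.-) * closeness χ χ')
                                                       ≡⟨ ∑-cong (allSigns N) (λ χ' → nine s (closeness χ χ')) ⟩
  ∑ (allSigns N) (λ χ' → 9 * closeness χ χ')           ≡⟨ ∑-*ˡ 9 _ (allSigns N) ⟩
  9 * ∑ (allSigns N) (closeness χ)                     ≡⟨ cong (9 *_) (∑-closeness χ) ⟩
  9 * 9 ^ N                                            ∎
  where
  open ≡-Reasoning
  nine : ∀ s c → 8 ^ (1 ∸ differ s Sign.+) * c + 8 ^ (1 ∸ differ s Sign.-) * c ≡ 9 * c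
  nine Sign.+ c = sym (*-distribʳ-+ c 8 1)
  nine Sign.- c = sym (*-distribʳ-+ c 1 8)

-- The Hamming ball of radius r has at most 9^N / 8^(N-r) elements.
far-pair : ∀ {N} r 𝒴 → 𝒴 ⊆ allSigns N → 9 ^ N * 8 ^ r < List.length 𝒴 * 8 ^ N →
  ∃ λ χ → ∃ λ χ' → χ ∈ 𝒴 × χ' ∈ 𝒴 × r < dist χ χ'
far-pair {N} r []        𝒴⊆ big = contradiction big λ ()
far-pair {N} r 𝒴@(χ ∷ _) 𝒴⊆ big with All.all? (λ χ' → dist χ χ' ≤? r) 𝒴
... | no ¬near =
  let any = Allₚ.¬All⇒Any¬ (λ χ' → dist χ χ' ≤? r) 𝒴 ¬near
      χ' , χ'∈ , far = find any
  in χ , χ' , here refl , χ'∈ , ≰⇒> far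
... | yes near = contradiction big (≤⇒≯ (begin
  List.length 𝒴 * 8 ^ N                     ≤⟨ const-≤-∑ (λ χ' → closeness χ χ' * 8 ^ r) (8 ^ N) (All.map near-heavy near) ⟩
  ∑ 𝒴 (λ χ' → closeness χ χ' * 8 ^ r)       ≡⟨ ∑-*ʳ (8 ^ r) (closeness χ) 𝒴 ⟩
  ∑ 𝒴 (closeness χ) * 8 ^ r                 ≤⟨ *-monoˡ-≤ (8 ^ r) (∑-⊆ (closeness χ) 𝒴⊆) ⟩
  ∑ (allSigns N) (closeness χ) * 8 ^ r      ≡⟨ cong (_* 8 ^ r) (∑-closeness χ) ⟩
  9 ^ N * 8 ^ r                             ∎))
  where
  open ≤-Reasoning
  near-heavy : ∀ {χ'} → dist χ χ' ≤ r → 8 ^ N ≤ closeness χ χ' * 8 ^ r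
  near-heavy {χ'} d≤r = ≤-trans (≤-reflexive (sym (closeness-dist χ χ'))) (*-monoʳ-≤ (closeness χ χ') (^-monoʳ-≤ 8 d≤r))

-- Moments of a random signed sum

sq : ℤ → ℕ
sq x = ℤ.∣ x ∣ * ℤ.∣ x ∣

pos-sq : ∀ x → + sq x ≡ x ℤ.* x
pos-sq (+ n)    = ℤₚ.pos-* n n
pos-sq -[1+ n ] = refl

‖_‖² : ∀ {N} → Vec ℤ N → ℕ
‖ []     ‖² = 0
‖ a ∷ as ‖² = sq a + ‖ as ‖²

±-sum : ∀ (f : ℤ → ℕ) a d → f (a ℤ.* (Sign.+ ℤ.◃ 1) ℤ.+ d) + f (a ℤ.* (Sign.- ℤ.◃ 1) ℤ.+ d) ≡ f (a ℤ.+ d) + f (ℤ.- a ℤ.+ d)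
±-sum f a d = cong₂ (λ x y → f (x ℤ.+ d) + f (y ℤ.+ d)) (ℤₚ.*-identityʳ a) (trans (ℤₚ.*-comm a ℤ.-1ℤ) (ℤₚ.-1*i≡-i a))

±-sq : ∀ a d → sq (a ℤ.+ d) + sq (ℤ.- a ℤ.+ d) ≡ 2 * (sq d + sq a)
±-sq a d = ℤₚ.+-injective (begin
  + (sq (a ℤ.+ d) + sq (ℤ.- a ℤ.+ d))               ≡⟨ ℤₚ.pos-+ (sq (a ℤ.+ d)) _ ⟩
  + sq (a ℤ.+ d) ℤ.+ + sq (ℤ.- a ℤ.+ d)             ≡⟨ cong₂ ℤ._+_ (pos-sq (a ℤ.+ d)) (pos-sq (ℤ.- a ℤ.+ d)) ⟩
  _                                                 ≡⟨ lem a d ⟩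
  (d ℤ.* d ℤ.+ a ℤ.* a) ℤ.+ (d ℤ.* d ℤ.+ a ℤ.* a)   ≡⟨ sym (cong₂ ℤ._+_ pos pos) ⟩
  + (sq d + sq a) ℤ.+ + (sq d + sq a)               ≡⟨ sym (ℤₚ.pos-+ (sq d + sq a) _) ⟩
  + (sq d + sq a + (sq d + sq a))                   ≡⟨ cong (λ k → + (sq d + sq a + k)) (sym (+-identityʳ _)) ⟩
  + (2 * (sq d + sq a))                             ∎)
  where
  open ≡-Reasoning
  pos : + (sq d + sq a) ≡ d ℤ.* d ℤ.+ a ℤ.* a
  pos = trans (ℤₚ.pos-+ (sq d) (sq a)) (cong₂ ℤ._+_ (pos-sq d) (pos-sq a))
  lem : ∀ a d → (a ℤ.+ d) ℤ.* (a ℤ.+ d) ℤ.+ (ℤ.- a ℤ.+ d) ℤ.* (ℤ.- a ℤ.+ d)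
              ≡ (d ℤ.* d ℤ.+ a ℤ.* a) ℤ.+ (d ℤ.* d ℤ.+ a ℤ.* a)
  lem = ℤ-Solver.solve-∀

-- (a + d)² (- a + d)² = (d² - a²)² without subtraction; together with ±-sq it determines the
-- higher power sums of the two squares.
±-sq-* : ∀ a d → sq (a ℤ.+ d) * sq (ℤ.- a ℤ.+ d) + 2 * (sq a * sq d) ≡ sq d * sq d + sq a * sq a
±-sq-* a d = ℤₚ.+-injective (begin
  + (sq (a ℤ.+ d) * sq (ℤ.- a ℤ.+ d) + 2 * (sq a * sq d))        ≡⟨ cong (λ k → + (sq (a ℤ.+ d) * sq (ℤ.- a ℤ.+ d) + (sq a * sq d + k))) (+-identityʳ _) ⟩
  + (sq (a ℤ.+ d) * sq (ℤ.- a ℤ.+ d) + (sq a * sq d + sq a * sq d)) ≡⟨ ℤₚ.pos-+ (sq (a ℤ.+ d) * sq (ℤ.- a ℤ.+ d)) _ ⟩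
  _ ≡⟨ cong₂ ℤ._+_ (prod (a ℤ.+ d) (ℤ.- a ℤ.+ d)) (trans (ℤₚ.pos-+ (sq a * sq d) _) (cong₂ ℤ._+_ (prod a d) (prod a d))) ⟩
  _ ≡⟨ lem a d ⟩
  _ ≡⟨ sym (cong₂ ℤ._+_ (prod d d) (prod a a)) ⟩
  + (sq d * sq d) ℤ.+ + (sq a * sq a)  ≡⟨ sym (ℤₚ.pos-+ (sq d * sq d) _) ⟩
  + (sq d * sq d + sq a * sq a) ∎)
  where
  open ≡-Reasoning
  prod : ∀ x y → + (sq x * sq y) ≡ x ℤ.* x ℤ.* (y ℤ.* y)
  prod x y = trans (ℤₚ.pos-* (sq x) (sq y)) (cong₂ ℤ._*_ (pos-sq x) (pos-sq y))
  lem : ∀ a d → (a ℤ.+ d) ℤ.* (a ℤ.+ d) ℤ.* ((ℤ.- a ℤ.+ d) ℤ.* (ℤ.- a ℤ.+ d)) ℤ.+ (a ℤ.* a ℤ.* (d ℤ.* d) ℤ.+ a ℤ.* a ℤ.* (d ℤ.* d))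
              ≡ d ℤ.* d ℤ.* (d ℤ.* d) ℤ.+ a ℤ.* a ℤ.* (a ℤ.* a)
  lem = ℤ-Solver.solve-∀

power-sum₂ : ∀ s t A D → s + t ≡ 2 * (D + A) → s * t + 2 * (A * D) ≡ D * D + A * A →
  s * s + t * t ≡ 2 * (D * D + 6 * A * D + A * A)
power-sum₂ s t A D e₁ e₂ = +-cancelʳ-≡ (2 * (D * D + A * A)) _ _ (begin
  s * s + t * t + 2 * (D * D + A * A)                ≡⟨ cong (λ k → s * s + t * t + 2 * k) (sym e₂) ⟩
  s * s + t * t + 2 * (s * t + 2 * (A * D))          ≡⟨ lem₁ s t A D ⟩
  (s + t) * (s + t) + 4 * (A * D)                    ≡⟨ cong (λ k → k * k + 4 * (A * D)) e₁ ⟩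
  2 * (D + A) * (2 * (D + A)) + 4 * (A * D)          ≡⟨ lem₂ A D ⟩
  2 * (D * D + 6 * A * D + A * A) + 2 * (D * D + A * A) ∎)
  where
  open ≡-Reasoning
  lem₁ : ∀ s t A D → s * s + t * t + 2 * (s * t + 2 * (A * D)) ≡ (s + t) * (s + t) + 4 * (A * D)
  lem₁ = solve-∀
  lem₂ : ∀ A D → 2 * (D + A) * (2 * (D + A)) + 4 * (A * D) ≡ 2 * (D * D + 6 * A * D + A * A) + 2 * (D * D + A * A)
  lem₂ = solve-∀

-- Newton's identity s^3 + t^3 = (s + t)^3 - 3 s t (s + t), with the negative terms moved to the
-- other side. For s and t the squares of d ± a, the coefficients 1, 15, 15, 1 are the even binomial
-- coefficients of the sixth power.
power-sum₃ : ∀ s t A D → s + t ≡ 2 * (D + A) → s * t + 2 * (A * D) ≡ D * D + A * A →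
  s * s * s + t * t * t ≡ 2 * (D * D * D + 15 * A * (D * D) + 15 * (A * A) * D + A * A * A)
power-sum₃ s t A D e₁ e₂ = +-cancelʳ-≡ (3 * (s + t) * (D * D + A * A)) _ _ (begin
  s * s * s + t * t * t + 3 * (s + t) * (D * D + A * A)            ≡⟨ cong (λ k → s * s * s + t * t * t + 3 * (s + t) * k) (sym e₂) ⟩
  s * s * s + t * t * t + 3 * (s + t) * (s * t + 2 * (A * D))      ≡⟨ lem₁ s t A D ⟩
  (s + t) * (s + t) * (s + t) + 6 * (A * D) * (s + t)              ≡⟨ cong (λ k → k * k * k + 6 * (A * D) * k) e₁ ⟩
  _                                                                ≡⟨ lem₂ A D ⟩
  2 * (D * D * D + 15 * A * (D * D) + 15 * (A * A) * D + A * A * A) + 3 * (2 * (D + A)) * (D * D + A * A)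
     ≡⟨ cong (λ k → 2 * (D * D * D + 15 * A * (D * D) + 15 * (A * A) * D + A * A * A) + 3 * k * (D * D + A * A)) (sym e₁) ⟩
  _ ∎)
  where
  open ≡-Reasoning
  lem₁ : ∀ s t A D → s * s * s + t * t * t + 3 * (s + t) * (s * t + 2 * (A * D)) ≡ (s + t) * (s + t) * (s + t) + 6 * (A * D) * (s + t)
  lem₁ = solve-∀
  lem₂ : ∀ A D → 2 * (D + A) * (2 * (D + A)) * (2 * (D + A)) + 6 * (A * D) * (2 * (D + A))
    ≡ 2 * (D * D * D + 15 * A * (D * D) + 15 * (A * A) * D + A * A * A) + 3 * (2 * (D + A)) * (D * D + A * A)
  lem₂ = solve-∀

moment₂ : ∀ {N} (r : Vec ℤ N) → ∑ (allSigns N) (λ χ → sq (dot r χ)) ≡ 2 ^ N * ‖ r ‖²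
moment₂ []                = refl
moment₂ {suc N} (a ∷ r) = begin
  ∑ (allSigns (suc N)) (λ χ → sq (dot (a ∷ r) χ))          ≡⟨ ∑-signs N _ ⟩
  _                                                        ≡⟨ ∑-cong (allSigns N) (λ χ → trans (±-sum sq a (dot r χ)) (±-sq a (dot r χ))) ⟩
  ∑ (allSigns N) (λ χ → 2 * (sq (dot r χ) + sq a))         ≡⟨ ∑-*ˡ 2 _ (allSigns N) ⟩
  2 * ∑ (allSigns N) (λ χ → sq (dot r χ) + sq a)           ≡⟨ cong (2 *_) (∑-+ _ _ (allSigns N)) ⟩
  2 * (∑ (allSigns N) (λ χ → sq (dot r χ)) + ∑ (allSigns N) (λ _ → sq a)) ≡⟨ cong₂ (λ x y → 2 * (x + y)) (moment₂ r) (∑-signs-const N (sq a)) ⟩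
  2 * (2 ^ N * ‖ r ‖² + 2 ^ N * sq a)                      ≡⟨ lem (2 ^ N) ‖ r ‖² (sq a) ⟩
  2 * 2 ^ N * (sq a + ‖ r ‖²)                              ∎
  where
  open ≡-Reasoning
  lem : ∀ t s a → 2 * (t * s + t * a) ≡ 2 * t * (a + s)
  lem = solve-∀

moment₄ : ∀ {N} (r : Vec ℤ N) →
  ∑ (allSigns N) (λ χ → sq (dot r χ) * sq (dot r χ)) ≤ 2 ^ N * (3 * (‖ r ‖² * ‖ r ‖²))
moment₄ []                = z≤n
moment₄ {suc N} (a ∷ r) = begin
  ∑ (allSigns (suc N)) (λ χ → sq (dot (a ∷ r) χ) * sq (dot (a ∷ r) χ))  ≡⟨ ∑-signs N _ ⟩
  _  ≡⟨ ∑-cong 𝒳 (λ χ → trans (±-sum (λ x → sq x * sq x) a (dot r χ))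
          (power-sum₂ (sq (a ℤ.+ dot r χ)) (sq (ℤ.- a ℤ.+ dot r χ)) A (sq (dot r χ)) (±-sq a (dot r χ)) (±-sq-* a (dot r χ)))) ⟩
  ∑ 𝒳 (λ χ → 2 * (D χ * D χ + 6 * A * D χ + A * A))     ≡⟨ ∑-*ˡ 2 _ 𝒳 ⟩
  2 * ∑ 𝒳 (λ χ → D χ * D χ + 6 * A * D χ + A * A)       ≡⟨ cong (2 *_) (trans (∑-+ _ _ 𝒳) (cong₂ _+_ (trans (∑-+ _ _ 𝒳) (cong₂ _+_ refl (∑-*ˡ (6 * A) D 𝒳))) (∑-signs-const N (A * A)))) ⟩
  2 * (∑ 𝒳 (λ χ → D χ * D χ) + 6 * A * ∑ 𝒳 D + 2 ^ N * (A * A))  ≤⟨ *-monoʳ-≤ 2 (+-monoˡ-≤ (2 ^ N * (A * A)) (+-mono-≤ (moment₄ r) (*-monoʳ-≤ (6 * A) (≤-reflexive (moment₂ r))))) ⟩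
  2 * (2 ^ N * (3 * (σ * σ)) + 6 * A * (2 ^ N * σ) + 2 ^ N * (A * A))  ≤⟨ m≤m+n _ (2 * 2 ^ N * (2 * (A * A))) ⟩
  2 * (2 ^ N * (3 * (σ * σ)) + 6 * A * (2 ^ N * σ) + 2 ^ N * (A * A)) + 2 * 2 ^ N * (2 * (A * A)) ≡⟨ lem (2 ^ N) A σ ⟩
  2 * 2 ^ N * (3 * ((A + σ) * (A + σ)))                 ∎
  where
  open ≤-Reasoning
  𝒳 = allSigns N
  A = sq a
  σ = ‖ r ‖²
  D : Vec Sign N → ℕ
  D χ = sq (dot r χ)
  lem : ∀ t a s → 2 * (t * (3 * (s * s)) + 6 * a * (t * s) + t * (a * a)) + 2 * t * (2 * (a * a)) ≡ 2 * t * (3 * ((a + s) * (a + s)))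
  lem = solve-∀

-- The constants 3 and 15 here and in `moment₄` are the Gaussian moments, and they survive the
-- induction. With A the square of the new entry, the step yields 15σ^3 + 45Aσ^2 + 15A^2σ + A^3,
-- which falls short of 15 (A + σ)^3 by 30A^2σ + 14A^3.
moment₆ : ∀ {N} (r : Vec ℤ N) →
  ∑ (allSigns N) (λ χ → sq (dot r χ) * sq (dot r χ) * sq (dot r χ)) ≤ 2 ^ N * (15 * (‖ r ‖² * ‖ r ‖² * ‖ r ‖²))
moment₆ []                = z≤n
moment₆ {suc N} (a ∷ r) = begin
  ∑ (allSigns (suc N)) (λ χ → sq (dot (a ∷ r) χ) * sq (dot (a ∷ r) χ) * sq (dot (a ∷ r) χ))  ≡⟨ ∑-signs N _ ⟩
  _  ≡⟨ ∑-cong 𝒳 (λ χ → trans (±-sum (λ x → sq x * sq x * sq x) a (dot r χ))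
          (power-sum₃ (sq (a ℤ.+ dot r χ)) (sq (ℤ.- a ℤ.+ dot r χ)) A (sq (dot r χ)) (±-sq a (dot r χ)) (±-sq-* a (dot r χ)))) ⟩
  ∑ 𝒳 (λ χ → 2 * (D χ * D χ * D χ + 15 * A * (D χ * D χ) + 15 * (A * A) * D χ + A * A * A))     ≡⟨ ∑-*ˡ 2 _ 𝒳 ⟩
  2 * ∑ 𝒳 (λ χ → D χ * D χ * D χ + 15 * A * (D χ * D χ) + 15 * (A * A) * D χ + A * A * A)
     ≡⟨ cong (2 *_) (trans (∑-+ _ _ 𝒳) (cong₂ _+_ (trans (∑-+ _ _ 𝒳) (cong₂ _+_ (trans (∑-+ _ _ 𝒳) (cong₂ _+_ refl (∑-*ˡ (15 * A) (λ χ → D χ * D χ) 𝒳))) (∑-*ˡ (15 * (A * A)) D 𝒳))) (∑-signs-const N (A * A * A)))) ⟩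
  2 * (∑ 𝒳 (λ χ → D χ * D χ * D χ) + 15 * A * ∑ 𝒳 (λ χ → D χ * D χ) + 15 * (A * A) * ∑ 𝒳 D + T * (A * A * A))
     ≤⟨ *-monoʳ-≤ 2 (+-monoˡ-≤ (T * (A * A * A)) (+-mono-≤ (+-mono-≤ (moment₆ r) (*-monoʳ-≤ (15 * A) (moment₄ r))) (*-monoʳ-≤ (15 * (A * A)) (≤-reflexive (moment₂ r))))) ⟩
  2 * (T * (15 * (σ * σ * σ)) + 15 * A * (T * (3 * (σ * σ))) + 15 * (A * A) * (T * σ) + T * (A * A * A))
     ≤⟨ m≤m+n _ (2 * T * (30 * (A * A) * σ + 14 * (A * A * A))) ⟩
  _  ≡⟨ lem T A σ ⟩
  2 * T * (15 * ((A + σ) * (A + σ) * (A + σ)))          ∎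
  where
  open ≤-Reasoning
  𝒳 = allSigns N
  T = 2 ^ N
  A = sq a
  σ = ‖ r ‖²
  D : Vec Sign N → ℕ
  D χ = sq (dot r χ)
  lem : ∀ t a s → 2 * (t * (15 * (s * s * s)) + 15 * a * (t * (3 * (s * s))) + 15 * (a * a) * (t * s) + t * (a * a * a)) + 2 * t * (30 * (a * a) * s + 14 * (a * a * a))
     ≡ 2 * t * (15 * ((a + s) * (a + s) * (a + s)))
  lem = solve-∀

-- Rounding

module _ (Δ : ℕ) .{{_ : NonZero Δ}} where

  -- Codes are natural numbers, so rounding toward zero is recorded separately for the positive and
  -- the negative part, at most one of which is nonzero.
  round⁺ : ℤ → ℕ
  round⁺ (+ n)    = n / Δ
    where open DivMod
  round⁺ -[1+ n ] = 0

  round⁻ : ℤ → ℕ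
  round⁻ x = round⁺ (ℤ.- x)

  round⁺+round⁻ : ∀ x → round⁺ x + round⁻ x ≡ ℤ.∣ x ∣ DivMod./ Δ
  round⁺+round⁻ (+ zero)   = trans (cong₂ _+_ (DivMod.0/n≡0 Δ) (DivMod.0/n≡0 Δ)) (sym (DivMod.0/n≡0 Δ))
  round⁺+round⁻ (+ suc n)  = +-identityʳ _
  round⁺+round⁻ -[1+ n ]   = refl

  /-≡⇒≤ : ∀ m n → m DivMod./ Δ ≡ n DivMod./ Δ → m ≤ n + Δ
  /-≡⇒≤ m n eq = begin
    m                                           ≡⟨ DivMod.m≡m%n+[m/n]*n m Δ ⟩
    m DivMod.% Δ + m DivMod./ Δ * Δ             ≤⟨ +-mono-≤ (<⇒≤ (DivMod.m%n<n m Δ)) (≤-reflexive (cong (_* Δ) eq)) ⟩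
    Δ + n DivMod./ Δ * Δ                        ≤⟨ +-monoʳ-≤ Δ (DivMod.m/n*n≤m n Δ) ⟩
    Δ + n                                       ≡⟨ +-comm Δ n ⟩
    n + Δ                                       ∎
    where open ≤-Reasoning

  round⁺-≡0 : ∀ n → 0 ≡ n DivMod./ Δ → n ≤ Δ
  round⁺-≡0 n eq = /-≡⇒≤ n 0 (trans (sym eq) (sym (DivMod.0/n≡0 Δ)))

  ∣m⊖n∣≤ : ∀ m n → m ≤ n + Δ → n ≤ m + Δ → ℤ.∣ m ℤ.⊖ n ∣ ≤ 2 * Δ
  ∣m⊖n∣≤ m n m≤ n≤ with ≤-total m n
  ... | inj₁ le = ≤-trans (≤-reflexive (ℤₚ.∣⊖∣-≤ le)) (≤-trans (m≤n+o⇒m∸n≤o n m n≤) (m≤m+n Δ _))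
  ... | inj₂ le = ≤-trans (≤-reflexive (trans (ℤₚ.∣m⊖n∣≡∣n⊖m∣ m n) (ℤₚ.∣⊖∣-≤ le))) (≤-trans (m≤n+o⇒m∸n≤o m n m≤) (m≤m+n Δ _))

  opposite-rounding : ∀ m n → round⁺ (+ m) ≡ 0 → round⁻ (+ m) ≡ suc n DivMod./ Δ → ℤ.∣ + m ℤ.- -[1+ n ] ∣ ≤ 2 * Δ
  opposite-rounding zero    n e₁ e₂ = ≤-trans (round⁺-≡0 (suc n) (trans (sym (DivMod.0/n≡0 Δ)) e₂)) (m≤m+n Δ _)
  opposite-rounding (suc m) n e₁ e₂ = ≤-trans (+-mono-≤ (round⁺-≡0 (suc m) (sym e₁)) (round⁺-≡0 (suc n) e₂)) (+-monoʳ-≤ Δ (≤-reflexive (sym (+-identityʳ Δ))))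

  -- Rounding toward zero makes the bucket of zero reach from -Δ to Δ, hence the factor 2.
  same-rounding : ∀ x y → round⁺ x ≡ round⁺ y → round⁻ x ≡ round⁻ y → ℤ.∣ x ℤ.- y ∣ ≤ 2 * Δ
  same-rounding (+ m)    (+ n)    e₁ e₂ = subst (λ z → ℤ.∣ z ∣ ≤ 2 * Δ) (sym (ℤₚ.m-n≡m⊖n m n)) (∣m⊖n∣≤ m n (/-≡⇒≤ m n e₁) (/-≡⇒≤ n m (sym e₁)))
  same-rounding (+ m)    -[1+ n ] e₁ e₂ = opposite-rounding m n e₁ e₂
  same-rounding -[1+ m ] (+ n)    e₁ e₂ = subst (_≤ 2 * Δ) (ℤₚ.∣i-j∣≡∣j-i∣ (+ n) -[1+ m ]) (opposite-rounding n m (sym e₁) (sym e₂))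
  same-rounding -[1+ m ] -[1+ n ] e₁ e₂ = ∣m⊖n∣≤ (suc n) (suc m) (/-≡⇒≤ (suc n) (suc m) (sym e₂)) (/-≡⇒≤ (suc m) (suc n) e₂)

  overflow : ∀ {N} → Vec ℤ N → Vec Sign N → ℕ
  overflow r χ = ℤ.∣ dot r χ ∣ DivMod./ Δ

  private
    k≤k² : ∀ k → k ≤ k * k
    k≤k² zero    = z≤n
    k≤k² (suc k) = m≤m+n (suc k) _

    k*Δ²≤ : ∀ n → n DivMod./ Δ * (Δ * Δ) ≤ n * n
    k*Δ²≤ n = begin
      k * (Δ * Δ)         ≤⟨ *-monoˡ-≤ (Δ * Δ) (k≤k² k) ⟩
      k * k * (Δ * Δ)     ≡⟨ lem k Δ ⟩
      k * Δ * (k * Δ)     ≤⟨ *-mono-≤ kΔ≤n kΔ≤n ⟩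
      n * n               ∎
      where
      open ≤-Reasoning
      k = n DivMod./ Δ
      kΔ≤n = DivMod.m/n*n≤m n Δ
      lem : ∀ k d → k * k * (d * d) ≡ k * d * (k * d)
      lem = solve-∀

    k*Δ⁶≤ : ∀ n → n DivMod./ Δ * (Δ * Δ * (Δ * Δ) * (Δ * Δ)) ≤ n * n * (n * n) * (n * n)
    k*Δ⁶≤ n = begin
      k * (Δ² * Δ² * Δ²)             ≤⟨ *-monoˡ-≤ (Δ² * Δ² * Δ²) (≤-trans (k≤k² k) (*-monoˡ-≤ k (k≤k² k))) ⟩
      k * k * k * (Δ² * Δ² * Δ²)     ≡⟨ lem k Δ² ⟩
      k * Δ² * (k * Δ²) * (k * Δ²)   ≤⟨ *-mono-≤ (*-mono-≤ (k*Δ²≤ n) (k*Δ²≤ n)) (k*Δ²≤ n) ⟩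
      n * n * (n * n) * (n * n)      ∎
      where
      open ≤-Reasoning
      k = n DivMod./ Δ
      Δ² = Δ * Δ
      lem : ∀ k d → k * k * k * (d * d * d) ≡ k * d * (k * d) * (k * d)
      lem = solve-∀

  -- A natural quotient k is at most k^2 and at most k^3, so a moment of the sum bounds the mean of
  -- the quotient itself. The mean is of order σ/Δ^2 here and of order (σ/Δ^2)^3 in `overflow₆`,
  -- where σ is the squared norm.
  overflow₂ : ∀ {N} (r : Vec ℤ N) → ∑ (allSigns N) (overflow r) * (Δ * Δ) ≤ 2 ^ N * ‖ r ‖²
  overflow₂ {N} r = begin
    ∑ (allSigns N) (overflow r) * (Δ * Δ)               ≡⟨ sym (∑-*ʳ (Δ * Δ) (overflow r) (allSigns N)) ⟩
    ∑ (allSigns N) (λ χ → overflow r χ * (Δ * Δ))       ≤⟨ ∑-mono (allSigns N) (λ χ → k*Δ²≤ ℤ.∣ dot r χ ∣) ⟩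
    ∑ (allSigns N) (λ χ → sq (dot r χ))                 ≡⟨ moment₂ r ⟩
    2 ^ N * ‖ r ‖²                                      ∎
    where open ≤-Reasoning

  overflow₆ : ∀ {N} (r : Vec ℤ N) → ∑ (allSigns N) (overflow r) * (Δ * Δ * (Δ * Δ) * (Δ * Δ)) ≤ 2 ^ N * (15 * (‖ r ‖² * ‖ r ‖² * ‖ r ‖²))
  overflow₆ {N} r = begin
    _                                                                 ≡⟨ sym (∑-*ʳ (Δ * Δ * (Δ * Δ) * (Δ * Δ)) (overflow r) (allSigns N)) ⟩
    ∑ (allSigns N) (λ χ → overflow r χ * (Δ * Δ * (Δ * Δ) * (Δ * Δ))) ≤⟨ ∑-mono (allSigns N) (λ χ → k*Δ⁶≤ ℤ.∣ dot r χ ∣) ⟩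
    ∑ (allSigns N) (λ χ → sq (dot r χ) * sq (dot r χ) * sq (dot r χ)) ≤⟨ moment₆ r ⟩
    _                                                                 ∎
    where open ≤-Reasoning

-- Partial colorings from priced constraints

record Constraint (N : ℕ) : Set where
  constructor mkConstraint
  field
    row         : Vec ℤ N
    width       : ℕ
    .{{width≢0}} : NonZero width
    cprice      : ℕ
    cexcess     : ℕ

open Constraint public

CFair : ∀ {N} → ℕ → Constraint N → Set
CFair H c = 1 ≤ cprice c × H + cexcess c ≤ 2 ^ cprice c * cexcess c

codes : ∀ {N} → List (Constraint N) → List (Code (Vec Sign N))
codes []       = []
codes (c ∷ cs) = mkCode (λ χ → round⁺ (width c) (dot (row c) χ)) (cprice c) (cexcess c)
               ∷ mkCode (λ χ → round⁻ (width c) (dot (row c) χ)) (cprice c) (cexcess c)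
               ∷ codes cs

cost-codes : ∀ {N} (cs : List (Constraint N)) χ →
  cost (codes cs) χ ≡ ∑ cs (λ c → cprice c * overflow (width c) (row c) χ)
cost-codes []       χ = refl
cost-codes (c ∷ cs) χ = begin
  p * k⁺ + (p * k⁻ + cost (codes cs) χ)          ≡⟨ lem p k⁺ k⁻ (cost (codes cs) χ) ⟩
  p * (k⁺ + k⁻) + cost (codes cs) χ              ≡⟨ cong₂ (λ k r → p * k + r) (round⁺+round⁻ (width c) (dot (row c) χ)) (cost-codes cs χ) ⟩
  _ ∎
  where
  open ≡-Reasoning
  p = cprice c
  k⁺ = round⁺ (width c) (dot (row c) χ)
  k⁻ = round⁻ (width c) (dot (row c) χ)
  lem : ∀ p a b r → p * a + (p * b + r) ≡ p * (a + b) + r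
  lem = solve-∀

excess-codes : ∀ {N} (cs : List (Constraint N)) → ∑ (codes cs) excess ≡ ∑ cs (λ c → 2 * cexcess c)
excess-codes []       = refl
excess-codes (c ∷ cs) = trans (sym (+-assoc (cexcess c) _ _)) (cong₂ _+_ (cong (λ k → cexcess c + k) (sym (+-identityʳ _))) (excess-codes cs))

fair-codes : ∀ {N H} {cs : List (Constraint N)} → All (CFair H) cs → All (Fair H) (codes cs)
fair-codes []       = []
fair-codes (p ∷ ps) = p ∷ p ∷ fair-codes ps

same-codes : ∀ {N} (cs : List (Constraint N)) {χ χ'} → All (λ c → code c χ ≡ code c χ') (codes cs) →
  All (λ c → ℤ.∣ dot (row c) χ ℤ.- dot (row c) χ' ∣ ≤ 2 * width c) cs
same-codes []       []               = []
same-codes (c ∷ cs) {χ} {χ'} (e₁ ∷ e₂ ∷ eqs) = same-rounding (width c) (dot (row c) χ) (dot (row c) χ') e₁ e₂ ∷ same-codes cs eqs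

^-distribʳ-* : ∀ z a b → (a * b) ^ z ≡ a ^ z * b ^ z
^-distribʳ-* zero a b = refl
^-distribʳ-* (suc z) a b rewrite ^-distribʳ-* z a b = lem′ a b (a ^ z) (b ^ z)
  where
  lem′ : ∀ a b c d → a * b * (c * d) ≡ a * c * (b * d)
  lem′ = solve-∀

square-cancel-< : ∀ {m n} → m * m < n * n → m < n
square-cancel-< m²<n² = ≰⇒> λ n≤m → <⇒≱ m²<n² (*-mono-≤ n≤m n≤m)

-- After squaring, 81 * 2 ≤ 256 is what matters. So fewer than N/2 bits may be spent between the
-- factor (9/8)^N of the Hamming ball and the 2^N colorings.
9^N<16^N : ∀ N k → k + k < N → 9 ^ N * 2 ^ k < 16 ^ N
9^N<16^N N k 2k<N = square-cancel-< (begin-strict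
  9 ^ N * 2 ^ k * (9 ^ N * 2 ^ k)        ≡⟨ lem (9 ^ N) (2 ^ k) ⟩
  9 ^ N * 9 ^ N * (2 ^ k * 2 ^ k)        ≡⟨ cong₂ _*_ (sym (^-distribʳ-* N 9 9)) (sym (^-distribˡ-+-* 2 k k)) ⟩
  81 ^ N * 2 ^ (k + k)                   <⟨ *-monoʳ-< (81 ^ N) {{m^n≢0 81 N}} (^-monoʳ-< 2 (s≤s (s≤s z≤n)) 2k<N) ⟩
  81 ^ N * 2 ^ N                         ≤⟨ *-monoˡ-≤ (2 ^ N) (^-monoˡ-≤ N (m≤m+n 81 47)) ⟩
  128 ^ N * 2 ^ N                        ≡⟨ sym (^-distribʳ-* N 128 2) ⟩
  256 ^ N                                ≡⟨ ^-distribʳ-* N 16 16 ⟩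
  16 ^ N * 16 ^ N                        ∎)
  where
  open ≤-Reasoning
  lem : ∀ a b → a * b * (a * b) ≡ a * a * (b * b)
  lem = solve-∀

-- K lies just above N/64. At least half of the colorings cost at most L = 2 K, twice the bound on
-- the average; their codes take at most 2^L * 4^K values; a ball of radius r = 4 K has at most
-- (9/8)^N * 8^r elements. The powers of two multiply to 2^e with e = 16 K + 1, about N/4 bits, and
-- fewer than N/2 are allowed. The assumption 128 ≤ N pays for rounding K up.
partial-coloring : ∀ N h (cs : List (Constraint N)) .{{_ : NonZero h}} → 128 ≤ N →
  All (CFair (2 * h)) cs →
  64 * ∑ cs (λ c → cprice c * ∑ (allSigns N) (overflow (width c) (row c))) ≤ 2 ^ N * N →
  64 * ∑ cs (λ c → 2 * cexcess c) ≤ 2 * h * N →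
  ∃ λ χ → ∃ λ χ' → N ≤ 16 * dist χ χ' × All (λ c → ℤ.∣ dot (row c) χ ℤ.- dot (row c) χ' ∣ ≤ 2 * width c) cs
partial-coloring N h cs 128≤N fair cost≤ excess≤ =
  let 𝒴 , 𝒴⊆ , B<𝒴 , same = pigeonhole B H (codes cs) (fair-codes fair) L L ≤-refl 𝒳
        (Allₚ.all-filter (λ χ → cost (codes cs) χ ≤? L) (allSigns N)) big
      χ , χ' , χ∈ , χ'∈ , far = far-pair r 𝒴 (⊆-trans 𝒴⊆ (Subₚ.filter-⊆ (λ χ → cost (codes cs) χ ≤? L) (allSigns N))) (heavy B<𝒴)
  in χ , χ' , N≤16 far , same-codes cs (same χ∈ χ'∈)
  where
  open ≤-Reasoning
  m K L r H M B : ℕ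
  m = N DivMod./ 64
  K = suc m
  L = 2 * K
  r = 4 * K
  H = 2 * h
  M = List.length (codes cs)
  instance
    _ : NonZero (8 ^ N)
    _ = m^n≢0 8 N
  B = (9 ^ N * 8 ^ r) DivMod./ (8 ^ N)
  𝒳 : List (Vec Sign N)
  𝒳 = List.filter (λ χ → cost (codes cs) χ ≤? L) (allSigns N)

  N≤64K : N ≤ 64 * K
  N≤64K = begin
    N                                        ≡⟨ DivMod.m≡m%n+[m/n]*n N 64 ⟩
    N DivMod.% 64 + m * 64                   ≤⟨ +-monoˡ-≤ (m * 64) (<⇒≤ (DivMod.m%n<n N 64)) ⟩
    64 + m * 64                              ≡⟨ *-comm K 64 ⟩
    64 * K                                   ∎

  64m≤N : 64 * m ≤ N
  64m≤N = ≤-trans (≤-reflexive (*-comm 64 m)) (DivMod.m/n*n≤m N 64)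

  N≤16 : ∀ {d} → r < d → N ≤ 16 * d
  N≤16 {d} r<d = begin
    N             ≤⟨ N≤64K ⟩
    64 * K        ≡⟨ *-assoc 16 4 K ⟩
    16 * r        ≤⟨ *-monoʳ-≤ 16 (<⇒≤ r<d) ⟩
    16 * d        ∎

  heavy : ∀ {n} → B < n → 9 ^ N * 8 ^ r < n * 8 ^ N
  heavy {n} B<n = begin-strict
    9 ^ N * 8 ^ r                               ≡⟨ DivMod.m≡m%n+[m/n]*n (9 ^ N * 8 ^ r) (8 ^ N) ⟩
    (9 ^ N * 8 ^ r) DivMod.% (8 ^ N) + B * 8 ^ N  <⟨ +-monoˡ-< (B * 8 ^ N) (DivMod.m%n<n (9 ^ N * 8 ^ r) (8 ^ N)) ⟩
    suc B * 8 ^ N                               ≤⟨ *-monoˡ-≤ (8 ^ N) B<n ⟩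
    n * 8 ^ N                                   ∎

  total-cost : 64 * ∑ (allSigns N) (cost (codes cs)) ≤ 64 * (2 ^ N * K)
  total-cost = begin
    64 * ∑ (allSigns N) (cost (codes cs))
      ≡⟨ cong (64 *_) (trans (∑-cong (allSigns N) (cost-codes cs))
        (trans (∑-swap (λ χ c → cprice c * overflow (width c) (row c) χ) (allSigns N) cs)
          (∑-cong cs (λ c → ∑-*ˡ (cprice c) (overflow (width c) (row c)) (allSigns N))))) ⟩
    64 * ∑ cs (λ c → cprice c * ∑ (allSigns N) (overflow (width c) (row c)))    ≤⟨ cost≤ ⟩
    2 ^ N * N                                                                   ≤⟨ *-monoʳ-≤ (2 ^ N) N≤64K ⟩
    2 ^ N * (64 * K)                                                            ≡⟨ lem (2 ^ N) K ⟩
    64 * (2 ^ N * K) ∎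
    where
    lem : ∀ t k → t * (64 * k) ≡ 64 * (t * k)
    lem = solve-∀

  half : 2 ^ N ≤ 2 * List.length 𝒳
  half = ≤-trans (≤-reflexive (sym (length-allSigns N)))
    (markov (cost (codes cs)) (allSigns N) K L
      (≤-trans (*-cancelˡ-≤ 64 total-cost) (≤-reflexive (cong (_* K) (sym (length-allSigns N))))) ≤-refl)

  ∏≤ : ∏ H (codes cs) ≤ 4 ^ K * H ^ M
  ∏≤ = ∏-bound h K (codes cs) (*-cancelˡ-≤ 64 (begin
    64 * ∑ (codes cs) excess         ≡⟨ cong (64 *_) (excess-codes cs) ⟩
    64 * ∑ cs (λ c → 2 * cexcess c)  ≤⟨ excess≤ ⟩
    H * N                            ≤⟨ *-monoʳ-≤ H N≤64K ⟩
    H * (64 * K)                     ≡⟨ lem H K ⟩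
    64 * (H * K)                     ∎))
    where
    lem : ∀ t k → t * (64 * k) ≡ 64 * (t * k)
    lem = solve-∀

  e = suc (16 * K)

  e+e<N : e + e < N
  e+e<N = *-cancelˡ-< 2 (e + e) N (begin-strict
    2 * (e + e)                   ≡⟨ lem m ⟩
    68 + 64 * m                   <⟨ +-mono-<-≤ (≤-trans (m≤m+n 69 59) 128≤N) 64m≤N ⟩
    N + N                         ≡⟨ cong (λ k → N + k) (sym (+-identityʳ N)) ⟩
    2 * N                         ∎)
    where
    lem : ∀ m → 2 * (suc (16 * suc m) + suc (16 * suc m)) ≡ 68 + 64 * m
    lem = solve-∀

  powers : 2 * (8 ^ r * (2 ^ L * 4 ^ K)) ≡ 2 ^ e
  powers = cong (2 *_) (trans (cong₂ _*_ 8^r≡ (trans (cong (2 ^ L *_) (^-*-assoc 2 2 K)) (sym (^-distribˡ-+-* 2 L (2 * K)))))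
      (trans (sym (^-distribˡ-+-* 2 (12 * K) (L + 2 * K))) (cong (2 ^_) (lem K))))
    where
    8^r≡ : 8 ^ r ≡ 2 ^ (12 * K)
    8^r≡ = trans (^-*-assoc 2 3 r) (cong (2 ^_) (sym (*-assoc 3 4 K)))
    lem : ∀ k → 12 * k + (2 * k + 2 * k) ≡ 16 * k
    lem = solve-∀

  big : B * (2 ^ L * ∏ H (codes cs)) < List.length 𝒳 * H ^ M
  big = *-cancelʳ-< (2 * 8 ^ N) _ _ (begin-strict
    B * (2 ^ L * ∏ H (codes cs)) * (2 * 8 ^ N)           ≡⟨ lem₁ B (2 ^ L) (∏ H (codes cs)) (8 ^ N) ⟩
    B * 8 ^ N * (2 * 2 ^ L * ∏ H (codes cs))             ≤⟨ *-mono-≤ (DivMod.m/n*n≤m (9 ^ N * 8 ^ r) (8 ^ N)) (*-monoʳ-≤ (2 * 2 ^ L) ∏≤) ⟩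
    9 ^ N * 8 ^ r * (2 * 2 ^ L * (4 ^ K * H ^ M))        ≡⟨ lem₂ (9 ^ N) (8 ^ r) (2 ^ L) (4 ^ K) (H ^ M) ⟩
    9 ^ N * (2 * (8 ^ r * (2 ^ L * 4 ^ K))) * H ^ M      ≡⟨ cong (λ p → 9 ^ N * p * H ^ M) powers ⟩
    9 ^ N * 2 ^ e * H ^ M                                <⟨ *-monoˡ-< (H ^ M) {{m^n≢0 H M {{m*n≢0 2 h}}}} (9^N<16^N N e e+e<N) ⟩
    16 ^ N * H ^ M                                       ≡⟨ cong (_* H ^ M) (^-distribʳ-* N 2 8) ⟩
    2 ^ N * 8 ^ N * H ^ M                                ≤⟨ *-monoˡ-≤ (H ^ M) (*-monoˡ-≤ (8 ^ N) half) ⟩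
    2 * List.length 𝒳 * 8 ^ N * H ^ M                    ≡⟨ lem₃ (List.length 𝒳) (8 ^ N) (H ^ M) ⟩
    List.length 𝒳 * H ^ M * (2 * 8 ^ N)                  ∎)
    where
    lem₁ : ∀ b l π n → b * (l * π) * (2 * n) ≡ b * n * (2 * l * π)
    lem₁ = solve-∀
    lem₂ : ∀ a b l c d → a * b * (2 * l * (c * d)) ≡ a * (2 * (b * (l * c))) * d
    lem₂ = solve-∀
    lem₃ : ∀ x n d → 2 * x * n * d ≡ x * d * (2 * n)
    lem₃ = solve-∀

-- Geometric sums

Σ< : ℕ → (ℕ → ℕ) → ℕ
Σ< zero    f = 0
Σ< (suc n) f = f 0 + Σ< n (f ∘ suc)

Σ<-last : ∀ n f → Σ< (suc n) f ≡ Σ< n f + f n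
Σ<-last zero    f = +-identityʳ (f 0)
Σ<-last (suc n) f = trans (cong (λ s → f 0 + s) (Σ<-last n (f ∘ suc))) (sym (+-assoc (f 0) _ _))

Σ<-+ : ∀ m n f → Σ< (m + n) f ≡ Σ< m f + Σ< n (λ j → f (m + j))
Σ<-+ zero    n f = refl
Σ<-+ (suc m) n f = trans (cong (λ s → f 0 + s) (Σ<-+ m n (f ∘ suc))) (sym (+-assoc (f 0) _ _))

Σ<-*ˡ : ∀ k n f → Σ< n (λ j → k * f j) ≡ k * Σ< n f
Σ<-*ˡ k zero    f = sym (*-zeroʳ k)
Σ<-*ˡ k (suc n) f = trans (cong (λ s → k * f 0 + s) (Σ<-*ˡ k n (f ∘ suc))) (sym (*-distribˡ-+ k (f 0) _))

half-≤ : ∀ {a b} → 2 * a ≤ 2 * b → a ≤ b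
half-≤ {a} {b} = *-cancelˡ-≤ {a} {b} 2

private
  rotate : ∀ x y → x * (2 * y) ≡ 2 * x * y
  rotate = solve-∀

-- The doubled tail satisfies the same hypothesis with the same M, so twice the tail is at most 2 M.
-- No fractions M / 2^j appear.
geometric-decreasing : ∀ n f M → (∀ j → j < n → 2 ^ j * f j ≤ M) → Σ< n f ≤ 2 * M
geometric-decreasing zero    f M bound = z≤n
geometric-decreasing (suc n) f M bound = +-mono-≤
  (subst (_≤ M) (*-identityˡ (f 0)) (bound 0 (s≤s z≤n)))
  (≤-trans (half-≤ (≤-trans (≤-reflexive (sym (Σ<-*ˡ 2 n (f ∘ suc))))
    (geometric-decreasing n (λ j → 2 * f (suc j)) M
      (λ j j<n → ≤-trans (≤-reflexive (rotate (2 ^ j) (f (suc j)))) (bound (suc j) (s≤s j<n))))))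
    (m≤m+n M 0))

geometric-increasing : ∀ n f M → (∀ e i → suc (e + i) ≡ n → 2 ^ i * f e ≤ M) → Σ< n f ≤ 2 * M
geometric-increasing zero    f M bound = z≤n
geometric-increasing (suc n) f M bound = ≤-trans (≤-reflexive (trans (Σ<-last n f) (+-comm _ (f n)))) (+-mono-≤
  (subst (_≤ M) (*-identityˡ (f n)) (bound n 0 (cong suc (+-identityʳ n))))
  (≤-trans (half-≤ (≤-trans (≤-reflexive (sym (Σ<-*ˡ 2 n f)))
    (geometric-increasing n (λ e → 2 * f e) M
      (λ e i eq → ≤-trans (≤-reflexive (rotate (2 ^ i) (f e))) (bound e (suc i) (cong suc (trans (+-suc e i) eq)))))))
    (m≤m+n M 0)))

geometric : ∀ q f M → (∀ e i → e + i ≡ q → 2 ^ i * f e ≤ M) → (∀ i → i ≤ suc q → 2 ^ i * f (q + i) ≤ M) →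
  Σ< (suc q + suc q) f ≤ 4 * M
geometric q f M below above = begin
  Σ< (suc q + suc q) f                                ≡⟨ Σ<-+ (suc q) (suc q) f ⟩
  Σ< (suc q) f + Σ< (suc q) (λ j → f (suc q + j))     ≤⟨ +-mono-≤
    (geometric-increasing (suc q) f M (λ e i eq → below e i (suc-injective eq)))
    (geometric-decreasing (suc q) _ M above′) ⟩
  2 * M + 2 * M                                       ≡⟨ sym (*-distribʳ-+ M 2 2) ⟩
  4 * M                                               ∎
  where
  open ≤-Reasoning
  above′ : ∀ j → j < suc q → 2 ^ j * f (suc q + j) ≤ M
  above′ j j<q = ≤-trans (*-mono-≤ (^-monoʳ-≤ 2 (n≤1+n j)) (≤-reflexive (cong f (sym (+-suc q j))))) (above (suc j) j<q)

∑-average : ∀ {A : Set} (f : A → ℕ) K (xs : List A) → All (λ x → List.length xs * f x ≤ K) xs → ∑ xs f ≤ K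
∑-average f K []       bound = z≤n
∑-average f K xs@(_ ∷ _) bound = *-cancelˡ-≤ (List.length xs) (begin
  List.length xs * ∑ xs f               ≡⟨ sym (∑-*ˡ (List.length xs) f xs) ⟩
  ∑ xs (λ x → List.length xs * f x)     ≤⟨ ∑-≤-const _ K bound ⟩
  List.length xs * K                    ∎)
  where open ≤-Reasoning

-- Nets of rows

_⊖_ : ∀ {N} → Vec ℤ N → Vec ℤ N → Vec ℤ N
_⊖_ = Vec.zipWith ℤ._-_

𝟎 : ∀ {N} → Vec ℤ N
𝟎 = Vec.replicate _ ℤ.0ℤ

dot-⊖ : ∀ {N} (r g : Vec ℤ N) χ → dot (r ⊖ g) χ ≡ dot r χ ℤ.- dot g χ
dot-⊖ []      []      []      = refl
dot-⊖ (a ∷ r) (b ∷ g) (s ∷ χ) = trans (cong (λ d → (a ℤ.- b) ℤ.* (s ℤ.◃ 1) ℤ.+ d) (dot-⊖ r g χ))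
  (lem a b (s ℤ.◃ 1) (dot r χ) (dot g χ))
  where
  lem : ∀ a b s x y → (a ℤ.- b) ℤ.* s ℤ.+ (x ℤ.- y) ≡ a ℤ.* s ℤ.+ x ℤ.- (b ℤ.* s ℤ.+ y)
  lem = ℤ-Solver.solve-∀

dot-𝟎 : ∀ {N} (χ : Vec Sign N) → dot 𝟎 χ ≡ ℤ.0ℤ
dot-𝟎 []      = refl
dot-𝟎 (s ∷ χ) = trans (ℤₚ.+-identityˡ _) (dot-𝟎 χ)

∣a*s∣≤sq : ∀ a s → ℤ.∣ a ℤ.* (s ℤ.◃ 1) ∣ ≤ sq a
∣a*s∣≤sq a s = ≤-trans (≤-reflexive (trans (ℤₚ.abs-* a (s ℤ.◃ 1)) (trans (cong (ℤ.∣ a ∣ *_) (ℤₚ.abs-◃ s 1)) (*-identityʳ _)))) (m≤m² ℤ.∣ a ∣)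
  where
  m≤m² : ∀ m → m ≤ m * m
  m≤m² zero    = z≤n
  m≤m² (suc m) = m≤m+n (suc m) _

∣dot∣≤‖‖² : ∀ {N} (r : Vec ℤ N) χ → ℤ.∣ dot r χ ∣ ≤ ‖ r ‖²
∣dot∣≤‖‖² []      []      = z≤n
∣dot∣≤‖‖² (a ∷ r) (s ∷ χ) = ≤-trans (ℤₚ.∣i+j∣≤∣i∣+∣j∣ (a ℤ.* (s ℤ.◃ 1)) (dot r χ)) (+-mono-≤ (∣a*s∣≤sq a s) (∣dot∣≤‖‖² r χ))

-- Twice the absolute value of r on the partial coloring (χ - χ') / 2.
gap : ∀ {N} → Vec Sign N → Vec Sign N → Vec ℤ N → ℕ
gap χ χ' r = ℤ.∣ dot r χ ℤ.- dot r χ' ∣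

gap-⊖ : ∀ {N} (χ χ' : Vec Sign N) r g → gap χ χ' r ≤ gap χ χ' (r ⊖ g) + gap χ χ' g
gap-⊖ χ χ' r g = ≤-trans (≤-reflexive (cong ℤ.∣_∣ eq)) (ℤₚ.∣i+j∣≤∣i∣+∣j∣ (dot (r ⊖ g) χ ℤ.- dot (r ⊖ g) χ') (dot g χ ℤ.- dot g χ'))
  where
  lem : ∀ a b c d → a ℤ.- b ≡ (a ℤ.- c) ℤ.- (b ℤ.- d) ℤ.+ (c ℤ.- d)
  lem = ℤ-Solver.solve-∀
  eq : dot r χ ℤ.- dot r χ' ≡ dot (r ⊖ g) χ ℤ.- dot (r ⊖ g) χ' ℤ.+ (dot g χ ℤ.- dot g χ')
  eq = trans (lem (dot r χ) (dot r χ') (dot g χ) (dot g χ')) (sym (cong₂ (λ x y → x ℤ.- y ℤ.+ (dot g χ ℤ.- dot g χ')) (dot-⊖ r g χ) (dot-⊖ r g χ')))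

gap-𝟎 : ∀ {N} (χ χ' : Vec Sign N) → gap χ χ' 𝟎 ≡ 0
gap-𝟎 χ χ' = cong₂ (λ x y → ℤ.∣ x ℤ.- y ∣) (dot-𝟎 χ) (dot-𝟎 χ')

gap≤‖‖² : ∀ {N} (χ χ' : Vec Sign N) r → gap χ χ' r ≤ 2 * ‖ r ‖²
gap≤‖‖² χ χ' r = ≤-trans (ℤₚ.∣i-j∣≤∣i∣+∣j∣ (dot r χ) (dot r χ'))
  (≤-trans (+-mono-≤ (∣dot∣≤‖‖² r χ) (∣dot∣≤‖‖² r χ')) (+-monoʳ-≤ ‖ r ‖² (≤-reflexive (sym (+-identityʳ _)))))

record Net {N : ℕ} (R : Vec ℤ N → Set) (δ : ℕ) : Set where
  field
    members     : List (Vec ℤ N)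
    members⊆R   : All R members
    packing     : List.length members * (δ * δ) ≤ N * N
    approximate : ∀ {r} → R r → ∃ λ g → (g ≡ 𝟎 ⊎ g ∈ members) × ‖ r ⊖ g ‖² ≤ 4 * δ

open Net public

-- The two regimes of the entropy estimate at a level with n sets of size σ, where S is the
-- overflow of one of them summed over all T colorings. The scale of the level is δ = V Q for
-- large sets and δ = w² for small ones, while the peak scale is V = v².
private
  sq-swap : ∀ x a b → x * (a * a) * (b * b) ≡ x * (b * a * (b * a))
  sq-swap = solve-∀

large-sets : ∀ {n N T S σ P Q v a Δ c d k₁₄ k₁₆} .{{_ : NonZero v}} .{{_ : NonZero P}} .{{_ : NonZero Q}} .{{_ : NonZero c}} .{{_ : NonZero k₁₆}} →
  c * c * c ≡ k₁₆ * k₁₄ → k₁₄ ≡ d * 64 →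
  n * (v * v * Q * (v * v * Q)) ≤ N * N → N ≤ k₁₆ * (v * v * (v * v)) →
  S * (Δ * Δ) ≤ T * σ → σ ≤ c * (v * v * Q) → P * Δ ≡ c * c * v → a ≤ 64 * P → P * P * (P * P) ≤ Q →
  n * (P * d * (a * S)) ≤ T * N
large-sets {n} {N} {T} {S} {σ} {P} {Q} {v} {a} {Δ} {c} {d} {k₁₄} {k₁₆} c³ k₁₄≡ few N≤ over σ≤ width a≤ P⁴≤Q =
  -- As N ≤ `k₁₆` V^2, the packing gives n ≤ `k₁₆` N / Q^2, and the second moment gives S ≤ T Q P^2
  -- / c^3. After multiplication by P d a, at most 64 d P^2, the constants cancel and T N P^4 / Q
  -- remains.
  *-cancelʳ-≤ _ _ (P * P) {{m*n≢0 P P}} (begin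
    n * (P * d * (a * S)) * (P * P)           ≤⟨ *-monoˡ-≤ (P * P) (*-monoʳ-≤ n (*-monoʳ-≤ (P * d) (*-monoˡ-≤ S a≤))) ⟩
    n * (P * d * (64 * P * S)) * (P * P)      ≡⟨ lem₀ n P S d 64 ⟩
    n * S * (P * P * (P * P)) * (d * 64)      ≤⟨ *-mono-≤ (*-monoʳ-≤ (n * S) P⁴≤Q) (≤-reflexive (sym k₁₄≡)) ⟩
    n * S * Q * k₁₄                             ≤⟨ combined ⟩
    T * N * (P * P)                             ∎)
  where
  open ≤-Reasoning
  V = v * v
  instance
    _ : NonZero V
    _ = m*n≢0 v v
    _ : NonZero (V * V)
    _ = m*n≢0 V V
    _ : NonZero (c * V)
    _ = m*n≢0 c V
    _ : NonZero (k₁₆ * Q)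
    _ = m*n≢0 k₁₆ Q
  lem₀ : ∀ n P S x y → n * (P * x * (y * P * S)) * (P * P) ≡ n * S * (P * P * (P * P)) * (x * y)
  lem₀ = solve-∀
  few′ : n * (Q * Q) ≤ N * k₁₆
  few′ = *-cancelʳ-≤ _ _ (V * V) (begin
    n * (Q * Q) * (V * V)       ≡⟨ lem n Q V ⟩
    n * (V * Q * (V * Q))       ≤⟨ few ⟩
    N * N                       ≤⟨ *-monoʳ-≤ N N≤ ⟩
    N * (k₁₆ * (V * V))         ≡⟨ sym (*-assoc N k₁₆ (V * V)) ⟩
    N * k₁₆ * (V * V)           ∎)
    where
    lem : ∀ n q v → n * (q * q) * (v * v) ≡ n * (v * q * (v * q))
    lem = solve-∀
  over′ : S * (c * c * c) ≤ T * Q * (P * P)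
  over′ = *-cancelʳ-≤ _ _ (c * V) (begin
    S * (c * c * c) * (c * V)          ≡⟨ lem₁ S c v ⟩
    S * (c * c * v * (c * c * v))      ≡⟨ cong (λ x → S * (x * x)) (sym width) ⟩
    S * (P * Δ * (P * Δ))              ≡⟨ sym (sq-swap S Δ P) ⟩
    S * (Δ * Δ) * (P * P)              ≤⟨ *-monoˡ-≤ (P * P) over ⟩
    T * σ * (P * P)                    ≤⟨ *-monoˡ-≤ (P * P) (*-monoʳ-≤ T σ≤) ⟩
    T * (c * (V * Q)) * (P * P)        ≡⟨ lem₂ T c V Q P ⟩
    T * Q * (P * P) * (c * V)          ∎)
    where
    lem₁ : ∀ s c v → s * (c * c * c) * (c * (v * v)) ≡ s * (c * c * v * (c * c * v))
    lem₁ = solve-∀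
    lem₂ : ∀ t c v q p → t * (c * (v * q)) * (p * p) ≡ t * q * (p * p) * (c * v)
    lem₂ = solve-∀
  combined : n * S * Q * k₁₄ ≤ T * N * (P * P)
  combined = *-cancelʳ-≤ _ _ (k₁₆ * Q) (begin
    n * S * Q * k₁₄ * (k₁₆ * Q)             ≡⟨ lem₁ n S Q k₁₄ k₁₆ ⟩
    n * (Q * Q) * (S * (k₁₆ * k₁₄))         ≡⟨ cong (λ x → n * (Q * Q) * (S * x)) (sym c³) ⟩
    n * (Q * Q) * (S * (c * c * c))         ≤⟨ *-mono-≤ few′ over′ ⟩
    N * k₁₆ * (T * Q * (P * P))             ≡⟨ lem₂ N k₁₆ T Q P ⟩
    T * N * (P * P) * (k₁₆ * Q)             ∎)
    where
    lem₁ : ∀ n s q k l → n * s * q * k * (l * q) ≡ n * (q * q) * (s * (l * k))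
    lem₁ = solve-∀
    lem₂ : ∀ n k t q p → n * k * (t * q * (p * p)) ≡ t * n * (p * p) * (k * q)
    lem₂ = solve-∀

-- At distance i below the peak, where P = 2^i, the bound on the number of sets has grown by P^16,
-- while σ/Δ^2 has dropped by P^6. The cube from the sixth moment gains P^18, which pays exactly for
-- P^16, for one factor P of the price and for one of the geometric decay.
small-sets : ∀ {n N T S σ P w a Δ c d k₁₄ k₁₆} .{{_ : NonZero w}} .{{_ : NonZero P}} .{{_ : NonZero c}} .{{_ : NonZero k₁₆}} →
  k₁₆ * k₁₄ ≤ c * c * c → k₁₄ ≡ d * 64 → 15 ≤ c → let p = P * P * (P * P) in
  n * (w * w * (w * w)) ≤ N * N → N ≤ k₁₆ * (w * p * (w * p) * (w * p * (w * p))) →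
  S * (Δ * Δ * (Δ * Δ) * (Δ * Δ)) ≤ T * (15 * (σ * σ * σ)) → σ ≤ c * (w * w) → P * Δ ≡ c * c * (w * p) → a ≤ 64 * P →
  n * (P * d * (a * S)) ≤ T * N
small-sets {n} {N} {T} {S} {σ} {P} {w} {a} {Δ} {c} {d} {k₁₄} {k₁₆} c³ k₁₄≡ 15≤c few N≤ over σ≤ width a≤ = begin
    n * (P * d * (a * S))           ≤⟨ *-monoʳ-≤ n (*-monoʳ-≤ (P * d) (*-monoˡ-≤ S a≤)) ⟩
    n * (P * d * (64 * P * S))      ≡⟨ lem₀ n P S d 64 ⟩
    n * S * (P * P) * (d * 64)      ≡⟨ cong (n * S * (P * P) *_) (sym k₁₄≡) ⟩
    n * S * (P * P) * k₁₄             ≤⟨ combined ⟩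
    T * N                             ∎
  where
  open ≤-Reasoning
  W = w * w
  p = P * P * (P * P)
  p⁴ = p * p * (p * p)
  c³′ = c * c * c
  instance
    _ : NonZero W
    _ = m*n≢0 w w
    _ : NonZero (W * W)
    _ = m*n≢0 W W
    _ : NonZero (P * P)
    _ = m*n≢0 P P
    _ : NonZero p
    _ = m*n≢0 (P * P) (P * P)
    _ : NonZero (p * p)
    _ = m*n≢0 p p
    _ : NonZero p⁴
    _ = m*n≢0 (p * p) (p * p)
    _ : NonZero (c * c)
    _ = m*n≢0 c c
    _ : NonZero c³′
    _ = m*n≢0 (c * c) c
    _ : NonZero (W * W * W)
    _ = m*n≢0 (W * W) W
    _ : NonZero (c * (W * W * W))
    _ = m*n≢0 c (W * W * W)
    _ : NonZero (P * P * (P * P) * (P * P))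
    _ = m*n≢0 p (P * P)
  lem₀ : ∀ n P S x y → n * (P * x * (y * P * S)) ≡ n * S * (P * P) * (x * y)
  lem₀ = solve-∀
  few′ : n ≤ N * k₁₆ * p⁴
  few′ = *-cancelʳ-≤ _ _ (W * W) (begin
    n * (W * W)                                                ≤⟨ few ⟩
    N * N                                                      ≤⟨ *-monoʳ-≤ N N≤ ⟩
    N * (k₁₆ * (w * p * (w * p) * (w * p * (w * p))))          ≡⟨ lem N k₁₆ w p ⟩
    N * k₁₆ * p⁴ * (W * W)                                     ∎)
    where
    lem : ∀ n k w p → n * (k * (w * p * (w * p) * (w * p * (w * p)))) ≡ n * k * (p * p * (p * p)) * (w * w * (w * w))
    lem = solve-∀
  P⁶ = P * P * (P * P) * (P * P)
  p⁶ = p * p * (p * p) * (p * p)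
  over′ : S * (c³′ * c³′ * c * c) * p⁶ ≤ T * P⁶
  over′ = *-cancelʳ-≤ _ _ (c * (W * W * W) * c³′) {{m*n≢0 (c * (W * W * W)) c³′}} (begin
    S * (c³′ * c³′ * c * c) * p⁶ * (c * (W * W * W) * c³′)    ≡⟨ lem₁ S c w p ⟩
    S * (y * y * (y * y) * (y * y))                             ≡⟨ cong (λ x → S * (x * x * (x * x) * (x * x))) (sym width) ⟩
    S * (P * Δ * (P * Δ) * (P * Δ * (P * Δ)) * (P * Δ * (P * Δ)))  ≡⟨ lem₂ S P Δ ⟩
    S * (Δ * Δ * (Δ * Δ) * (Δ * Δ)) * P⁶                        ≤⟨ *-monoˡ-≤ P⁶ over ⟩
    T * (15 * (σ * σ * σ)) * P⁶                                 ≤⟨ *-monoˡ-≤ P⁶ (*-monoʳ-≤ T (*-mono-≤ 15≤c (*-mono-≤ (*-mono-≤ σ≤ σ≤) σ≤))) ⟩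
    T * (c * (c * W * (c * W) * (c * W))) * P⁶                  ≡⟨ lem₃ T c W P⁶ ⟩
    T * P⁶ * (c * (W * W * W) * c³′)                            ∎)
    where
    y = c * c * (w * p)
    lem₁ : ∀ s c w p → s * (c * c * c * (c * c * c) * c * c) * (p * p * (p * p) * (p * p)) * (c * (w * w * (w * w) * (w * w)) * (c * c * c))
      ≡ s * (c * c * (w * p) * (c * c * (w * p)) * (c * c * (w * p) * (c * c * (w * p))) * (c * c * (w * p) * (c * c * (w * p))))
    lem₁ = solve-∀
    lem₂ : ∀ s p d → s * (p * d * (p * d) * (p * d * (p * d)) * (p * d * (p * d))) ≡ s * (d * d * (d * d) * (d * d)) * (p * p * (p * p) * (p * p))
    lem₂ = solve-∀
    lem₃ : ∀ t c w p → t * (c * (c * w * (c * w) * (c * w))) * p ≡ t * p * (c * (w * w * w) * (c * c * c))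
    lem₃ = solve-∀
  combined : n * S * (P * P) * k₁₄ ≤ T * N
  combined = begin
    n * S * (P * P) * k₁₄                       ≤⟨ *-monoˡ-≤ k₁₄ (*-monoˡ-≤ (P * P) (*-monoˡ-≤ S few′)) ⟩
    N * k₁₆ * p⁴ * S * (P * P) * k₁₄            ≡⟨ lem₁ N k₁₆ p⁴ S (P * P) k₁₄ ⟩
    N * (k₁₆ * k₁₄ * (S * (p⁴ * (P * P))))      ≤⟨ *-monoʳ-≤ N (*-monoˡ-≤ _ c³) ⟩
    N * (c³′ * (S * (p⁴ * (P * P))))            ≤⟨ *-monoʳ-≤ N (*-monoˡ-≤ _ (m≤m*n c³′ (c³′ * (c * c)) {{m*n≢0 c³′ (c * c)}})) ⟩
    N * (c³′ * (c³′ * (c * c)) * (S * (p⁴ * (P * P))))  ≤⟨ *-monoʳ-≤ N over″ ⟩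
    N * T                                       ≡⟨ *-comm N T ⟩
    T * N                                       ∎
    where
    lem₁ : ∀ n k p s q l → n * k * p * s * q * l ≡ n * (k * l * (s * (p * q)))
    lem₁ = solve-∀
    over″ : c³′ * (c³′ * (c * c)) * (S * (p⁴ * (P * P))) ≤ T
    over″ = *-cancelʳ-≤ _ _ P⁶ (≤-trans (≤-reflexive (lem₂ S c³′ c P)) over′)
      where
      lem₂ : ∀ s d c P → let p = P * P * (P * P) in
        d * (d * (c * c)) * (s * (p * p * (p * p) * (P * P))) * (P * P * (P * P) * (P * P)) ≡ s * (d * d * c * c) * (p * p * (p * p) * (p * p))
      lem₂ = solve-∀

-- The scales of the partial coloring

Σ<-cong : ∀ k {f g : ℕ → ℕ} → (∀ j → f j ≡ g j) → Σ< k f ≡ Σ< k g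
Σ<-cong zero    f≡g = refl
Σ<-cong (suc k) f≡g = cong₂ _+_ (f≡g 0) (Σ<-cong k (λ j → f≡g (suc j)))

-- Level e uses the net at scale σ ^ e = 2^(8e), and q is the level where this is about √N. Widths
-- and prices depend only on the distance of e from q. The intended values are s = 2⁴, c = 2¹⁰,
-- d = 2⁸, k₁₄ = 2¹⁴, W = 20 + 4q, A = 60 + 17q and b = 26; they are kept as variables because
-- numerals of this size would be unfolded.
module Levels (s c d k₁₄ : ℕ) .{{_ : NonZero s}} .{{c≢0 : NonZero c}} (s≡ : s ≡ 2 * 2 * (2 * 2)) (c≡ : c ≡ 4 * (s * s)) (d≡ : d ≡ 4 * 64)
  (c³≡ : c * c * c ≡ s * s * (s * s) * k₁₄) (k₁₄≡ : k₁₄ ≡ d * 64) (15≤c : 15 ≤ c)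
  (W A b : ℕ) (N q : ℕ) (R : Vec ℤ N → Set) (nets : ∀ e → Net R ((s * s) ^ e))
  (q<W : suc q ≤ W) (2^W : 2 ^ W ≡ c * c * s ^ q)
  (price-exponent : ∀ i → i ≤ suc q → b + 17 * i ≤ 2 + A)
  (1≤b : 1 ≤ b) (2^b : 2 ^ b ≡ 2 * d * 2 * (s * s * (s * s))) (price≤64P : ∀ i → b + 17 * i ≤ 64 * 2 ^ i) where

  σ ς : ℕ
  σ = s * s
  ς = σ * σ

  peak : ℕ
  peak = 2 ^ W

  -- The slope 17 is 16 + 1: at offset i there may be 2^(16 i) times as many members as at the peak,
  -- and one more factor 2^i makes the total excess decay geometrically. The excess is chosen such
  -- that its ratio to H = 2 * h is 2 * 2^(-price), enough for fairness as the price is at least 1.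
  offset width′ price′ excess′ : ℕ → ℕ
  offset e  = (q ∸ e) + (e ∸ q)
  width′ e  = 2 ^ (W ∸ offset e)
  price′ e  = b + 17 * offset e
  excess′ e = 2 ^ ((2 + A) ∸ price′ e)

  h : ℕ
  h = 2 ^ A

  members# : ℕ → ℕ
  members# e = List.length (members (nets e))

  parent : ∀ e {g} → R g → Vec ℤ N
  parent e Rg = proj₁ (approximate (nets (suc e)) Rg)

  constraint : ∀ e {g} → R g → Constraint N
  constraint e {g} Rg = mkConstraint (g ⊖ parent e Rg) (width′ e) {{m^n≢0 2 (W ∸ offset e)}} (price′ e) (excess′ e)

  constraintsOf : ∀ e {gs} → All R gs → List (Constraint N)
  constraintsOf e []         = []
  constraintsOf e (Rg ∷ Rgs) = constraint e Rg ∷ constraintsOf e Rgs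

  level : ℕ → List (Constraint N)
  level e = constraintsOf e (members⊆R (nets e))

  levelsFrom : ℕ → ℕ → List (Constraint N)
  levelsFrom e zero    = []
  levelsFrom e (suc k) = level e ++ levelsFrom (suc e) k

  all-level : ∀ {P : Constraint N → Set} e {gs} → (∀ {g} (Rg : R g) → P (constraint e Rg)) → (Rgs : All R gs) → All P (constraintsOf e Rgs)
  all-level e P-all []         = []
  all-level e P-all (Rg ∷ Rgs) = P-all Rg ∷ all-level e P-all Rgs

  length-constraintsOf : ∀ e {gs} (Rgs : All R gs) → List.length (constraintsOf e Rgs) ≡ List.length gs
  length-constraintsOf e []         = refl
  length-constraintsOf e (Rg ∷ Rgs) = cong suc (length-constraintsOf e Rgs)

  length-level : ∀ e → List.length (level e) ≡ members# e
  length-level e = length-constraintsOf e (members⊆R (nets e))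

  ∑-levelsFrom : ∀ f e k → ∑ (levelsFrom e k) f ≡ Σ< k (λ j → ∑ (level (e + j)) f)
  ∑-levelsFrom f e zero    = refl
  ∑-levelsFrom f e (suc k) = trans (∑-++ f (level e) (levelsFrom (suc e) k))
    (cong₂ _+_ (cong (λ e → ∑ (level e) f) (sym (+-identityʳ e)))
      (trans (∑-levelsFrom f (suc e) k) (Σ<-cong k (λ j → cong (λ e → ∑ (level e) f) (sym (+-suc e j))))))

  all-levelsFrom : ∀ {P : Constraint N → Set} e k → (∀ e' → e' < e + k → ∀ {g} (Rg : R g) → P (constraint e' Rg)) →
    All P (levelsFrom e k)
  all-levelsFrom e zero    P-all = []
  all-levelsFrom e (suc k) P-all = Allₚ.++⁺
    (all-level e (P-all e (m<m+n e (s≤s z≤n))) (members⊆R (nets e)))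
    (all-levelsFrom (suc e) k (λ e' e'< → P-all e' (subst (e' <_) (sym (+-suc e k)) e'<)))

  -- The parent of g is computed from a proof of R g, so the constraint is returned together with
  -- the proof that was used to build it.
  lookup-level : ∀ {P : Constraint N → Set} e {gs} (Rgs : All R gs) → All P (constraintsOf e Rgs) →
    ∀ {g} → g ∈ gs → ∃ λ (Rg : R g) → P (constraint e Rg)
  lookup-level e (Rg ∷ Rgs) (p ∷ ps) (here refl) = Rg , p
  lookup-level e (Rg ∷ Rgs) (p ∷ ps) (there g∈)  = lookup-level e Rgs ps g∈

  offset-below : ∀ e i → e + i ≡ q → offset e ≡ i
  offset-below e i refl = trans (cong₂ _+_ (m+n∸m≡n e i) (m≤n⇒m∸n≡0 (m≤m+n e i))) (+-identityʳ i)

  offset-above : ∀ i → offset (q + i) ≡ i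
  offset-above i = cong₂ _+_ (m≤n⇒m∸n≡0 (m≤m+n q i)) (m+n∸m≡n q i)

  excess-price : ∀ i → i ≤ suc q → 2 ^ ((2 + A) ∸ (b + 17 * i)) * 2 ^ (b + 17 * i) ≡ 2 * (2 * h)
  excess-price i i≤ = trans (sym (^-distribˡ-+-* 2 ((2 + A) ∸ (b + 17 * i)) (b + 17 * i)))
    (cong (2 ^_) (m∸n+n≡m (price-exponent i i≤)))

  fair-excess : ∀ a X H → 1 ≤ a → X * 2 ^ a ≡ 2 * H → H + X ≤ 2 ^ a * X
  fair-excess a X H 1≤a eq = begin
    H + X           ≤⟨ +-monoʳ-≤ H (half-≤ (begin
      2 * X         ≡⟨ *-comm 2 X ⟩
      X * 2         ≤⟨ *-monoʳ-≤ X (^-monoʳ-≤ 2 1≤a) ⟩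
      X * 2 ^ a     ≡⟨ eq ⟩
      2 * H         ∎)) ⟩
    H + H           ≡⟨ cong (λ k → H + k) (sym (+-identityʳ H)) ⟩
    2 * H           ≡⟨ sym eq ⟩
    X * 2 ^ a       ≡⟨ *-comm X (2 ^ a) ⟩
    2 ^ a * X       ∎
    where open ≤-Reasoning

  width-peak : ∀ i → i ≤ suc q → 2 ^ i * 2 ^ (W ∸ i) ≡ peak
  width-peak i i≤ = trans (sym (^-distribˡ-+-* 2 i (W ∸ i))) (cong (2 ^_) (m+[n∸m]≡n (≤-trans i≤ q<W)))

  s^≡ : ∀ i → s ^ i ≡ 2 ^ i * 2 ^ i * (2 ^ i * 2 ^ i)
  s^≡ i = trans (cong (_^ i) s≡) (trans (^-distribʳ-* i (2 * 2) (2 * 2)) (cong₂ _*_ (^-distribʳ-* i 2 2) (^-distribʳ-* i 2 2)))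

  σ^≡ : ∀ i → σ ^ i ≡ s ^ i * s ^ i
  σ^≡ i = ^-distribʳ-* i s s

  ς^≡ : ∀ i → ς ^ i ≡ s ^ i * s ^ i * (s ^ i * s ^ i)
  ς^≡ i = trans (^-distribʳ-* i σ σ) (cong₂ _*_ (σ^≡ i) (σ^≡ i))

  width≢0′ : ∀ e → NonZero (width′ e)
  width≢0′ e = m^n≢0 2 (W ∸ offset e)

  2^≢0 : ∀ i → NonZero (2 ^ i)
  2^≢0 i = m^n≢0 2 i

  s^≢0 : ∀ i → NonZero (s ^ i)
  s^≢0 i = m^n≢0 s i

  σ^≢0 : ∀ i → NonZero (σ ^ i)
  σ^≢0 i = m^n≢0 σ i {{m*n≢0 s s}}

  2^16 : 2 ^ 16 ≡ ς
  2^16 = cong (λ s → s * s * (s * s)) (sym s≡)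

  -- Origin of c: the parent lives one scale up, with error 4 σ^(e+1), and c = 4 σ absorbs the
  -- constant of the net and the ratio of the scales.
  row-norm : ∀ e {g} (Rg : R g) → ‖ g ⊖ parent e Rg ‖² ≤ c * σ ^ e
  row-norm e Rg = ≤-trans (proj₂ (proj₂ (approximate (nets (suc e)) Rg))) (≤-reflexive (trans (sym (*-assoc 4 σ (σ ^ e))) (cong (_* σ ^ e) (sym c≡))))

  module _ (lower : ς ^ q ≤ N) (upper : N ≤ ς ^ suc q) where
    v = s ^ q

    N≤ : N ≤ ς * (v * v * (v * v))
    N≤ = ≤-trans upper (≤-reflexive (cong (ς *_) (ς^≡ q)))

    total-overflow : Constraint N → ℕ
    total-overflow c = ∑ (allSigns N) (overflow (width c) (row c))

    level-cost : Constraint N → ℕ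
    level-cost c = cprice c * total-overflow c

    cost-level : ∀ e i → (∀ {g} (Rg : R g) → members# e * (2 ^ i * d * level-cost (constraint e Rg)) ≤ 2 ^ N * N) →
      2 ^ i * (d * ∑ (level e) level-cost) ≤ 2 ^ N * N
    cost-level e i bound = ≤-trans (≤-reflexive (trans (sym (*-assoc (2 ^ i) d _)) (sym (∑-*ˡ (2 ^ i * d) level-cost (level e)))))
      (∑-average _ (2 ^ N * N) (level e) (all-level e (λ Rg →
        subst (λ n → n * (2 ^ i * d * level-cost (constraint e Rg)) ≤ 2 ^ N * N) (sym (length-level e)) (bound Rg))
        (members⊆R (nets e))))

    cost-below : ∀ e i → e + i ≡ q → 2 ^ i * (d * ∑ (level e) level-cost) ≤ 2 ^ N * N
    cost-below e i eq = cost-level e i λ {g} Rg →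
      small-sets {n = members# e} {N = N} {T = 2 ^ N} {S = total-overflow (constraint e Rg)} {σ = ‖ g ⊖ parent e Rg ‖²}
        {P = 2 ^ i} {w = s ^ e} {a = price′ e} {Δ = width′ e} {c = c} {d = d} {k₁₄ = k₁₄} {k₁₆ = ς}
        {{s^≢0 e}} {{2^≢0 i}} {{c≢0}} {{m*n≢0 σ σ {{m*n≢0 s s}} {{m*n≢0 s s}}}}
        (≤-reflexive (sym c³≡)) k₁₄≡ 15≤c
        (subst (λ δ → members# e * (δ * δ) ≤ N * N) (σ^≡ e) (packing (nets e)))
        (≤-trans N≤ (≤-reflexive (cong (λ v → ς * (v * v * (v * v))) v≡)))
        (overflow₆ (width′ e) {{width≢0′ e}} (g ⊖ parent e Rg))
        (≤-trans (row-norm e Rg) (≤-reflexive (cong (c *_) (σ^≡ e))))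
        (trans (cong (λ o → 2 ^ i * 2 ^ (W ∸ o)) (offset-below e i eq))
          (trans (width-peak i (≤-trans (m≤n+m i e) (≤-trans (≤-reflexive eq) (n≤1+n q)))) (trans 2^W (cong (c * c *_) v≡))))
        (≤-trans (≤-reflexive (cong (λ o → b + 17 * o) (offset-below e i eq))) (price≤64P i))
      where
      v≡ : v ≡ s ^ e * (2 ^ i * 2 ^ i * (2 ^ i * 2 ^ i))
      v≡ = trans (cong (s ^_) (sym eq)) (trans (^-distribˡ-+-* s e i) (cong (s ^ e *_) (s^≡ i)))

    cost-above : ∀ i → i ≤ suc q → 2 ^ i * (d * ∑ (level (q + i)) level-cost) ≤ 2 ^ N * N
    cost-above i i≤ = cost-level e i λ {g} Rg →
      large-sets {n = members# e} {N = N} {T = 2 ^ N} {S = total-overflow (constraint e Rg)} {σ = ‖ g ⊖ parent e Rg ‖²}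
        {P = 2 ^ i} {Q = σ ^ i} {v = v} {a = price′ e} {Δ = width′ e} {c = c} {d = d} {k₁₄ = k₁₄} {k₁₆ = ς}
        {{s^≢0 q}} {{2^≢0 i}} {{σ^≢0 i}} {{c≢0}} {{m*n≢0 σ σ {{m*n≢0 s s}} {{m*n≢0 s s}}}}
        c³≡ k₁₄≡
        (subst (λ δ → members# e * (δ * δ) ≤ N * N) δ≡ (packing (nets e)))
        N≤
        (overflow₂ (width′ e) {{width≢0′ e}} (g ⊖ parent e Rg))
        (≤-trans (row-norm e Rg) (≤-reflexive (cong (c *_) δ≡)))
        (trans (cong (λ o → 2 ^ i * 2 ^ (W ∸ o)) (offset-above i))
          (trans (width-peak i i≤) 2^W))
        (≤-trans (≤-reflexive (cong (λ o → b + 17 * o) (offset-above i))) (price≤64P i))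
        (≤-trans (≤-reflexive (sym (s^≡ i))) (^-monoˡ-≤ i (m≤m*n s s)))
      where
      e = q + i
      δ≡ : σ ^ e ≡ v * v * σ ^ i
      δ≡ = trans (^-distribˡ-+-* σ q i) (cong (_* σ ^ i) (σ^≡ q))

    excess-level : ∀ e i → offset e ≡ i → i ≤ suc q → v ≤ s ^ e * (2 ^ i * 2 ^ i * (2 ^ i * 2 ^ i)) →
      2 ^ i * (d * ∑ (level e) (λ c → 2 * cexcess c)) ≤ 2 * h * N
    excess-level e i off i≤ v≤ = *-cancelʳ-≤ _ _ (2 ^ a) {{m^n≢0 2 a}} (begin
      P * (d * ∑ (level e) (λ c → 2 * cexcess c)) * 2 ^ a     ≤⟨ *-monoˡ-≤ (2 ^ a) (*-monoʳ-≤ P (*-monoʳ-≤ d ∑≤)) ⟩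
      P * (d * (n * (2 * X))) * 2 ^ a                         ≡⟨ lem₁ P d n X (2 ^ a) ⟩
      P * d * n * 2 * (X * 2 ^ a)                             ≡⟨ cong (P * d * n * 2 *_) (excess-price i i≤) ⟩
      P * d * n * 2 * (2 * H)                                 ≤⟨ *-monoˡ-≤ (2 * H) (*-monoˡ-≤ 2 (*-monoʳ-≤ (P * d) n≤)) ⟩
      P * d * (N * (ς * (p * p * (p * p)))) * 2 * (2 * H) ≡⟨ lem₂ d ς P N p H ⟩
      H * N * (2 * d * 2 * ς * (P * (p * p * (p * p))))                ≡⟨ cong (H * N *_) (sym 2^a) ⟩
      H * N * 2 ^ a                                             ∎)
      where
      open ≤-Reasoning
      P = 2 ^ i
      p = P * P * (P * P)
      n = members# e
      H = 2 * h
      a = b + 17 * i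
      X = 2 ^ ((2 + A) ∸ a)
      w = s ^ e
      lem₁ : ∀ P k n x t → P * (k * (n * (2 * x))) * t ≡ P * k * n * 2 * (x * t)
      lem₁ = solve-∀
      lem₂ : ∀ k l P N p H → P * k * (N * (l * (p * p * (p * p)))) * 2 * (2 * H) ≡ H * N * (2 * k * 2 * l * (P * (p * p * (p * p))))
      lem₂ = solve-∀
      2^a : 2 ^ a ≡ 2 * d * 2 * ς * (P * (p * p * (p * p)))
      2^a = trans (^-distribˡ-+-* 2 b (17 * i)) (cong₂ _*_ 2^b (trans (^-distribˡ-+-* 2 i (16 * i))
        (cong (P *_) (trans (sym (^-*-assoc 2 16 i)) (trans (cong (_^ i) 2^16) (trans (ς^≡ i) (cong (λ p → p * p * (p * p)) (s^≡ i))))))))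
      ∑≤ : ∑ (level e) (λ c → 2 * cexcess c) ≤ n * (2 * X)
      ∑≤ = ≤-trans (∑-≤-const (λ c → 2 * cexcess c) (2 * X) (all-level e (λ _ → ≤-reflexive (cong (λ o → 2 * 2 ^ ((2 + A) ∸ (b + 17 * o))) off)) (members⊆R (nets e))))
        (≤-reflexive (cong (_* (2 * X)) (length-level e)))
      n≤ : n ≤ N * (ς * (p * p * (p * p)))
      n≤ = *-cancelʳ-≤ _ _ (σ ^ e * σ ^ e) {{m*n≢0 (σ ^ e) (σ ^ e) {{σ^≢0 e}} {{σ^≢0 e}}}} (begin
        n * (σ ^ e * σ ^ e)                                            ≤⟨ packing (nets e) ⟩
        N * N                                                              ≤⟨ *-monoʳ-≤ N N≤ ⟩
        N * (ς * (v * v * (v * v)))                                    ≤⟨ *-monoʳ-≤ N (*-monoʳ-≤ ς (*-mono-≤ (*-mono-≤ v≤ v≤) (*-mono-≤ v≤ v≤))) ⟩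
        N * (ς * (w * p * (w * p) * (w * p * (w * p))))                ≡⟨ lem₃ N ς w p ⟩
        N * (ς * (p * p * (p * p))) * (w * w * (w * w))                ≡⟨ cong (λ δ → N * (ς * (p * p * (p * p))) * (δ * δ)) (sym (σ^≡ e)) ⟩
        N * (ς * (p * p * (p * p))) * (σ ^ e * σ ^ e)              ∎)
        where
        lem₃ : ∀ n k w p → n * (k * (w * p * (w * p) * (w * p * (w * p)))) ≡ n * (k * (p * p * (p * p))) * (w * w * (w * w))
        lem₃ = solve-∀

    constraints : List (Constraint N)
    constraints = levelsFrom 0 (suc q + suc q)

    -- Origin of d = 4 * 64: the 64 is demanded by `partial-coloring`, and the 4 is lost in
    -- `geometric`.
    quarter : ∀ (f : Constraint N → ℕ) M → Σ< (suc q + suc q) (λ e → d * ∑ (level e) f) ≤ 4 * M → 64 * ∑ constraints f ≤ M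
    quarter f M le = *-cancelˡ-≤ 4 (begin
      4 * (64 * ∑ constraints f)                                 ≡⟨ subst (λ k → 4 * (64 * S) ≡ k * S) (sym d≡) (sym (*-assoc 4 64 S)) ⟩
      d * ∑ constraints f                                      ≡⟨ cong (d *_) (∑-levelsFrom f 0 (suc q + suc q)) ⟩
      d * Σ< (suc q + suc q) (λ e → ∑ (level e) f)             ≡⟨ sym (Σ<-*ˡ d (suc q + suc q) (λ e → ∑ (level e) f)) ⟩
      Σ< (suc q + suc q) (λ e → d * ∑ (level e) f)             ≤⟨ le ⟩
      4 * M                                                      ∎)
      where
      open ≤-Reasoning
      S = ∑ constraints f

    cost-bound : 64 * ∑ constraints level-cost ≤ 2 ^ N * N
    cost-bound = quarter level-cost (2 ^ N * N) (geometric q _ (2 ^ N * N) cost-below cost-above)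

    excess-bound : 64 * ∑ constraints (λ c → 2 * cexcess c) ≤ 2 * h * N
    excess-bound = quarter _ (2 * h * N) (geometric q _ (2 * h * N) below above)
      where
      below : ∀ e i → e + i ≡ q → 2 ^ i * (d * ∑ (level e) (λ c → 2 * cexcess c)) ≤ 2 * h * N
      below e i eq = excess-level e i (offset-below e i eq) (≤-trans (m≤n+m i e) (≤-trans (≤-reflexive eq) (n≤1+n q)))
        (≤-reflexive (trans (cong (s ^_) (sym eq)) (trans (^-distribˡ-+-* s e i) (cong (s ^ e *_) (s^≡ i)))))
      above : ∀ i → i ≤ suc q → 2 ^ i * (d * ∑ (level (q + i)) (λ c → 2 * cexcess c)) ≤ 2 * h * N
      above i i≤ = excess-level (q + i) i (offset-above i) i≤
        (≤-trans (^-monoʳ-≤ s (m≤m+n q i)) (m≤m*n (s ^ (q + i)) _ {{subst NonZero (s^≡ i) (s^≢0 i)}}))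

    width-bound : Σ< (suc q + suc q) width′ ≤ 4 * peak
    width-bound = geometric q width′ peak
      (λ e i eq → ≤-reflexive (trans (cong (λ o → 2 ^ i * 2 ^ (W ∸ o)) (offset-below e i eq)) (width-peak i (≤-trans (m≤n+m i e) (≤-trans (≤-reflexive eq) (n≤1+n q))))))
      (λ i i≤ → ≤-reflexive (trans (cong (λ o → 2 ^ i * 2 ^ (W ∸ o)) (offset-above i)) (width-peak i i≤)))

    offset-bound : ∀ e → e < suc q + suc q → offset e ≤ suc q
    offset-bound e e< with ≤-total e q
    ... | inj₁ e≤q = ≤-trans (≤-reflexive (trans (cong (λ k → q ∸ e + k) (m≤n⇒m∸n≡0 e≤q)) (+-identityʳ _))) (≤-trans (m∸n≤m q e) (n≤1+n q))
    ... | inj₂ q≤e = ≤-trans (≤-reflexive (cong (_+ (e ∸ q)) (m≤n⇒m∸n≡0 q≤e))) (m≤n+o⇒m∸n≤o e q (≤-pred e<))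

    fair-constraints : All (CFair (2 * h)) constraints
    fair-constraints = all-levelsFrom 0 (suc q + suc q) λ e e< Rg →
      ≤-trans 1≤b (m≤m+n b _) , fair-excess (price′ e) (excess′ e) (2 * h) (≤-trans 1≤b (m≤m+n b _)) (excess-price (offset e) (offset-bound e e<))

    -- Each member differs from its parent one level up by a constrained row, and there are no
    -- members at the top, where δ > N.
    chain : ∀ χ χ' k e → N < σ ^ (e + k) → All (λ c → gap χ χ' (row c) ≤ 2 * width c) (levelsFrom e k) →
      ∀ {g} → g ∈ members (nets e) → gap χ χ' g ≤ 2 * Σ< k (λ j → width′ (e + j))
    chain χ χ' zero e N< _ {g} g∈ = contradiction (packing (nets e)) (<⇒≱ (begin-strict
      N * N                                 <⟨ *-mono-< N<δ N<δ ⟩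
      σ ^ e * σ ^ e                     ≡⟨ sym (*-identityˡ _) ⟩
      1 * (σ ^ e * σ ^ e)               ≤⟨ *-monoˡ-≤ _ (nonempty g∈) ⟩
      members# e * (σ ^ e * σ ^ e)      ∎))
      where
      open ≤-Reasoning
      N<δ : N < σ ^ e
      N<δ = subst (λ e → N < σ ^ e) (+-identityʳ e) N<
      nonempty : ∀ {g} {gs : List (Vec ℤ N)} → g ∈ gs → 1 ≤ List.length gs
      nonempty (here _)  = s≤s z≤n
      nonempty (there _) = s≤s z≤n
    chain χ χ' (suc k) e N< small {g} g∈ with lookup-level e (members⊆R (nets e)) (Allₚ.++⁻ˡ (level e) small) g∈
    ... | Rg , close = begin
      gap χ χ' g                                                  ≤⟨ gap-⊖ χ χ' g (parent e Rg) ⟩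
      gap χ χ' (g ⊖ parent e Rg) + gap χ χ' (parent e Rg)         ≤⟨ +-mono-≤ close (rest (proj₁ (proj₂ (approximate (nets (suc e)) Rg)))) ⟩
      2 * width′ e + 2 * Σ< k (λ j → width′ (suc e + j))          ≡⟨ sym (*-distribˡ-+ 2 (width′ e) _) ⟩
      2 * (width′ e + Σ< k (λ j → width′ (suc e + j)))            ≡⟨ cong (2 *_) (cong₂ _+_ (cong width′ (sym (+-identityʳ e))) (Σ<-cong k (λ j → cong width′ (sym (+-suc e j))))) ⟩
      2 * Σ< (suc k) (λ j → width′ (e + j))                       ∎
      where
      open ≤-Reasoning
      rest : ∀ {p} → p ≡ 𝟎 ⊎ p ∈ members (nets (suc e)) → gap χ χ' p ≤ 2 * Σ< k (λ j → width′ (suc e + j))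
      rest (inj₁ refl) = ≤-trans (≤-reflexive (gap-𝟎 χ χ')) z≤n
      rest (inj₂ p∈)   = chain χ χ' k (suc e) (subst (λ n → N < σ ^ n) (+-suc e k) N<) (Allₚ.++⁻ʳ (level e) small) p∈

    -- The summand 8 is the trivial bound for the distance to the finest net, at scale σ^0 = 1,
    -- where at most 4 positions differ. The other summand is the telescoped sum of the widths.
    gap-bound : ℕ
    gap-bound = 8 + 2 * (4 * peak)

    gap≤ : ∀ χ χ' → N < ς ^ suc q → All (λ c → gap χ χ' (row c) ≤ 2 * width c) constraints →
      ∀ {r} → R r → gap χ χ' r ≤ gap-bound
    gap≤ χ χ' N< small {r} Rr with approximate (nets 0) Rr
    ... | g , g∈ , near = ≤-trans (gap-⊖ χ χ' r g) (+-mono-≤ (≤-trans (gap≤‖‖² χ χ' (r ⊖ g)) (*-monoʳ-≤ 2 near)) (rest g∈))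
      where
      -- Since ς = σ^2, the 2 (q + 1) levels reach the scale ς^(q+1) > N, and so every chain ends at
      -- `𝟎`.
      N<′ : N < σ ^ (suc q + suc q)
      N<′ = <-≤-trans N< (≤-reflexive (trans (^-distribʳ-* (suc q) σ σ) (sym (^-distribˡ-+-* σ (suc q) (suc q)))))
      rest : ∀ {p} → p ≡ 𝟎 ⊎ p ∈ members (nets 0) → gap χ χ' p ≤ 2 * (4 * peak)
      rest (inj₁ refl) = ≤-trans (≤-reflexive (gap-𝟎 χ χ')) z≤n
      rest (inj₂ p∈)   = ≤-trans (chain χ χ' (suc q + suc q) 0 N<′ small p∈) (*-monoʳ-≤ 2 width-bound)

    gap-bound^4 : gap-bound ^ 4 ≤ (16 * (c * c)) ^ 4 * N
    gap-bound^4 = begin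
      gap-bound ^ 4                              ≤⟨ ^-monoˡ-≤ 4 gap-bound≤ ⟩
      (16 * (c * c) * v) ^ 4                     ≡⟨ ^-distribʳ-* 4 (16 * (c * c)) v ⟩
      (16 * (c * c)) ^ 4 * v ^ 4                 ≡⟨ cong ((16 * (c * c)) ^ 4 *_) (trans (lem v) (sym (ς^≡ q))) ⟩
      (16 * (c * c)) ^ 4 * ς ^ q                 ≤⟨ *-monoʳ-≤ ((16 * (c * c)) ^ 4) lower ⟩
      (16 * (c * c)) ^ 4 * N                     ∎
      where
      open ≤-Reasoning
      lem : ∀ v → v * (v * (v * (v * 1))) ≡ v * v * (v * v)
      lem = solve-∀
      lem₂ : ∀ k v → 8 * (k * v) + 2 * (4 * (k * v)) ≡ 16 * k * v
      lem₂ = solve-∀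
      gap-bound≤ : gap-bound ≤ 16 * (c * c) * v
      gap-bound≤ = begin
        8 + 2 * (4 * peak)                           ≤⟨ +-mono-≤ (m≤m*n 8 (c * c * v) {{m*n≢0 (c * c) v {{m*n≢0 c c}} {{s^≢0 q}}}}) (≤-reflexive (cong (λ p → 2 * (4 * p)) 2^W)) ⟩
        8 * (c * c * v) + 2 * (4 * (c * c * v))      ≡⟨ lem₂ (c * c) v ⟩
        16 * (c * c) * v                             ∎

floor-log : ∀ β N → 2 ≤ β → 1 ≤ N → ∃ λ q → β ^ q ≤ N × N < β ^ suc q
floor-log β (suc zero)    2≤β 1≤N = 0 , s≤s z≤n , ≤-trans 2≤β (≤-reflexive (sym (*-identityʳ β)))
floor-log β (suc (suc n)) 2≤β 1≤N with floor-log β (suc n) 2≤β (s≤s z≤n)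
... | q , lower , upper with suc (suc n) <? β ^ suc q
...   | yes n< = q , m≤n⇒m≤1+n lower , n<
...   | no  n≮ = suc q , ≮⇒≥ n≮ , ≤-<-trans upper (^-monoʳ-< β 2≤β (n<1+n (suc q)))

NetColoring : ℕ → ℕ → Set₁
NetColoring δ₀ C₀ = ∀ N (R : Vec ℤ N → Set) → (∀ e → Net R (δ₀ ^ e)) → 128 ≤ N →
  ∃ λ χ → ∃ λ χ' → ∃ λ g → N ≤ 16 * dist χ χ' × g ^ 4 ≤ C₀ * N × (∀ {r} → R r → gap χ χ' r ≤ g)

net-coloring : ∀ s c d k₁₄ .{{_ : NonZero s}} .{{_ : NonZero c}} → s ≡ 2 * 2 * (2 * 2) → c ≡ 4 * (s * s) → d ≡ 4 * 64 →
  c * c * c ≡ s * s * (s * s) * k₁₄ → k₁₄ ≡ d * 64 → 15 ≤ c → ∀ (W A : ℕ → ℕ) b →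
  (∀ q → suc q ≤ W q) → (∀ q → 2 ^ W q ≡ c * c * s ^ q) → (∀ q i → i ≤ suc q → b + 17 * i ≤ 2 + A q) →
  1 ≤ b → 2 ^ b ≡ 2 * d * 2 * (s * s * (s * s)) → (∀ i → b + 17 * i ≤ 64 * 2 ^ i) →
  NetColoring (s * s) ((16 * (c * c)) ^ 4)
net-coloring s c d k₁₄ s≡ c≡ d≡ c³≡ k₁₄≡ 15≤c W A b q<W 2^W price-exponent 1≤b 2^b price≤ N R nets 128≤N =
  χ , χ' , gap-bound lower (<⇒≤ upper) , far , gap-bound^4 lower (<⇒≤ upper) , gap≤ lower (<⇒≤ upper) χ χ' upper small
  where
  2≤ς : 2 ≤ s * s * (s * s)
  2≤ς = subst (λ s → 2 ≤ s * s * (s * s)) (sym s≡) (m≤m+n 2 65534)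
  logN = floor-log (s * s * (s * s)) N 2≤ς (≤-trans (m≤m+n 1 127) 128≤N)
  q = proj₁ logN
  lower = proj₁ (proj₂ logN)
  upper = proj₂ (proj₂ logN)
  open Levels s c d k₁₄ s≡ c≡ d≡ c³≡ k₁₄≡ 15≤c (W q) (A q) b N q R nets (q<W q) (2^W q) (price-exponent q) 1≤b 2^b price≤
  colors = partial-coloring N h (constraints lower (<⇒≤ upper)) {{m^n≢0 2 (A q)}} 128≤N
    (fair-constraints lower (<⇒≤ upper)) (cost-bound lower (<⇒≤ upper)) (excess-bound lower (<⇒≤ upper))
  χ = proj₁ colors
  χ' = proj₁ (proj₂ colors)
  far = proj₁ (proj₂ (proj₂ colors))
  small = proj₂ (proj₂ (proj₂ colors))

-- Nets of traces

unique-length-≤ : ∀ {A : Set} {xs ys : List A} → Unique xs → (∀ {z} → z ∈ xs → z ∈ ys) → List.length xs ≤ List.length ys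
unique-length-≤ []            xs⊆ys = z≤n
unique-length-≤ {xs = x ∷ xs} (x∉ ∷ uniq) xs⊆ys with ∈-∃++ (xs⊆ys (here refl))
... | as , bs , refl = ≤-trans (s≤s (unique-length-≤ uniq rest)) (≤-reflexive (begin
  suc (List.length (as ++ bs))          ≡⟨ cong suc (Listₚ.length-++ as) ⟩
  suc (List.length as + List.length bs) ≡⟨ sym (+-suc (List.length as) (List.length bs)) ⟩
  List.length as + suc (List.length bs) ≡⟨ sym (Listₚ.length-++ as) ⟩
  List.length (as ++ x ∷ bs)            ∎))
  where
  open ≡-Reasoning
  rest : ∀ {z} → z ∈ xs → z ∈ as ++ bs
  rest z∈ with ∈-++⁻ as (xs⊆ys (there z∈))
  ... | inj₁ z∈as         = ∈-++⁺ˡ z∈as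
  ... | inj₂ (here refl)  = contradiction refl (All.lookup x∉ z∈)
  ... | inj₂ (there z∈bs) = ∈-++⁺ʳ as z∈bs

unique-++⁻ : ∀ {A : Set} (xs : List A) {ys} → Unique (xs ++ ys) → Unique xs × Unique ys
unique-++⁻ []       uniq        = [] , uniq
unique-++⁻ (x ∷ xs) (x∉ ∷ uniq) = let xs! , ys! = unique-++⁻ xs uniq in Allₚ.++⁻ˡ xs x∉ ∷ xs! , ys!

Consistent : {X : Set} → (List X → Set) → Set
Consistent 𝒯 = ∀ {t t'} → 𝒯 t → 𝒯 t' → ∀ {x y A B C A' B' C'} →
  t ≡ A ++ x ∷ B ++ y ∷ C → t' ≡ A' ++ x ∷ B' ++ y ∷ C' → B ≡ B'

filter-split : ∀ {X : Set} {P : X → Set} (P? : ∀ x → Dec (P x)) t A {x R} → List.filter P? t ≡ A ++ x ∷ R →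
  ∃ λ A₀ → ∃ λ R₀ → t ≡ A₀ ++ x ∷ R₀ × List.filter P? R₀ ≡ R
filter-split P? []      []      ()
filter-split P? []      (_ ∷ _) ()
filter-split P? (z ∷ t) A       eq with P? z
filter-split P? (z ∷ t) A       eq | no _ =
  let A₀ , R₀ , t≡ , R≡ = filter-split P? t A eq in z ∷ A₀ , R₀ , cong (z ∷_) t≡ , R≡
filter-split P? (z ∷ t) []      eq | yes _ with refl , refl ← Listₚ.∷-injective eq = [] , t , refl , refl
filter-split P? (z ∷ t) (a ∷ A) eq | yes _ =
  let A₀ , R₀ , t≡ , R≡ = filter-split P? t A (Listₚ.∷-injectiveʳ eq) in z ∷ A₀ , R₀ , cong (z ∷_) t≡ , R≡

filter-split₂ : ∀ {X : Set} {P : X → Set} (P? : ∀ x → Dec (P x)) t B {y C} → List.filter P? t ≡ B ++ y ∷ C →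
  ∃ λ B₀ → ∃ λ C₀ → t ≡ B₀ ++ y ∷ C₀ × List.filter P? B₀ ≡ B
filter-split₂ P? []      []      ()
filter-split₂ P? []      (_ ∷ _) ()
filter-split₂ P? (z ∷ t) B       eq with P? z in Pz
filter-split₂ P? (z ∷ t) B       eq | no ¬p =
  let B₀ , C₀ , t≡ , B≡ = filter-split₂ P? t B eq in z ∷ B₀ , C₀ , cong (z ∷_) t≡ , trans (Listₚ.filter-reject P? ¬p) B≡
filter-split₂ P? (z ∷ t) []      eq | yes p with refl , refl ← Listₚ.∷-injective eq = [] , t , refl , refl
filter-split₂ P? (z ∷ t) (b ∷ B) eq | yes p with refl , eq′ ← Listₚ.∷-injective eq =
  let B₀ , C₀ , t≡ , B≡ = filter-split₂ P? t B eq′ in z ∷ B₀ , C₀ , cong (z ∷_) t≡ , trans (Listₚ.filter-accept P? p) (cong (z ∷_) B≡)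

-- Occurrences of x and y in the filtered list lift to the original list, and the piece between them
-- there is filtered to B. This is why the argument passes to subsets of columns and to the
-- uncolored part.
filter-consistent : ∀ {X : Set} {P : X → Set} (P? : ∀ x → Dec (P x)) (ts : List (List X)) →
  Consistent (_∈ ts) → Consistent (_∈ List.map (List.filter P?) ts)
filter-consistent P? ts consistent t∈ t'∈ {A = A} {B} {C} {A'} {B'} {C'} eq eq'
  with t , t∈ts , refl ← ∈-map⁻ (List.filter P?) t∈
     | t' , t'∈ts , refl ← ∈-map⁻ (List.filter P?) t'∈
  with _ , R , t≡ , R≡ ← filter-split P? t A eq
     | _ , R' , t'≡ , R'≡ ← filter-split P? t' A' eq'
  with _ , _ , refl , B≡ ← filter-split₂ P? R B R≡
     | _ , _ , refl , B'≡ ← filter-split₂ P? R' B' R'≡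
  = trans (sym B≡) (trans (cong (List.filter P?) (consistent t∈ts t'∈ts t≡ t'≡)) B'≡)

record Split {X : Set} (δ : ℕ) (t : List X) : Set where
  field
    front middle back : List X
    whole        : t ≡ front ++ middle ++ back
    length-front : List.length front ≡ δ
    length-back  : List.length back ≡ δ

  endpoints : List (X × X)
  endpoints = List.cartesianProduct front back

open Split

split : ∀ {X : Set} δ (t : List X) → 2 * δ ≤ List.length t → Split δ t
split δ t 2δ≤ = record
  { front        = List.take δ t
  ; middle       = List.take (List.length rest ∸ δ) rest
  ; back         = List.drop (List.length rest ∸ δ) rest
  ; whole        = trans (sym (Listₚ.take++drop≡id δ t)) (cong (List.take δ t ++_) (sym (Listₚ.take++drop≡id (List.length rest ∸ δ) rest)))
  ; length-front = trans (Listₚ.length-take δ t) (m≤n⇒m⊓n≡m (≤-trans (m≤m+n δ _) 2δ≤))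
  ; length-back  = trans (Listₚ.length-drop (List.length rest ∸ δ) rest) (m∸[m∸n]≡n δ≤rest)
  }
  where
  rest = List.drop δ t
  δ≤rest : δ ≤ List.length rest
  δ≤rest = subst (δ ≤_) (sym (Listₚ.length-drop δ t)) (m+n≤o⇒m≤o∸n δ (subst (λ k → δ + k ≤ List.length t) (+-identityʳ δ) 2δ≤))

length-cartesianProduct : ∀ {A B : Set} (xs : List A) (ys : List B) → List.length (List.cartesianProduct xs ys) ≡ List.length xs * List.length ys
length-cartesianProduct []       ys = refl
length-cartesianProduct (x ∷ xs) ys = trans (Listₚ.length-++ (List.map (x ,_) ys))
  (cong₂ _+_ (Listₚ.length-map (x ,_) ys) (length-cartesianProduct xs ys))

length-concat : ∀ {A : Set} n {xss : List (List A)} → All (λ xs → List.length xs ≡ n) xss → List.length (List.concat xss) ≡ List.length xss * n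
length-concat n []                     = refl
length-concat n {xs ∷ xss} (eq ∷ eqs) = trans (Listₚ.length-++ xs) (cong₂ _+_ eq (length-concat n eqs))

module Traces {X : Set} (_≟_ : DecidableEquality X) where

  open DecMembership _≟_ using (_∈?_)

  _≟²_ : DecidableEquality (X × X)
  _≟²_ = Productₚ.≡-dec _≟_ _≟_

  open DecMembership _≟²_ using () renaming (_∈?_ to _∈²?_)

  indicate : List X → X → ℤ
  indicate t x = if does (x ∈? t) then ℤ.1ℤ else ℤ.0ℤ

  incidence : ∀ {N} → Vec X N → List X → Vec ℤ N
  incidence xs t = Vec.map (indicate t) xs

  indicate-∈ : ∀ {x t} → x ∈ t → indicate t x ≡ ℤ.1ℤ
  indicate-∈ {x} {t} x∈ rewrite dec-true (x ∈? t) x∈ = refl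

  indicate-∉ : ∀ {x t} → x ∉ t → indicate t x ≡ ℤ.0ℤ
  indicate-∉ {x} {t} x∉ rewrite dec-false (x ∈? t) x∉ = refl

  indicate-cong : ∀ {x t t'} → (x ∈ t → x ∈ t') → (x ∈ t' → x ∈ t) → indicate t x ≡ indicate t' x
  indicate-cong {x} {t} {t'} to from with x ∈? t
  ... | yes x∈ = sym (indicate-∈ (to x∈))
  ... | no  x∉ = sym (indicate-∉ (x∉ ∘ from))

  RowOf : ∀ {N} → Vec X N → List (List X) → Vec ℤ N → Set
  RowOf xs ts r = ∃ λ t → t ∈ ts × r ≡ incidence xs t

  -- The list E may have repetitions, as it will be a concatenation of overlapping end pieces: the
  -- entries of xs in E are distinct and therefore no more than its length.
  norm-support : ∀ {N} (xs : Vec X N) → Unique (Vec.toList xs) → ∀ f g E →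
    (∀ x → sq (f x ℤ.- g x) ≤ 1) → (∀ x → x ∉ E → f x ≡ g x) →
    ‖ Vec.map f xs ⊖ Vec.map g xs ‖² ≤ List.length E
  norm-support xs uniq f g E small support = ≤-trans (bound xs)
    (unique-length-≤ (Uniqueₚ.filter⁺ (_∈? E) uniq) (λ z∈ → proj₂ (∈-filter⁻ (_∈? E) {xs = Vec.toList xs} z∈)))
    where
    bound : ∀ {N} (xs : Vec X N) → ‖ Vec.map f xs ⊖ Vec.map g xs ‖² ≤ List.length (List.filter (_∈? E) (Vec.toList xs))
    bound []       = z≤n
    bound (x ∷ xs) with x ∈? E
    ... | yes _  = +-mono-≤ (small x) (bound xs)
    ... | no  x∉ = +-mono-≤ (≤-reflexive (trans (cong (λ y → sq (y ℤ.- g x)) (support x x∉)) (cong sq (ℤₚ.+-inverseʳ (g x))))) (bound xs)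

  indicate-diff : ∀ t g x → sq (indicate t x ℤ.- indicate g x) ≤ 1
  indicate-diff t g x with does (x ∈? t) | does (x ∈? g)
  ... | true  | true  = z≤n
  ... | true  | false = ≤-refl
  ... | false | true  = ≤-refl
  ... | false | false = z≤n

  module _ {N} (xs : Vec X N) (xs! : Unique (Vec.toList xs)) (ts : List (List X))
           (ts! : ∀ {t} → t ∈ ts → Unique t) (ts⊆xs : ∀ {t} → t ∈ ts → ∀ {x} → x ∈ t → x ∈ Vec.toList xs)
           (consistent : Consistent (_∈ ts)) (δ : ℕ) .{{_ : NonZero δ}} where

    Long : Set
    Long = ∃ λ (t : List X) → Split δ t

    ends² : Long → List (X × X)
    ends² (t , s) = endpoints s

    Shares : Long → Long → Set
    Shares l l' = Any (_∈ ends² l') (ends² l)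

    Covered : List Long → List X → Set
    Covered 𝒢 t = List.length t ≤ 2 * δ ⊎ ∃ λ s → Any (Shares (t , s)) 𝒢

    inhabited : (ys : List X) → List.length ys ≡ δ → ∃ λ y → y ∈ ys
    inhabited []      eq = contradiction (sym eq) (≢-nonZero⁻¹ δ)
    inhabited (y ∷ _) eq = y , here refl

    greedy : ∀ us → (∀ {t} → t ∈ us → t ∈ ts) → ∃ λ 𝒢 → All (λ l → proj₁ l ∈ ts) 𝒢 ×
      AllPairs Disjoint (List.map ends² 𝒢) × (∀ {t} → t ∈ us → Covered 𝒢 t)
    greedy []       us⊆ = [] , [] , [] , λ ()
    greedy (u ∷ us) us⊆ with greedy us (us⊆ ∘ there)
    ... | 𝒢 , 𝒢⊆ , disjoint , cover with 2 * δ ≤? List.length u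
    ...   | no short = 𝒢 , 𝒢⊆ , disjoint , λ where
            (here refl) → inj₁ (<⇒≤ (≰⇒> short))
            (there t∈)  → cover t∈
    ...   | yes long with any? (λ l → any? (_∈²? ends² l) (endpoints (split δ u long))) 𝒢
    ...     | yes shared = 𝒢 , 𝒢⊆ , disjoint , λ where
              (here refl) → inj₂ (split δ u long , shared)
              (there t∈)  → cover t∈
    ...     | no ¬shared = l ∷ 𝒢 , us⊆ (here refl) ∷ 𝒢⊆ , Allₚ.map⁺ (All.map (λ {l'} → disjoint-from l') (Allₚ.¬Any⇒All¬ 𝒢 ¬shared)) ∷ disjoint , λ where
              (here refl) → inj₂ (split δ u long , here self)
              (there t∈)  → weaken (cover t∈)
      where
      l : Long
      l = u , split δ u long
      disjoint-from : ∀ l' → ¬ Shares l l' → Disjoint (ends² l) (ends² l')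
      disjoint-from l' ¬s (p∈ , p∈') = ¬s (lose p∈ p∈')
      -- As δ is nonzero, `front` and `back` are inhabited, and so a chosen trace covers itself.
      self : Shares l l
      self with inhabited (front (proj₂ l)) (length-front (proj₂ l)) | inhabited (back (proj₂ l)) (length-back (proj₂ l))
      ... | x , x∈ | y , y∈ = lose (∈-cartesianProduct⁺ x∈ y∈) (∈-cartesianProduct⁺ x∈ y∈)
      weaken : ∀ {t} → Covered 𝒢 t → Covered (l ∷ 𝒢) t
      weaken (inj₁ short)        = inj₁ short
      weaken (inj₂ (s , shared)) = inj₂ (s , there shared)

    packing-bound : ∀ 𝒢 → All (λ l → proj₁ l ∈ ts) 𝒢 → AllPairs Disjoint (List.map ends² 𝒢) → List.length 𝒢 * (δ * δ) ≤ N * N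
    packing-bound 𝒢 𝒢⊆ disjoint = begin
      List.length 𝒢 * (δ * δ)                             ≡⟨ cong (_* (δ * δ)) (sym (Listₚ.length-map ends² 𝒢)) ⟩
      List.length (List.map ends² 𝒢) * (δ * δ)            ≡⟨ sym (length-concat (δ * δ) (Allₚ.map⁺ (All.universal size 𝒢))) ⟩
      List.length (List.concat (List.map ends² 𝒢))        ≤⟨ unique-length-≤ (Uniqueₚ.concat⁺ (Allₚ.map⁺ (All.map (λ {l} → unique-ends l) 𝒢⊆)) disjoint) within-square ⟩
      List.length (List.cartesianProduct ground ground)   ≡⟨ length-cartesianProduct ground ground ⟩
      List.length ground * List.length ground             ≡⟨ cong (λ n → n * n) (Vecₚ.length-toList xs) ⟩
      N * N                                               ∎
      where
      open ≤-Reasoning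
      ground = Vec.toList xs
      size : ∀ l → List.length (ends² l) ≡ δ * δ
      size (t , s) = trans (length-cartesianProduct (front s) (back s)) (cong₂ _*_ (length-front s) (length-back s))
      unique-ends : ∀ l → proj₁ l ∈ ts → Unique (ends² l)
      unique-ends (t , s) t∈ with unique-++⁻ (front s) (subst Unique (whole s) (ts! t∈))
      ... | front! , rest! = Uniqueₚ.cartesianProduct⁺ front! (proj₂ (unique-++⁻ (middle s) rest!))
      within : ∀ l → proj₁ l ∈ ts → ∀ {p} → p ∈ ends² l → p ∈ List.cartesianProduct ground ground
      within (t , s) t∈ {x , y} p∈ with ∈-cartesianProduct⁻ (front s) (back s) p∈
      ... | x∈ , y∈ = ∈-cartesianProduct⁺
        (ts⊆xs t∈ (subst (x ∈_) (sym (whole s)) (∈-++⁺ˡ x∈)))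
        (ts⊆xs t∈ (subst (y ∈_) (sym (whole s)) (∈-++⁺ʳ (front s) (∈-++⁺ʳ (middle s) y∈))))
      within-square : ∀ {p} → p ∈ List.concat (List.map ends² 𝒢) → p ∈ List.cartesianProduct ground ground
      within-square p∈ with ∈-concat⁻′ (List.map ends² 𝒢) p∈
      ... | ps , p∈ps , ps∈ with ∈-map⁻ ends² ps∈
      ...   | l , l∈ , refl = within l (All.lookup 𝒢⊆ l∈) p∈ps

    -- The traces agree from x to y, so they differ only in the four end pieces outside.
    shared-close : ∀ {t t'} → t ∈ ts → t' ∈ ts → (s : Split δ t) (s' : Split δ t') → Shares (t , s) (t' , s') →
      ‖ incidence xs t ⊖ incidence xs t' ‖² ≤ 4 * δ
    shared-close {t} {t'} t∈ t'∈ s s' shares with find shares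
    ... | (x , y) , p∈ , p∈' with ∈-cartesianProduct⁻ (front s) (back s) p∈ | ∈-cartesianProduct⁻ (front s') (back s') p∈'
    ...   | x∈ , y∈ | x∈' , y∈' with ∈-∃++ x∈ | ∈-∃++ y∈ | ∈-∃++ x∈' | ∈-∃++ y∈'
    ...     | A , A₂ , front≡ | C₁ , C , back≡ | A' , A'₂ , front'≡ | C'₁ , C' , back'≡ = ≤-trans
      (norm-support xs xs! (indicate t) (indicate t') E (indicate-diff t t') (λ z z∉ → indicate-cong (transfer t≡ t'≡ B≡ z∉) (transfer t'≡ t≡ (sym B≡) (z∉ ∘ swap))))
      length-E
      where
      B B' E : List X
      B  = A₂ ++ middle s ++ C₁
      B' = A'₂ ++ middle s' ++ C'₁
      E  = (A ++ C) ++ (A' ++ C')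
      regroup : ∀ {t : List X} (s : Split δ t) {A A₂ C₁ C} → front s ≡ A ++ x ∷ A₂ → back s ≡ C₁ ++ y ∷ C →
        t ≡ A ++ x ∷ (A₂ ++ middle s ++ C₁) ++ y ∷ C
      regroup s {A} {A₂} {C₁} {C} front≡ back≡ = trans (whole s) (trans (cong₂ (λ f b → f ++ middle s ++ b) front≡ back≡)
        (trans (Listₚ.++-assoc A (x ∷ A₂) _) (cong (λ l → A ++ x ∷ l) (sym (trans (Listₚ.++-assoc A₂ _ _) (cong (A₂ ++_) (Listₚ.++-assoc (middle s) C₁ (y ∷ C))))))))
      t≡ : t ≡ A ++ x ∷ B ++ y ∷ C
      t≡ = regroup s front≡ back≡
      t'≡ : t' ≡ A' ++ x ∷ B' ++ y ∷ C'
      t'≡ = regroup s' front'≡ back'≡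
      B≡ : B ≡ B'
      B≡ = consistent t∈ t'∈ t≡ t'≡
      swap : ∀ {z} → z ∈ (A' ++ C') ++ (A ++ C) → z ∈ E
      swap z∈ with ∈-++⁻ (A' ++ C') z∈
      ... | inj₁ z∈₁ = ∈-++⁺ʳ (A ++ C) z∈₁
      ... | inj₂ z∈₂ = ∈-++⁺ˡ z∈₂
      transfer : ∀ {t t' A B C A' B' C' z} → t ≡ A ++ x ∷ B ++ y ∷ C → t' ≡ A' ++ x ∷ B' ++ y ∷ C' → B ≡ B' →
        z ∉ (A ++ C) ++ (A' ++ C') → z ∈ t → z ∈ t'
      transfer {A = A} {B} {C} {A'} refl refl refl z∉ z∈ with ∈-++⁻ A z∈
      ... | inj₁ z∈A = contradiction (∈-++⁺ˡ (∈-++⁺ˡ z∈A)) z∉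
      ... | inj₂ (here refl) = ∈-++⁺ʳ A' (here refl)
      ... | inj₂ (there z∈R) with ∈-++⁻ B z∈R
      ...   | inj₁ z∈B = ∈-++⁺ʳ A' (there (∈-++⁺ˡ z∈B))
      ...   | inj₂ (here refl) = ∈-++⁺ʳ A' (there (∈-++⁺ʳ B (here refl)))
      ...   | inj₂ (there z∈C) = contradiction (∈-++⁺ˡ (∈-++⁺ʳ A z∈C)) z∉
      prefix≤ : ∀ {L A A₂ : List X} {z} → L ≡ A ++ z ∷ A₂ → List.length L ≡ δ → List.length A ≤ δ
      prefix≤ {A = A} refl len = ≤-trans (m≤m+n _ _) (≤-reflexive (trans (sym (Listₚ.length-++ A)) len))
      suffix≤ : ∀ {L C₁ C : List X} {z} → L ≡ C₁ ++ z ∷ C → List.length L ≡ δ → List.length C ≤ δ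
      suffix≤ {C₁ = C₁} refl len = ≤-trans (n≤1+n _) (≤-trans (m≤n+m _ (List.length C₁)) (≤-reflexive (trans (sym (Listₚ.length-++ C₁)) len)))
      length-E : List.length E ≤ 4 * δ
      length-E = begin
        List.length E                                                            ≡⟨ trans (Listₚ.length-++ (A ++ C)) (cong₂ _+_ (Listₚ.length-++ A) (Listₚ.length-++ A')) ⟩
        (List.length A + List.length C) + (List.length A' + List.length C')      ≤⟨ +-mono-≤
          (+-mono-≤ (prefix≤ front≡ (length-front s)) (suffix≤ back≡ (length-back s)))
          (+-mono-≤ (prefix≤ front'≡ (length-front s')) (suffix≤ back'≡ (length-back s'))) ⟩
        δ + δ + (δ + δ)                                                          ≡⟨ lem δ ⟩
        4 * δ                                                                    ∎
        where
        open ≤-Reasoning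
        lem : ∀ d → d + d + (d + d) ≡ 4 * d
        lem = solve-∀

    short-close : ∀ t → List.length t ≤ 2 * δ → ‖ incidence xs t ⊖ 𝟎 ‖² ≤ 4 * δ
    short-close t short = subst (λ z → ‖ incidence xs t ⊖ z ‖² ≤ 4 * δ) (Vecₚ.map-const xs ℤ.0ℤ)
      -- The zero row is treated as the indicator of the empty list, to which it is equal by
      -- computation.
      (≤-trans (norm-support xs xs! (indicate t) (λ _ → ℤ.0ℤ) t (indicate-diff t []) (λ x → indicate-∉ {x} {t}))
        (≤-trans short (*-monoˡ-≤ δ (m≤m+n 2 2))))

    trace-net : Net (RowOf xs ts) δ
    trace-net with greedy ts (λ t∈ → t∈)
    ... | 𝒢 , 𝒢⊆ , disjoint , cover = record
      { members     = List.map (incidence xs ∘ proj₁) 𝒢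
      ; members⊆R   = Allₚ.map⁺ (All.map (λ {l} t∈ → proj₁ l , t∈ , refl) 𝒢⊆)
      ; packing     = subst (λ n → n * (δ * δ) ≤ N * N) (sym (Listₚ.length-map (incidence xs ∘ proj₁) 𝒢)) (packing-bound 𝒢 𝒢⊆ disjoint)
      ; approximate = λ { (t , t∈ , refl) → approximation t∈ (cover t∈) }
      }
      where
      approximation : ∀ {t} → t ∈ ts → Covered 𝒢 t →
        ∃ λ g → (g ≡ 𝟎 ⊎ g ∈ List.map (incidence xs ∘ proj₁) 𝒢) × ‖ incidence xs t ⊖ g ‖² ≤ 4 * δ
      approximation {t} t∈ (inj₁ short) = 𝟎 , inj₁ refl , short-close t short
      approximation t∈ (inj₂ (s , shared)) with find shared
      ... | (t' , s') , l∈ , shares = incidence xs t' , inj₂ (∈-map⁺ (incidence xs ∘ proj₁) l∈) ,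
        shared-close t∈ (All.lookup 𝒢⊆ l∈) s s' shares

-- From partial to full colorings

sameSign : Sign → Sign → Bool
sameSign Sign.+ Sign.+ = inside
sameSign Sign.+ Sign.- = outside
sameSign Sign.- Sign.+ = outside
sameSign Sign.- Sign.- = inside

agreement : ∀ {N} → Vec Sign N → Vec Sign N → Subset N
agreement = Vec.zipWith sameSign

∣agreement∣ : ∀ {N} (χ χ' : Vec Sign N) → ∣ agreement χ χ' ∣ + dist χ χ' ≡ N
∣agreement∣ []           []            = refl
∣agreement∣ (Sign.+ ∷ χ) (Sign.+ ∷ χ') = cong suc (∣agreement∣ χ χ')
∣agreement∣ (Sign.+ ∷ χ) (Sign.- ∷ χ') = trans (+-suc _ _) (cong suc (∣agreement∣ χ χ'))
∣agreement∣ (Sign.- ∷ χ) (Sign.+ ∷ χ') = trans (+-suc _ _) (cong suc (∣agreement∣ χ χ'))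
∣agreement∣ (Sign.- ∷ χ) (Sign.- ∷ χ') = cong suc (∣agreement∣ χ χ')

-- Where χ and χ' differ this is χ, which equals (χ - χ') / 2 there.
complete : ∀ {N} (χ χ' : Vec Sign N) → Vec Sign ∣ agreement χ χ' ∣ → Vec Sign N
complete []           []            ψ       = []
complete (Sign.+ ∷ χ) (Sign.+ ∷ χ') (s ∷ ψ) = s ∷ complete χ χ' ψ
complete (Sign.+ ∷ χ) (Sign.- ∷ χ') ψ       = Sign.+ ∷ complete χ χ' ψ
complete (Sign.- ∷ χ) (Sign.+ ∷ χ') ψ       = Sign.- ∷ complete χ χ' ψ
complete (Sign.- ∷ χ) (Sign.- ∷ χ') (s ∷ ψ) = s ∷ complete χ χ' ψ

private
  agree-step : ∀ a σ τ m x y z → m ℤ.+ m ≡ x ℤ.- y ℤ.+ (z ℤ.+ z) →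
    (a ℤ.* τ ℤ.+ m) ℤ.+ (a ℤ.* τ ℤ.+ m) ≡ (a ℤ.* σ ℤ.+ x) ℤ.- (a ℤ.* σ ℤ.+ y) ℤ.+ ((a ℤ.* τ ℤ.+ z) ℤ.+ (a ℤ.* τ ℤ.+ z))
  agree-step a σ τ m x y z eq = trans (lem₁ (a ℤ.* τ) m) (trans (cong (λ k → (a ℤ.* τ ℤ.+ a ℤ.* τ) ℤ.+ k) eq) (lem₂ a σ τ x y z))
    where
    lem₁ : ∀ t m → (t ℤ.+ m) ℤ.+ (t ℤ.+ m) ≡ (t ℤ.+ t) ℤ.+ (m ℤ.+ m)
    lem₁ = ℤ-Solver.solve-∀
    lem₂ : ∀ a σ τ x y z → (a ℤ.* τ ℤ.+ a ℤ.* τ) ℤ.+ (x ℤ.- y ℤ.+ (z ℤ.+ z)) ≡ (a ℤ.* σ ℤ.+ x) ℤ.- (a ℤ.* σ ℤ.+ y) ℤ.+ ((a ℤ.* τ ℤ.+ z) ℤ.+ (a ℤ.* τ ℤ.+ z))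
    lem₂ = ℤ-Solver.solve-∀

  differ-step : ∀ a σ m x y z → m ℤ.+ m ≡ x ℤ.- y ℤ.+ (z ℤ.+ z) →
    (a ℤ.* σ ℤ.+ m) ℤ.+ (a ℤ.* σ ℤ.+ m) ≡ (a ℤ.* σ ℤ.+ x) ℤ.- (a ℤ.* (ℤ.- σ) ℤ.+ y) ℤ.+ (z ℤ.+ z)
  differ-step a σ m x y z eq = trans (lem₁ (a ℤ.* σ) m) (trans (cong (λ k → (a ℤ.* σ ℤ.+ a ℤ.* σ) ℤ.+ k) eq) (lem₂ a σ x y z))
    where
    lem₁ : ∀ t m → (t ℤ.+ m) ℤ.+ (t ℤ.+ m) ≡ (t ℤ.+ t) ℤ.+ (m ℤ.+ m)
    lem₁ = ℤ-Solver.solve-∀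
    lem₂ : ∀ a σ x y z → (a ℤ.* σ ℤ.+ a ℤ.* σ) ℤ.+ (x ℤ.- y ℤ.+ (z ℤ.+ z)) ≡ (a ℤ.* σ ℤ.+ x) ℤ.- (a ℤ.* (ℤ.- σ) ℤ.+ y) ℤ.+ (z ℤ.+ z)
    lem₂ = ℤ-Solver.solve-∀

-- Where the two colorings differ, χ' is -χ and thus χ - χ' = 2χ; where they agree, their
-- contributions cancel and ψ takes over. Doubling both sides avoids the division by two.
dot-complete : ∀ {N} (r : Vec ℤ N) χ χ' ψ → let m = dot r (complete χ χ' ψ) ; z = dot (select (agreement χ χ') r) ψ in
  m ℤ.+ m ≡ dot r χ ℤ.- dot r χ' ℤ.+ (z ℤ.+ z)
dot-complete []      []           []            []      = refl
dot-complete (a ∷ r) (Sign.+ ∷ χ) (Sign.+ ∷ χ') (s ∷ ψ) = agree-step a _ (s ℤ.◃ 1) _ _ _ _ (dot-complete r χ χ' ψ)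
dot-complete (a ∷ r) (Sign.+ ∷ χ) (Sign.- ∷ χ') ψ       = differ-step a ℤ.1ℤ _ _ _ (dot (select (agreement χ χ') r) ψ) (dot-complete r χ χ' ψ)
dot-complete (a ∷ r) (Sign.- ∷ χ) (Sign.+ ∷ χ') ψ       = differ-step a ℤ.-1ℤ _ _ _ (dot (select (agreement χ χ') r) ψ) (dot-complete r χ χ' ψ)
dot-complete (a ∷ r) (Sign.- ∷ χ) (Sign.- ∷ χ') (s ∷ ψ) = agree-step a _ (s ℤ.◃ 1) _ _ _ _ (dot-complete r χ χ' ψ)

∣dot-complete∣ : ∀ {N} (r : Vec ℤ N) χ χ' ψ →
  ℤ.∣ dot r (complete χ χ' ψ) ∣ ≤ gap χ χ' r + ℤ.∣ dot (select (agreement χ χ') r) ψ ∣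
∣dot-complete∣ r χ χ' ψ = half-≤ (begin
  2 * ℤ.∣ m ∣                                                       ≡⟨ double m ⟩
  ℤ.∣ m ℤ.+ m ∣                                                     ≡⟨ cong ℤ.∣_∣ (dot-complete r χ χ' ψ) ⟩
  ℤ.∣ dot r χ ℤ.- dot r χ' ℤ.+ (z ℤ.+ z) ∣                          ≤⟨ ℤₚ.∣i+j∣≤∣i∣+∣j∣ (dot r χ ℤ.- dot r χ') (z ℤ.+ z) ⟩
  gap χ χ' r + ℤ.∣ z ℤ.+ z ∣                                        ≡⟨ cong (λ k → gap χ χ' r + k) (sym (double z)) ⟩
  -- Half of the gap would do; the full gap is granted so that the factor 2 can be cancelled.
  gap χ χ' r + 2 * ℤ.∣ z ∣                                          ≤⟨ +-monoˡ-≤ (2 * ℤ.∣ z ∣) (m≤m+n (gap χ χ' r) _) ⟩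
  2 * gap χ χ' r + 2 * ℤ.∣ z ∣                                      ≡⟨ sym (*-distribˡ-+ 2 (gap χ χ' r) ℤ.∣ z ∣) ⟩
  2 * (gap χ χ' r + ℤ.∣ z ∣)                                        ∎)
  where
  open ≤-Reasoning
  m = dot r (complete χ χ' ψ)
  z = dot (select (agreement χ χ') r) ψ
  double : ∀ x → 2 * ℤ.∣ x ∣ ≡ ℤ.∣ x ℤ.+ x ∣
  double (+ n)    = cong (λ k → n + k) (+-identityʳ n)
  double -[1+ n ] = trans (cong (λ k → suc n + k) (+-identityʳ (suc n))) (cong suc (+-suc n n))

select-map : ∀ {A B : Set} {N} (f : A → B) (Y : Subset N) (xs : Vec A N) → select Y (Vec.map f xs) ≡ Vec.map f (select Y xs)
select-map f []            []       = refl
select-map f (inside ∷ Y)  (x ∷ xs) = cong (f x ∷_) (select-map f Y xs)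
select-map f (outside ∷ Y) (x ∷ xs) = select-map f Y xs

select-∈ : ∀ {A : Set} {N} (Y : Subset N) (xs : Vec A N) {x} → x ∈ Vec.toList (select Y xs) → x ∈ Vec.toList xs
select-∈ []            []       ()
select-∈ (inside ∷ Y)  (x ∷ xs) (here eq)  = here eq
select-∈ (inside ∷ Y)  (x ∷ xs) (there x∈) = there (select-∈ Y xs x∈)
select-∈ (outside ∷ Y) (x ∷ xs) x∈         = there (select-∈ Y xs x∈)

select-unique : ∀ {A : Set} {N} (Y : Subset N) (xs : Vec A N) → Unique (Vec.toList xs) → Unique (Vec.toList (select Y xs))
select-unique []            []       xs!        = []
select-unique (inside ∷ Y)  (x ∷ xs) (x∉ ∷ xs!) = All.tabulate (λ y∈ → All.lookup x∉ (select-∈ Y xs y∈)) ∷ select-unique Y xs xs!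
select-unique (outside ∷ Y) (x ∷ xs) (x∉ ∷ xs!) = select-unique Y xs xs!

-- Either d ≤ w p, or p is at most d / w and the loss is paid by the factor 15/16.
fourth-power-step : ∀ w u .{{_ : NonZero w}} → u ≡ suc w → u ^ 4 * 15 ≤ w ^ 4 * 16 →
  ∀ C₀ p d n n' → p ^ 4 ≤ C₀ * n → d ^ 4 ≤ u ^ 4 * C₀ * n' → 16 * n' ≤ 15 * n → (p + d) ^ 4 ≤ u ^ 4 * C₀ * n
fourth-power-step w u u≡ ratio C₀ p d n n' p⁴≤ d⁴≤ n'≤ with d ≤? w * p
... | yes d≤ = begin
  (p + d) ^ 4          ≤⟨ ^-monoˡ-≤ 4 (+-monoʳ-≤ p d≤) ⟩
  (suc w * p) ^ 4      ≡⟨ cong (λ u → (u * p) ^ 4) (sym u≡) ⟩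
  (u * p) ^ 4          ≡⟨ ^-distribʳ-* 4 u p ⟩
  u ^ 4 * p ^ 4        ≤⟨ *-monoʳ-≤ (u ^ 4) p⁴≤ ⟩
  u ^ 4 * (C₀ * n)     ≡⟨ sym (*-assoc (u ^ 4) C₀ n) ⟩
  u ^ 4 * C₀ * n       ∎
  where open ≤-Reasoning
... | no d≰ = *-cancelˡ-≤ (w ^ 4 * 16) {{m*n≢0 (w ^ 4) 16 {{m^n≢0 w 4}}}} (begin
  w ^ 4 * 16 * (p + d) ^ 4            ≡⟨ lem₁ (w ^ 4) 16 ((p + d) ^ 4) ⟩
  16 * (w ^ 4 * (p + d) ^ 4)          ≡⟨ cong (16 *_) (sym (^-distribʳ-* 4 w (p + d))) ⟩
  16 * (w * (p + d)) ^ 4              ≤⟨ *-monoʳ-≤ 16 (^-monoˡ-≤ 4 wp+wd≤) ⟩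
  16 * (u * d) ^ 4                    ≡⟨ cong (16 *_) (^-distribʳ-* 4 u d) ⟩
  16 * (u ^ 4 * d ^ 4)                ≤⟨ *-monoʳ-≤ 16 (*-monoʳ-≤ (u ^ 4) d⁴≤) ⟩
  16 * (u ^ 4 * (u ^ 4 * C₀ * n'))    ≡⟨ lem₂ 16 (u ^ 4) C₀ n' ⟩
  u ^ 4 * (u ^ 4 * C₀) * (16 * n')    ≤⟨ *-monoʳ-≤ (u ^ 4 * (u ^ 4 * C₀)) n'≤ ⟩
  u ^ 4 * (u ^ 4 * C₀) * (15 * n)     ≡⟨ lem₃ 15 (u ^ 4) C₀ n ⟩
  u ^ 4 * 15 * (u ^ 4 * C₀ * n)       ≤⟨ *-monoˡ-≤ (u ^ 4 * C₀ * n) ratio ⟩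
  w ^ 4 * 16 * (u ^ 4 * C₀ * n)       ∎)
  where
  open ≤-Reasoning
  wp+wd≤ : w * (p + d) ≤ u * d
  wp+wd≤ = begin
    w * (p + d)       ≡⟨ *-distribˡ-+ w p d ⟩
    w * p + w * d     ≤⟨ +-monoˡ-≤ (w * d) (<⇒≤ (≰⇒> d≰)) ⟩
    suc w * d         ≡⟨ cong (_* d) (sym u≡) ⟩
    u * d             ∎
  lem₁ : ∀ b k x → b * k * x ≡ k * (b * x)
  lem₁ = solve-∀
  lem₂ : ∀ k a c n → k * (a * (a * c * n)) ≡ a * (a * c) * (k * n)
  lem₂ = solve-∀
  lem₃ : ∀ k a c n → a * (a * c) * (k * n) ≡ a * k * (a * c * n)
  lem₃ = solve-∀

module Coloring {X : Set} (_≟_ : DecidableEquality X) (w u δ₀ C₀ : ℕ) .{{_ : NonZero w}} .{{_ : NonZero δ₀}}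
  (u≡ : u ≡ suc w) (ratio : u ^ 4 * 15 ≤ w ^ 4 * 16) (large : 128 * (128 * 128) ≤ C₀) (net-coloring : NetColoring δ₀ C₀) where

  open Traces _≟_
  open DecMembership _≟_ using (_∈?_)

  Good : ∀ {N} → Vec X N → List (List X) → Set
  Good {N} xs ts = ∃ λ χ → ∃ λ d → d ^ 4 ≤ u ^ 4 * C₀ * N × (∀ {t} → t ∈ ts → ℤ.∣ dot (incidence xs t) χ ∣ ≤ d)

  incidence-norm : ∀ {N} (xs : Vec X N) t → ‖ incidence xs t ‖² ≤ N
  incidence-norm []       t = z≤n
  incidence-norm (x ∷ xs) t = +-mono-≤ (entry (does (x ∈? t))) (incidence-norm xs t)
    where
    entry : ∀ b → sq (if b then ℤ.1ℤ else ℤ.0ℤ) ≤ 1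
    entry true  = ≤-refl
    entry false = z≤n

  -- Traces are restricted to xs so that the packing takes place inside a ground set of size N. The
  -- rows do not notice, because only elements of xs are tested.
  incidence-filter : ∀ {N} (xs : Vec X N) t → incidence xs (List.filter (_∈? Vec.toList xs) t) ≡ incidence xs t
  incidence-filter xs t = go xs (λ x∈ → x∈)
    where
    go : ∀ {M} (ys : Vec X M) → (∀ {y} → y ∈ Vec.toList ys → y ∈ Vec.toList xs) →
      Vec.map (indicate (List.filter (_∈? Vec.toList xs) t)) ys ≡ Vec.map (indicate t) ys
    go []       ys⊆ = refl
    go (y ∷ ys) ys⊆ = cong₂ _∷_
      (indicate-cong {y} {List.filter (_∈? Vec.toList xs) t} {t} (λ y∈ → proj₁ (∈-filter⁻ (_∈? Vec.toList xs) y∈)) (λ y∈ → ∈-filter⁺ (_∈? Vec.toList xs) y∈ (ys⊆ (here refl))))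
      (go ys (ys⊆ ∘ there))

  small-case : ∀ N → N ≤ 128 → N ^ 4 ≤ u ^ 4 * C₀ * N
  small-case N N≤ = begin
    N ^ 4                          ≡⟨ lem N ⟩
    N * (N * N) * N                ≤⟨ *-monoˡ-≤ N (≤-trans (*-mono-≤ N≤ (*-mono-≤ N≤ N≤)) large) ⟩
    C₀ * N                         ≤⟨ *-monoˡ-≤ N (m≤n*m C₀ (u ^ 4) {{m^n≢0 u 4 {{subst NonZero (sym u≡) _}}}}) ⟩
    u ^ 4 * C₀ * N                 ∎
    where
    open ≤-Reasoning
    lem : ∀ n → n * (n * (n * (n * 1))) ≡ n * (n * n) * n
    lem = solve-∀

  module _ (ts : List (List X)) (ts! : ∀ {t} → t ∈ ts → Unique t) (consistent : Consistent (_∈ ts)) where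

    coloring : ∀ {N} → Acc _<_ N → (xs : Vec X N) → Unique (Vec.toList xs) → Good xs ts
    coloring {N} (acc rec) xs xs! with N ≤? 128
    -- The recursion stops where `NetColoring` no longer applies; there the trivial bound N is good
    -- enough because 128^3 ≤ C₀.
    ... | yes N≤ = Vec.replicate N Sign.+ , N , small-case N N≤ ,
      λ {t} _ → ≤-trans (∣dot∣≤‖‖² (incidence xs t) _) (incidence-norm xs t)
    ... | no  N≰ = combine (net-coloring N (RowOf xs traces) nets (<⇒≤ (≰⇒> N≰)))
      where
      traces : List (List X)
      traces = List.map (List.filter (_∈? Vec.toList xs)) ts

      traces! : ∀ {t} → t ∈ traces → Unique t
      traces! t∈ with ∈-map⁻ (List.filter (_∈? Vec.toList xs)) t∈
      ... | t , t∈ts , refl = Uniqueₚ.filter⁺ (_∈? Vec.toList xs) (ts! t∈ts)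

      traces⊆ : ∀ {t} → t ∈ traces → ∀ {x} → x ∈ t → x ∈ Vec.toList xs
      traces⊆ t∈ x∈ with ∈-map⁻ (List.filter (_∈? Vec.toList xs)) t∈
      ... | t , t∈ts , refl = proj₂ (∈-filter⁻ (_∈? Vec.toList xs) {xs = t} x∈)

      nets : ∀ e → Net (RowOf xs traces) (δ₀ ^ e)
      nets e = trace-net xs xs! traces traces! traces⊆ (filter-consistent (_∈? Vec.toList xs) ts consistent) (δ₀ ^ e) {{m^n≢0 δ₀ e}}

      combine : (∃ λ χ → ∃ λ χ' → ∃ λ g → N ≤ 16 * dist χ χ' × g ^ 4 ≤ C₀ * N × (∀ {r} → RowOf xs traces r → gap χ χ' r ≤ g)) → Good xs ts
      combine (χ , χ' , g , far , g⁴≤ , gap≤g) =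
        complete χ χ' ψ , g + d , fourth-power-step w u u≡ ratio C₀ g d N n g⁴≤ d⁴≤ 16n≤15N , bound
        where
        Y = agreement χ χ'
        n = ∣ Y ∣
        16n≤15N : 16 * n ≤ 15 * N
        16n≤15N = +-cancelʳ-≤ N (16 * n) (15 * N) (begin
          16 * n + N                    ≤⟨ +-monoʳ-≤ (16 * n) far ⟩
          16 * n + 16 * dist χ χ'       ≡⟨ sym (*-distribˡ-+ 16 n (dist χ χ')) ⟩
          16 * (n + dist χ χ')          ≡⟨ cong (16 *_) (∣agreement∣ χ χ') ⟩
          16 * N                        ≡⟨ +-comm N (15 * N) ⟩
          15 * N + N                    ∎)
          where open ≤-Reasoning
        n<N : n < N
        n<N = *-cancelˡ-< 16 n N (≤-<-trans 16n≤15N (*-monoˡ-< N {{>-nonZero (≤-trans (s≤s z≤n) (≰⇒> N≰))}} (m≤m+n 16 0)))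
        rest = coloring (rec n<N) (select Y xs) (select-unique Y xs xs!)
        ψ = proj₁ rest
        d = proj₁ (proj₂ rest)
        d⁴≤ = proj₁ (proj₂ (proj₂ rest))
        bound : ∀ {t} → t ∈ ts → ℤ.∣ dot (incidence xs t) (complete χ χ' ψ) ∣ ≤ g + d
        bound {t} t∈ = ≤-trans (∣dot-complete∣ (incidence xs t) χ χ' ψ) (+-mono-≤
          (gap≤g (_ , ∈-map⁺ (List.filter (_∈? Vec.toList xs)) t∈ , sym (incidence-filter xs t)))
          (subst (λ r → ℤ.∣ dot r ψ ∣ ≤ d) (sym (select-map (indicate t) Y xs)) (proj₂ (proj₂ (proj₂ rest)) t∈)))

    good : ∀ {N} (xs : Vec X N) → Unique (Vec.toList xs) → Good xs ts
    good {N} = coloring (<-wellFounded N)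

-- Shortest paths

≤ᴿ-trans : ∀ x y z → x ≤ᴿ y → y ≤ᴿ z → x ≤ᴿ z
≤ᴿ-trans x y z x≤y y≤z δ 0<δ = N₁ ⊔ N₂ , λ i N≤i → begin
  approx x i                              ≤⟨ proj₂ (x≤y (ℚ.½ ℚ.* δ) 0<δ/2) i (m⊔n≤o⇒m≤o N₁ N₂ N≤i) ⟩
  approx y i ℚ.+ ℚ.½ ℚ.* δ                ≤⟨ ℚₚ.+-monoˡ-≤ (ℚ.½ ℚ.* δ) (proj₂ (y≤z (ℚ.½ ℚ.* δ) 0<δ/2) i (m⊔n≤o⇒n≤o N₁ N₂ N≤i)) ⟩
  approx z i ℚ.+ ℚ.½ ℚ.* δ ℚ.+ ℚ.½ ℚ.* δ  ≡⟨ ℚₚ.+-assoc (approx z i) (ℚ.½ ℚ.* δ) (ℚ.½ ℚ.* δ) ⟩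
  approx z i ℚ.+ (ℚ.½ ℚ.* δ ℚ.+ ℚ.½ ℚ.* δ) ≡⟨ cong (λ h → approx z i ℚ.+ h) (trans (sym (ℚₚ.*-distribʳ-+ δ ℚ.½ ℚ.½)) (ℚₚ.*-identityˡ δ)) ⟩
  approx z i ℚ.+ δ                        ∎
  where
  open ℚₚ.≤-Reasoning
  0<δ/2 : 0ℚ ℚ.< ℚ.½ ℚ.* δ
  0<δ/2 = subst (ℚ._< ℚ.½ ℚ.* δ) (ℚₚ.*-zeroʳ ℚ.½) (ℚₚ.*-monoʳ-<-pos ℚ.½ 0<δ)
  N₁ N₂ : ℕ
  N₁ = proj₁ (x≤y (ℚ.½ ℚ.* δ) 0<δ/2)
  N₂ = proj₁ (y≤z (ℚ.½ ℚ.* δ) 0<δ/2)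

-- Addition of reals is termwise, so lengths of concatenated walks satisfy exact identities at every
-- approximation. Common summands can then be added or cancelled over ℚ, with the same index and the
-- same error.
≤ᴿ-transport : ∀ {x y x' y'} → (∀ i δ → approx x i ℚ.≤ approx y i ℚ.+ δ → approx x' i ℚ.≤ approx y' i ℚ.+ δ) →
  x ≤ᴿ y → x' ≤ᴿ y'
≤ᴿ-transport pointwise x≤y δ 0<δ = proj₁ (x≤y δ 0<δ) , λ i N≤i → pointwise i δ (proj₂ (x≤y δ 0<δ) i N≤i)

≤ᴿ-refl : ∀ x → x ≤ᴿ x
≤ᴿ-refl x δ 0<δ = 0 , λ i _ → subst (ℚ._≤ approx x i ℚ.+ δ) (ℚₚ.+-identityʳ (approx x i)) (ℚₚ.+-monoʳ-≤ (approx x i) (ℚₚ.<⇒≤ 0<δ))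

private
  +-cancelˡ-≤-ℚ : ∀ k {a b} → k ℚ.+ a ℚ.≤ k ℚ.+ b → a ℚ.≤ b
  +-cancelˡ-≤-ℚ k {a} {b} le = subst₂ ℚ._≤_ (cancel k a) (cancel k b) (ℚₚ.+-monoʳ-≤ (ℚ.- k) le)
    where
    open +-*-Solver
    cancel : ∀ k a → ℚ.- k ℚ.+ (k ℚ.+ a) ≡ a
    cancel = solve 2 (λ k a → :- k :+ (k :+ a) := a) refl

module _ {n m : ℕ} (G : WeightedDigraph n m) where
  open WeightedDigraph G

  length-◅◅ : ∀ {u x v} (p : Walk G u x) (q : Walk G x v) i →
    approx (length G (p ◅◅ q)) i ≡ approx (length G p) i ℚ.+ approx (length G q) i
  length-◅◅ ε             q i = sym (ℚₚ.+-identityˡ _)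
  length-◅◅ ((e , _) ◅ p) q i = trans (cong (λ k → approx (weight e) i ℚ.+ k) (length-◅◅ p q i)) (sym (ℚₚ.+-assoc (approx (weight e) i) _ _))

  vertices-source : ∀ {u v} (w : Walk G u v) → ∃ λ R → vertices G w ≡ u ∷ R
  vertices-source ε       = [] , refl
  vertices-source (e ◅ w) = vertices G w , refl

  vertices-split : ∀ {u v x} (w : Walk G u v) A {R} → vertices G w ≡ A ++ x ∷ R →
    ∃ λ (w₁ : Walk G u x) → ∃ λ (w₂ : Walk G x v) →
    w ≡ w₁ ◅◅ w₂ × vertices G w₁ ≡ A ++ x ∷ [] × vertices G w₂ ≡ x ∷ R
  vertices-split ε       []          refl = ε , ε , refl , refl , refl
  vertices-split ε       (_ ∷ [])    ()
  vertices-split ε       (_ ∷ _ ∷ _) ()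
  vertices-split (e ◅ w) []          refl = ε , e ◅ w , refl , refl , refl
  vertices-split (e ◅ w) (a ∷ A)     eq with refl , eq′ ← Listₚ.∷-injective eq =
    let w₁ , w₂ , w≡ , eq₁ , eq₂ = vertices-split w A eq′ in
    e ◅ w₁ , w₂ , cong (e ◅_) w≡ , cong (_ ∷_) eq₁ , eq₂

  edges-split : ∀ {u v e} (w : Walk G u v) A {R} → edges G w ≡ A ++ e ∷ R →
    ∃ λ (w₁ : Walk G u (proj₁ (ends e))) → ∃ λ (w₂ : Walk G (proj₂ (ends e)) v) →
    w ≡ w₁ ◅◅ ((e , refl) ◅ w₂) × edges G w₁ ≡ A × edges G w₂ ≡ R
  edges-split ε                []      ()
  edges-split ε                (_ ∷ _) ()
  edges-split ((e , refl) ◅ w) []      refl = ε , w , refl , refl , refl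
  edges-split (e ◅ w)          (a ∷ A) eq with refl , eq′ ← Listₚ.∷-injective eq =
    let w₁ , w₂ , w≡ , eq₁ , eq₂ = edges-split w A eq′ in
    e ◅ w₁ , w₂ , cong (e ◅_) w≡ , cong (_ ∷_) eq₁ , eq₂

  IsPath-◅◅ : ∀ {u x v} (p : Walk G u x) (q : Walk G x v) → IsPath G (p ◅◅ q) → IsPath G p × IsPath G q
  IsPath-◅◅ ε       q uniq = [] ∷ [] , uniq
  IsPath-◅◅ {u} (e ◅ p) q (u∉ ∷ uniq) =
    let p! , q! = IsPath-◅◅ p q uniq in All.tabulate (λ z∈ → All.lookup u∉ (vertices-◅◅ˡ p q z∈)) ∷ p! , q!
    where
    vertices-◅◅ˡ : ∀ {u x v} (p : Walk G u x) (q : Walk G x v) {z} → z ∈ vertices G p → z ∈ vertices G (p ◅◅ q)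
    vertices-◅◅ˡ ε       q (here refl) = subst (_ ∈_) (sym (proj₂ (vertices-source q))) (here refl)
    vertices-◅◅ˡ (e ◅ p) q (here eq)   = here eq
    vertices-◅◅ˡ (e ◅ p) q (there z∈)  = there (vertices-◅◅ˡ p q z∈)

  module _ (noNeg : NoNegativeCycle G) where

    shortcut : ∀ {u v} (w : Walk G u v) → ∃ λ (p : Walk G u v) → IsPath G p × length G p ≤ᴿ length G w
    shortcut ε = ε , [] ∷ [] , ≤ᴿ-refl 0ᴿ
    shortcut {u} (e ◅ w) with shortcut w
    ... | p , p! , p≤w with DecMembership._∈?_ Finₚ._≟_ u (vertices G p)
    ...   | no u∉ = e ◅ p , Allₚ.¬Any⇒All¬ _ u∉ ∷ p! ,
              ≤ᴿ-transport {length G p} {length G w} {length G (e ◅ p)} {length G (e ◅ w)} (λ i δ le →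
                subst (approx (length G (e ◅ p)) i ℚ.≤_) (sym (ℚₚ.+-assoc (approx (weight (proj₁ e)) i) _ δ)) (ℚₚ.+-monoʳ-≤ (approx (weight (proj₁ e)) i) le)) p≤w
    ...   | yes u∈ with ∈-∃++ u∈
    ...     | A , R , eq with vertices-split p A eq
    ...       | p₁ , p₂ , refl , _ , _ = p₂ , proj₂ (IsPath-◅◅ p₁ p₂ p!) ,
              ≤ᴿ-trans (length G p₂) (length G (e ◅ (p₁ ◅◅ p₂))) (length G (e ◅ w))
                (≤ᴿ-transport {0ᴿ} {length G (e ◅ p₁)} {length G p₂} {length G (e ◅ (p₁ ◅◅ p₂))} (λ i δ le → drop-cycle i δ le) (noNeg e p₁ (proj₁ (IsPath-◅◅ p₁ p₂ p!))))
                (≤ᴿ-transport {length G (p₁ ◅◅ p₂)} {length G w} {length G (e ◅ (p₁ ◅◅ p₂))} {length G (e ◅ w)} (λ i δ le →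
                subst (approx (length G (e ◅ (p₁ ◅◅ p₂))) i ℚ.≤_) (sym (ℚₚ.+-assoc (approx (weight (proj₁ e)) i) _ δ)) (ℚₚ.+-monoʳ-≤ (approx (weight (proj₁ e)) i) le)) p≤w)
      where
      drop-cycle : ∀ i δ → 0ℚ ℚ.≤ approx (length G (e ◅ p₁)) i ℚ.+ δ → approx (length G p₂) i ℚ.≤ approx (length G (e ◅ (p₁ ◅◅ p₂))) i ℚ.+ δ
      drop-cycle i δ le = begin
        l₂                                           ≡⟨ sym (ℚₚ.+-identityʳ l₂) ⟩
        l₂ ℚ.+ 0ℚ                                    ≤⟨ ℚₚ.+-monoʳ-≤ l₂ le ⟩
        l₂ ℚ.+ (ω ℚ.+ l₁ ℚ.+ δ)                      ≡⟨ regroup l₂ ω l₁ δ ⟩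
        ω ℚ.+ (l₁ ℚ.+ l₂) ℚ.+ δ                      ≡⟨ cong (λ l → ω ℚ.+ l ℚ.+ δ) (sym (length-◅◅ p₁ p₂ i)) ⟩
        ω ℚ.+ approx (length G (p₁ ◅◅ p₂)) i ℚ.+ δ   ∎
        where
        open ℚₚ.≤-Reasoning
        l₁ = approx (length G p₁) i
        l₂ = approx (length G p₂) i
        ω = approx (weight (proj₁ e)) i
        regroup : ∀ l₂ ω l₁ δ → l₂ ℚ.+ (ω ℚ.+ l₁ ℚ.+ δ) ≡ ω ℚ.+ (l₁ ℚ.+ l₂) ℚ.+ δ
        regroup = solve 4 (λ l₂ ω l₁ δ → l₂ :+ (ω :+ l₁ :+ δ) := ω :+ (l₁ :+ l₂) :+ δ) refl
          where open +-*-Solver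

    -- Exchanging ρ for a competitor σ gives a walk, and a shortcut of it competes with the whole path.
    subpath-shortest : ∀ {u x y v} (w₁ : Walk G u x) (ρ : Walk G x y) (w₂ : Walk G y v) →
      IsShortestPath G (w₁ ◅◅ (ρ ◅◅ w₂)) → IsShortestPath G ρ
    subpath-shortest w₁ ρ w₂ (π! , shortest) = ρ! , λ σ _ →
      let q , q! , q≤ = shortcut (w₁ ◅◅ (σ ◅◅ w₂)) in
      ≤ᴿ-transport {length G (w₁ ◅◅ (ρ ◅◅ w₂))} {length G (w₁ ◅◅ (σ ◅◅ w₂))} {length G ρ} {length G σ} (cancel-ends σ)
        (≤ᴿ-trans (length G (w₁ ◅◅ (ρ ◅◅ w₂))) (length G q) (length G (w₁ ◅◅ (σ ◅◅ w₂))) (shortest q q!) q≤)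
      where
      ρ! = proj₁ (IsPath-◅◅ ρ w₂ (proj₂ (IsPath-◅◅ w₁ (ρ ◅◅ w₂) π!)))
      cancel-ends : ∀ σ i δ → approx (length G (w₁ ◅◅ (ρ ◅◅ w₂))) i ℚ.≤ approx (length G (w₁ ◅◅ (σ ◅◅ w₂))) i ℚ.+ δ →
        approx (length G ρ) i ℚ.≤ approx (length G σ) i ℚ.+ δ
      cancel-ends σ i δ le = +-cancelˡ-≤-ℚ (l₁ ℚ.+ l₂) (subst₂ ℚ._≤_
        (trans (expand ρ) (regroup₁ l₁ (l ρ) l₂)) (trans (cong (ℚ._+ δ) (expand σ)) (regroup₂ l₁ (l σ) l₂ δ)) le)
        where
        l : ∀ {a b} → Walk G a b → ℚ
        l w = approx (length G w) i
        l₁ = l w₁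
        l₂ = l w₂
        expand : ∀ τ → l (w₁ ◅◅ (τ ◅◅ w₂)) ≡ l₁ ℚ.+ (l τ ℚ.+ l₂)
        expand τ = trans (length-◅◅ w₁ (τ ◅◅ w₂) i) (cong (λ k → l₁ ℚ.+ k) (length-◅◅ τ w₂ i))
        open +-*-Solver
        regroup₁ : ∀ a x b → a ℚ.+ (x ℚ.+ b) ≡ a ℚ.+ b ℚ.+ x
        regroup₁ = solve 3 (λ a x b → a :+ (x :+ b) := a :+ b :+ x) refl
        regroup₂ : ∀ a x b d → a ℚ.+ (x ℚ.+ b) ℚ.+ d ≡ a ℚ.+ b ℚ.+ (x ℚ.+ d)
        regroup₂ = solve 4 (λ a x b d → a :+ (x :+ b) :+ d := a :+ b :+ (x :+ d)) refl

    module _ (usp : UniqueShortestPaths G) where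

      shortest-unique : ∀ {x y} {ρ ρ' : Walk G x y} → IsShortestPath G ρ → IsShortestPath G ρ' → ρ ≡ ρ'
      shortest-unique {x} {y} s s' = let _ , _ , unique = usp x y in trans (sym (unique s)) (unique s')

      ShortestPath : Path G → Set
      ShortestPath p = IsShortestPath G (Path.walk p)

      vertices-between : ∀ {u v} (w : Walk G u v) → IsShortestPath G w → ∀ {x y} A B {C} →
        vertices G w ≡ A ++ x ∷ B ++ y ∷ C →
        ∃ λ (ρ : Walk G x y) → IsShortestPath G ρ × vertices G ρ ≡ x ∷ B ++ y ∷ []
      vertices-between w s {x} {y} A B eq with vertices-split w A eq
      ... | w₁ , w′ , refl , _ , eq′ with vertices-split w′ (x ∷ B) eq′
      ...   | ρ , w₂ , refl , eq-ρ , _ = ρ , subpath-shortest w₁ ρ w₂ s , eq-ρ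

      vertices-consistent : ∀ {u v u' v'} (w : Walk G u v) (w' : Walk G u' v') → IsShortestPath G w → IsShortestPath G w' →
        ∀ {x y} A B {C} A' B' {C'} → vertices G w ≡ A ++ x ∷ B ++ y ∷ C → vertices G w' ≡ A' ++ x ∷ B' ++ y ∷ C' → B ≡ B'
      vertices-consistent w w' s s' A B A' B' eq eq' with vertices-between w s A B eq | vertices-between w' s' A' B' eq'
      ... | ρ , sρ , eqρ | ρ' , sρ' , eqρ' with shortest-unique sρ sρ'
      ...   | refl = proj₁ (Listₚ.∷ʳ-injective B B' (Listₚ.∷-injectiveʳ (trans (sym eqρ) eqρ')))

      -- The piece between e and f runs from the target of e to the source of f. Its endpoints
      -- depend on e and f alone, so that uniqueness of shortest paths applies.
      edges-between : ∀ {u v} (w : Walk G u v) → IsShortestPath G w → ∀ {e f} A B {C} →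
        edges G w ≡ A ++ e ∷ B ++ f ∷ C →
        ∃ λ (ρ : Walk G (proj₂ (ends e)) (proj₁ (ends f))) → IsShortestPath G ρ × edges G ρ ≡ B
      edges-between w s {e} {f} A B eq with edges-split w A eq
      ... | w₁ , w′ , refl , _ , eq′ with edges-split w′ B eq′
      -- The edge e is moved to the end of the first part and f to the start of the last one.
      ...   | ρ , w₂ , refl , eq-ρ , _ = ρ , subpath-shortest (w₁ ◅◅ ((e , refl) ◅ ε)) ρ ((f , refl) ◅ w₂)
                (subst (IsShortestPath G) (sym (◅◅-assoc w₁ _ _)) s) , eq-ρ
        where open import Relation.Binary.Construct.Closure.ReflexiveTransitive.Properties using (◅◅-assoc)

      edges-consistent : ∀ {u v u' v'} (w : Walk G u v) (w' : Walk G u' v') → IsShortestPath G w → IsShortestPath G w' →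
        ∀ {e f} A B {C} A' B' {C'} → edges G w ≡ A ++ e ∷ B ++ f ∷ C → edges G w' ≡ A' ++ e ∷ B' ++ f ∷ C' → B ≡ B'
      edges-consistent w w' s s' A B A' B' eq eq' with edges-between w s A B eq | edges-between w' s' A' B' eq'
      ... | ρ , sρ , eqρ | ρ' , sρ' , eqρ' with shortest-unique sρ sρ'
      ...   | refl = trans (sym eqρ) eqρ'

  source-∈ : ∀ {u v} (w : Walk G u v) {e} → e ∈ edges G w → proj₁ (ends e) ∈ vertices G w
  source-∈ ((e , refl) ◅ w) (here refl) = here refl
  source-∈ (_ ◅ w)          (there e∈)  = there (source-∈ w e∈)

  -- A repeated edge would repeat its source among the vertices of the path.
  edges-unique : ∀ {u v} (w : Walk G u v) → IsPath G w → Unique (edges G w)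
  edges-unique ε                uniq        = []
  edges-unique ((e , refl) ◅ w) (u∉ ∷ uniq) =
    All.tabulate (λ f∈ → λ { refl → All.lookup u∉ (source-∈ w f∈) refl }) ∷ edges-unique w uniq

-- Discrepancy of shortest paths

-- One constant for all element types and all ground lists, so that the same C serves vertices and
-- edges, and every set of columns.
Colorable : ℕ → Set₁
Colorable C = ∀ {X : Set} (_≟_ : DecidableEquality X) (ts : List (List X)) →
  (∀ {t} → t ∈ ts → Unique t) → Consistent (_∈ ts) → ∀ {N} (xs : Vec X N) → Unique (Vec.toList xs) →
  ∃ λ χ → ∃ λ d → d ^ 4 ≤ C * N × (∀ {t} → t ∈ ts → ℤ.∣ dot (Traces.incidence _≟_ xs t) χ ∣ ≤ d)

colorable : ∃ Colorable
colorable = 65 ^ 4 * (16 * (1024 * 1024)) ^ 4 , λ _≟_ ts ts! consistent xs xs! →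
  -- The ratio 65/64 is so close to 1 that its fourth power is at most 16/15, the factor by which a
  -- round shrinks the uncolored part.
  Coloring.good _≟_ 64 65 (16 * 16) ((16 * (1024 * 1024)) ^ 4) refl (≤ᵇ⇒≤ (65 ^ 4 * 15) (64 ^ 4 * 16) tt) (≤ᵇ⇒≤ (128 * (128 * 128)) ((16 * (1024 * 1024)) ^ 4) tt)
    (net-coloring 16 1024 256 16384 refl refl refl refl refl (≤ᵇ⇒≤ 15 1024 tt) (λ q → 20 + 4 * q) (λ q → 60 + 17 * q) 26
      width-exponent (λ q → peak≡ 20 (1024 * 1024) refl q) price-exponent (≤ᵇ⇒≤ 1 26 tt) refl price≤)
    ts ts! consistent xs xs!
  where
  open ≤-Reasoning
  width-exponent : ∀ q → suc q ≤ 20 + 4 * q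
  width-exponent q = +-mono-≤ (m≤m+n 1 19) (m≤n*m q 4)
  peak≡ : ∀ t c → 2 ^ t ≡ c → ∀ q → 2 ^ (t + 4 * q) ≡ c * 16 ^ q
  peak≡ t c eq q = trans (^-distribˡ-+-* 2 t (4 * q)) (cong₂ _*_ eq (sym (^-*-assoc 2 4 q)))
  price-exponent : ∀ q i → i ≤ suc q → 26 + 17 * i ≤ 2 + (60 + 17 * q)
  price-exponent q i i≤ = begin
    26 + 17 * i           ≤⟨ +-monoʳ-≤ 26 (*-monoʳ-≤ 17 i≤) ⟩
    26 + 17 * suc q       ≡⟨ lem q ⟩
    43 + 17 * q           ≤⟨ +-monoˡ-≤ (17 * q) (≤ᵇ⇒≤ 43 62 tt) ⟩
    62 + 17 * q           ∎
    where
    lem : ∀ q → 26 + 17 * suc q ≡ 43 + 17 * q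
    lem = solve-∀
  price≤ : ∀ i → 26 + 17 * i ≤ 64 * 2 ^ i
  price≤ zero    = ≤ᵇ⇒≤ 26 64 tt
  price≤ (suc i) = begin
    26 + 17 * suc i                ≡⟨ lem i ⟩
    17 + (26 + 17 * i)             ≤⟨ +-monoˡ-≤ (26 + 17 * i) (≤-trans (≤ᵇ⇒≤ 17 26 tt) (m≤m+n 26 (17 * i))) ⟩
    26 + 17 * i + (26 + 17 * i)    ≤⟨ +-mono-≤ (price≤ i) (price≤ i) ⟩
    64 * 2 ^ i + 64 * 2 ^ i        ≡⟨ lem₂ 64 (2 ^ i) ⟩
    64 * (2 * 2 ^ i)               ∎
    where
    lem : ∀ i → 26 + 17 * suc i ≡ 17 + (26 + 17 * i)
    lem = solve-∀
    lem₂ : ∀ k p → k * p + k * p ≡ k * (2 * p)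
    lem₂ = solve-∀

minOverSigns-≤ : ∀ N f χ → minOverSigns N f ≤ f χ
minOverSigns-≤ zero    f []            = ≤-refl
minOverSigns-≤ (suc N) f (Sign.+ ∷ χ) = ≤-trans (m⊓n≤m _ _) (minOverSigns-≤ N (λ χ → f (Sign.+ ∷ χ)) χ)
minOverSigns-≤ (suc N) f (Sign.- ∷ χ) = ≤-trans (m⊓n≤n _ _) (minOverSigns-≤ N (λ χ → f (Sign.- ∷ χ)) χ)

maxOverSubsets-attained : ∀ N f → ∃ λ Y → maxOverSubsets N f ≡ f Y
maxOverSubsets-attained zero    f = [] , refl
maxOverSubsets-attained (suc N) f
  with maxOverSubsets-attained N (λ Y → f (inside ∷ Y)) | maxOverSubsets-attained N (λ Y → f (outside ∷ Y)) | ⊔-sel (maxOverSubsets N (λ Y → f (inside ∷ Y))) (maxOverSubsets N (λ Y → f (outside ∷ Y)))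
... | Y , eq | _ | inj₁ left  = inside ∷ Y , trans left eq
... | _ | Y , eq | inj₂ right = outside ∷ Y , trans right eq

‖columns‖∞-≤ : ∀ {k N d} (A : Matrix k N) Y χ → VecAll.All (λ r → ℤ.∣ dot (select Y r) χ ∣ ≤ d) A → ‖ columns A Y · χ ‖∞ ≤ d
‖columns‖∞-≤ []      Y χ []       = z≤n
‖columns‖∞-≤ (r ∷ A) Y χ (p ∷ ps) = ⊔-lub p (‖columns‖∞-≤ A Y χ ps)

herdisc-bound : ∀ {k N} (A : Matrix k N) K →
  (∀ Y → ∃ λ χ → ∃ λ d → d ^ 4 ≤ K × VecAll.All (λ r → ℤ.∣ dot (select Y r) χ ∣ ≤ d) A) → herdisc A ^ 4 ≤ K
herdisc-bound {N = N} A K bound with maxOverSubsets-attained N (λ Y → disc (columns A Y))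
... | Y , eq with bound Y
...   | χ , d , d⁴≤ , small = subst (λ h → h ^ 4 ≤ K) (sym eq) (≤-trans (^-monoˡ-≤ 4 disc≤d) d⁴≤)
  where
  disc≤d : disc (columns A Y) ≤ d
  disc≤d = ≤-trans (minOverSigns-≤ _ (λ x → ‖ columns A Y · x ‖∞) χ) (‖columns‖∞-≤ A Y χ small)

toList-tabulate : ∀ {A : Set} {N} (f : Fin N → A) → Vec.toList (Vec.tabulate f) ≡ List.tabulate f
toList-tabulate {N = zero}  f = refl
toList-tabulate {N = suc N} f = cong (f Fin.zero ∷_) (toList-tabulate (f ∘ Fin.suc))

module _ {N : ℕ} where

  open Traces (Finₚ._≟_ {N})
  open DecMembership (Finₚ._≟_ {N}) using (_∈?_)

  -- The vertex and edge incidence matrices are instances of this by computation, with f the vertex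
  -- or the edge list of a path.
  incidenceMatrix : ∀ {P : Set} {k} → (P → List (Fin N)) → Vec P k → Matrix k N
  incidenceMatrix f = Vec.map λ p → Vec.tabulate (indicate (f p))

  -- A column set Y is just another ground list without repetitions, so `Colorable` bounds each
  -- submatrix by C times the size of Y, which is at most N.
  incidenceMatrix-herdisc : ∀ {P : Set} {k} C → Colorable C → (f : P → List (Fin N)) (Π : Vec P k) {Q : P → Set} → VecAll.All Q Π →
    (∀ {p} → Q p → Unique (f p)) →
    (∀ {p p'} → Q p → Q p' → ∀ {x y} A B {C} A' B' {C'} → f p ≡ A ++ x ∷ B ++ y ∷ C → f p' ≡ A' ++ x ∷ B' ++ y ∷ C' → B ≡ B') →
    herdisc (incidenceMatrix f Π) ^ 4 ≤ C * N
  incidenceMatrix-herdisc {P} C color f Π {Q} allQ uniq consistent = herdisc-bound (incidenceMatrix f Π) (C * N) λ Y →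
    let χ , d , d⁴≤ , small = color Finₚ._≟_ ts ts! ts-consistent (select Y (Vec.allFin N))
          (select-unique Y (Vec.allFin N) (subst Unique (sym (toList-tabulate id)) (Uniqueₚ.allFin⁺ N)))
    in χ , d , ≤-trans d⁴≤ (*-monoʳ-≤ C (∣p∣≤n Y)) ,
       VecAllₚ.map⁺ (VecAllₚ.toList⁻ (All.tabulate λ {p} p∈ →
         subst (λ r → ℤ.∣ dot r χ ∣ ≤ d) (sym (row≡ Y p)) (small (∈-map⁺ f p∈))))
    where
    ts : List (List (Fin N))
    ts = List.map f (Vec.toList Π)
    has-Q : ∀ {p} → p ∈ Vec.toList Π → Q p
    has-Q = All.lookup (VecAllₚ.toList⁺ allQ)
    ts! : ∀ {t} → t ∈ ts → Unique t
    ts! t∈ with ∈-map⁻ f t∈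
    ... | p , p∈ , refl = uniq (has-Q p∈)
    ts-consistent : Consistent (_∈ ts)
    ts-consistent t∈ t'∈ {A = A} {B} {A' = A'} {B'} eq eq' with ∈-map⁻ f t∈ | ∈-map⁻ f t'∈
    ... | p , p∈ , refl | p' , p'∈ , refl = consistent (has-Q p∈) (has-Q p'∈) A B A' B' eq eq'
    row≡ : ∀ Y p → select Y (Vec.tabulate (indicate (f p))) ≡ incidence (select Y (Vec.allFin N)) (f p)
    row≡ Y p = trans (cong (select Y) (Vecₚ.tabulate-allFin (indicate (f p)))) (select-map (indicate (f p)) Y (Vec.allFin N))

module _ {n m : ℕ} (G : WeightedDigraph n m) (noNeg : NoNegativeCycle G) (usp : UniqueShortestPaths G) where

  shortestPaths-shortest : VecAll.All (ShortestPath G noNeg usp) (shortestPaths G usp)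
  shortestPaths-shortest = VecAllₚ.map⁺ (VecAll.universal (λ (u , v) → proj₁ (proj₂ (usp u v))) (Vec.allPairs (Vec.allFin n) (Vec.allFin n)))

  herdiscᵥ-bound : ∀ C → Colorable C → herdiscᵥ G (shortestPaths G usp) ^ 4 ≤ C * n
  herdiscᵥ-bound C color = incidenceMatrix-herdisc C color (λ p → vertices G (Path.walk p)) (shortestPaths G usp) shortestPaths-shortest
    (λ s → proj₁ s)
    (λ {p} {p'} s s' → vertices-consistent G noNeg usp (Path.walk p) (Path.walk p') s s')

  herdiscₑ-bound : ∀ C → Colorable C → herdiscₑ G (shortestPaths G usp) ^ 4 ≤ C * m
  herdiscₑ-bound C color = incidenceMatrix-herdisc C color (λ p → edges G (Path.walk p)) (shortestPaths G usp) shortestPaths-shortest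
    (λ {p} s → edges-unique G (Path.walk p) (proj₁ s))
    (λ {p} {p'} s s' → edges-consistent G noNeg usp (Path.walk p) (Path.walk p') s s')

theorem1p6 : ∃ λ (C : ℕ) → ∀ (n m : ℕ) (G : WeightedDigraph n m) →
    NoNegativeCycle G → (usp : UniqueShortestPaths G) →
    (herdiscᵥ G (shortestPaths G usp) ^ 4 ≤ C * n) ×
    (herdiscₑ G (shortestPaths G usp) ^ 4 ≤ C * m)
theorem1p6 = proj₁ colorable , λ n m G noNeg usp →
  herdiscᵥ-bound G noNeg usp (proj₁ colorable) (proj₂ colorable) , herdiscₑ-bound G noNeg usp (proj₁ colorable) (proj₂ colorable)
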